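{- Let $k \ge 3$ be an integer. If $G$ is a connected $k$-regular graph that is not isomorphic to the complete bipartite graph $K_{k,k}$, then $i(G) \le \frac{k-1}{2k-1}|V(G)|$.
   Context: All graphs are finite and simple. A dominating set of a graph $G$ is a set $S \subseteq V(G)$ such that every vertex not in $S$ has a neighbor in $S$. An independent dominating set is a dominating set that is also an independent set. The independent domination number $i(G)$ is the minimum size of an independent dominating set of $G$. -}

module Defs where

open import Data.Nat using (ℕ; zero; suc; _+_; _*_; _∸_; _≤_; _<?_)
import Relation.Nullary.Decidable
open import Data.Bool using (Bool; true; false; T)
open import Data.Fin using (Fin; toℕ)
open import Data.Fin.Subset using (Subset; _∈_; _∉_; ∣_∣)
open import Data.Vec.Functional using (Vector)
open import Data.Vec using (tabulate)
open import Data.List using (List; []; _∷_)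
open import Data.Product using (Σ; ∃; ∃-syntax; _×_; _,_)
open import Relation.Binary.PropositionalEquality using (_≡_)
open import Relation.Nullary using (¬_)
open import Function.Bundles using (_⤖_; Bijection)

record Graph (n : ℕ) : Set where
  field
    adj   : Fin n → Fin n → Bool
    sym   : ∀ u v → adj u v ≡ adj v u
    irrefl : ∀ v → adj v v ≡ false
open Graph public

Adjacent : ∀ {n} → Graph n → Fin n → Fin n → Set
Adjacent G u v = T (adj G u v)

nbhd : ∀ {n} → Graph n → Fin n → Subset n
nbhd G v = tabulate (λ u → adj G v u)

degree : ∀ {n} → Graph n → Fin n → ℕ
degree G v = ∣ nbhd G v ∣

Regular : ∀ {n} → ℕ → Graph n → Set
Regular k G = ∀ v → degree G v ≡ k

data Walk {n} (G : Graph n) : Fin n → Fin n → Set where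
  [] : ∀ {v} → Walk G v v
  _∷_ : ∀ {u v w} → Adjacent G u v → Walk G v w → Walk G u w

Connected : ∀ {n} → Graph n → Set
Connected G = ∀ u v → Walk G u v

isLow : ∀ {m} → ℕ → Fin m → Bool
isLow k i = Relation.Nullary.Decidable.⌊ toℕ i <? k ⌋

xor : Bool → Bool → Bool
xor true true = false
xor true false = true
xor false true = true
xor false false = false

xor-sym : ∀ a b → xor a b ≡ xor b a
xor-sym true true = Relation.Binary.PropositionalEquality.refl
xor-sym true false = Relation.Binary.PropositionalEquality.refl
xor-sym false true = Relation.Binary.PropositionalEquality.refl
xor-sym false false = Relation.Binary.PropositionalEquality.refl

xor-self : ∀ a → xor a a ≡ false
xor-self true = Relation.Binary.PropositionalEquality.refl
xor-self false = Relation.Binary.PropositionalEquality.refl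


CompleteBipartite : (k : ℕ) → Graph (k + k)
CompleteBipartite k = record
  { adj = λ u v → xor (isLow k u) (isLow k v)
  ; sym = λ u v → xor-sym (isLow k u) (isLow k v)
  ; irrefl = λ v → xor-self (isLow k v)
  }

record _≅_ {n m} (G : Graph n) (H : Graph m) : Set where
  field
    bij      : Fin n ⤖ Fin m
    preserve : ∀ u v → adj H (Bijection.to bij u) (Bijection.to bij v) ≡ adj G u v

Independent : ∀ {n} → Graph n → Subset n → Set
Independent G S = ∀ u v → u ∈ S → v ∈ S → ¬ Adjacent G u v

Dominating : ∀ {n} → Graph n → Subset n → Set
Dominating G S = ∀ v → v ∉ S → ∃[ u ] (u ∈ S × Adjacent G u v)

IndependentDominating : ∀ {n} → Graph n → Subset n → Set
IndependentDominating G S = Independent G S × Dominating G S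

{-# OPTIONS --safe #-}
-- Let k = r + 2.  For an independent dominating set S let dS w count the neighbours of w in S.  Counting the
-- edges leaving S, the claim |S|(2k - 1) ≤ (k - 1)n says that the average of dS over the complement is at most
-- k - 1, that is, the set J of vertices with all neighbours in S satisfies |J| ≤ Σ (k - 1 - dS w), summed over
-- the w ∉ S outside J.
-- Choose S of minimum size.  A set W of pairwise non-adjacent vertices outside S, exchanged for a set D ⊇ N(W) ∩ S,
-- leaves at least |D| - |W| vertices undominated; all local structure comes from such exchanges.  In particular at
-- least dS w vertices u ∉ S have N(u) ∩ S ⊆ N(w) ∩ S.  Hence every t ∈ J pays its unit to vertices w with
-- N(w) ∩ S ⊆ N(t), except in two tight situations where the surplus is one too small:
--  * a vertex s all of whose neighbours but one are in J, the exceptional one having s as its only neighbour in S;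
--  * a block: t together with k - 1 vertices sharing k - 1 of its neighbours.
-- Both are handled by breaking ties among the minimum S: the number of stars (components K_{1,k-1} of G - S whose
-- centre has one neighbour in S) is maximal, then two counts of tight configurations (TW and Cl) are minimal.
-- Exchanging the two sides of a block creates a star, so each block sees a star which is destroyed by this
-- exchange; the block charges the star's neighbour s in S, and further exchanges show s can afford it.
module Submission where

open import Defs hiding (sym)
open import Data.Nat using (ℕ; zero; suc; _+_; _*_; _∸_; _≤_; _<_; z≤n; s≤s; _≤?_; >-nonZero) renaming (_≟_ to _≟ℕ_)
open import Data.Nat.Properties hiding (_≟_)
open import Data.Bool using (true; false; T)
open import Data.Bool.Properties using (T?)
open import Data.Fin as Fin using (Fin; zero; suc; toℕ; fromℕ<; punchOut)
open import Data.Fin.Properties as FinP using (_≟_; any?; all?)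
open import Data.Fin.Subset using (Subset; _∈_; _∉_; ∣_∣)
open import Data.Fin.Subset.Properties using (_∈?_; anySubset?; drop-there)
open import Data.Vec using ([]; _∷_; tabulate; there)
open import Data.Vec.Properties using (lookup∘tabulate; []=⇒lookup; lookup⇒[]=)
open import Data.Product using (∃; ∃-syntax; _×_; _,_; proj₁; proj₂)
open import Data.Sum using (_⊎_; inj₁; inj₂; [_,_])
open import Data.Unit using (tt)
open import Data.Empty using (⊥; ⊥-elim)
open import Function using (id)
open import Function.Bundles using (mk⤖)
open import Relation.Nullary using (¬_; Dec; yes; no; ¬?; _×-dec_; _⊎-dec_; _→-dec_)
open import Relation.Nullary.Decidable using (⌊_⌋; decidable-stable)
open import Relation.Unary using (Decidable)
open import Relation.Binary.Definitions using (tri<; tri≈; tri>)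
open import Relation.Binary.PropositionalEquality hiding ([_]; J)
open import Algebra.Properties.CommutativeMonoid.Sum +-0-commutativeMonoid using (sum; ∑-distrib-+; ∑-comm)
open import Algebra.Properties.Semiring.Sum +-*-semiring using (*-distribˡ-sum)

-- A vertex w outside S can spend k - 1 - dS w: a private vertex has k - 2 units, a vertex with k -
-- 1 neighbours in S has none. This explains the two tight situations. A `Bad` vertex has k - 2
-- units for k - 1 members of J, so each of them asks it for half a unit only, which it can afford
-- because k ≥ 3 gives k - 1 ≤ 2(k - 2). The other half is missing only if all of them are twins
-- (`Tw`), and exchanging s for its private vertex dissolves that configuration. In a block, the k -
-- 1 vertices supplied by the exchange argument have nothing to spend, so a private vertex further
-- away must pay; maximality of the number of stars is what produces it. The graph K_{k,k} is the
-- case in which everything that the exchange argument finds below t is a twin of t: k twins force a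
-- connected graph to be K_{k,k}. The order of the tie-breaks follows the exchanges: flipping a
-- `Bad` vertex never lowers the number of stars, and a block exchange that merely trades one star
-- for another is judged by `Cl` once `TW` is known not to grow.

sum-mono : ∀ {n} {f g : Fin n → ℕ} → (∀ i → f i ≤ g i) → sum f ≤ sum g
sum-mono {zero} f≤g = z≤n
sum-mono {suc n} f≤g = +-mono-≤ (f≤g zero) (sum-mono (λ i → f≤g (suc i)))

term≤sum : ∀ {n} (f : Fin n → ℕ) i → f i ≤ sum f
term≤sum f zero = m≤m+n _ _
term≤sum f (suc i) = ≤-trans (term≤sum (λ j → f (suc j)) i) (m≤n+m _ _)

-- Cardinalities of decidable sets as sums of indicators

𝟙 : ∀ {P : Set} → Dec P → ℕ
𝟙 (yes _) = 1
𝟙 (no _) = 0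

𝟙-yes : ∀ {P : Set} (P? : Dec P) → P → 𝟙 P? ≡ 1
𝟙-yes (yes _) p = refl
𝟙-yes (no ¬p) p = ⊥-elim (¬p p)

𝟙-no : ∀ {P : Set} (P? : Dec P) → ¬ P → 𝟙 P? ≡ 0
𝟙-no (yes p) ¬p = ⊥-elim (¬p p)
𝟙-no (no _) ¬p = refl

𝟙-mono : ∀ {P Q : Set} (P? : Dec P) (Q? : Dec Q) → (P → Q) → 𝟙 P? ≤ 𝟙 Q?
𝟙-mono (yes p) Q? f = ≤-reflexive (sym (𝟙-yes Q? (f p)))
𝟙-mono (no _) Q? f = z≤n

𝟙≤ : ∀ {P : Set} (P? : Dec P) {m} → (P → 1 ≤ m) → 𝟙 P? ≤ m
𝟙≤ (yes p) f = f p
𝟙≤ (no _) f = z≤n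

module _ {n : ℕ} where

  # : {P : Fin n → Set} → Decidable P → ℕ
  # P? = sum (λ v → 𝟙 (P? v))

  #-mono : ∀ {P Q : Fin n → Set} (P? : Decidable P) (Q? : Decidable Q) →
           (∀ v → P v → Q v) → # P? ≤ # Q?
  #-mono P? Q? f = sum-mono (λ v → 𝟙-mono (P? v) (Q? v) (f v))

  #-cong : ∀ {P Q : Fin n → Set} (P? : Decidable P) (Q? : Decidable Q) →
           (∀ v → P v → Q v) → (∀ v → Q v → P v) → # P? ≡ # Q?
  #-cong P? Q? f g = ≤-antisym (#-mono P? Q? f) (#-mono Q? P? g)

  #-∪ : ∀ {P Q R : Fin n → Set} (P? : Decidable P) (Q? : Decidable Q) (R? : Decidable R) →
        (∀ v → P v → Q v ⊎ R v) → # P? ≤ # Q? + # R?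
  #-∪ P? Q? R? f =
    ≤-trans (sum-mono pointwise) (≤-reflexive (∑-distrib-+ (λ v → 𝟙 (Q? v)) (λ v → 𝟙 (R? v))))
    where
    pointwise : ∀ v → 𝟙 (P? v) ≤ 𝟙 (Q? v) + 𝟙 (R? v)
    pointwise v = 𝟙≤ (P? v) λ p → case′ (f v p)
      where
      case′ : _ ⊎ _ → 1 ≤ 𝟙 (Q? v) + 𝟙 (R? v)
      case′ (inj₁ q) = ≤-trans (≤-reflexive (sym (𝟙-yes (Q? v) q))) (m≤m+n _ _)
      case′ (inj₂ r) = ≤-trans (≤-reflexive (sym (𝟙-yes (R? v) r))) (m≤n+m _ _)

  #-⊎ : ∀ {P Q R : Fin n → Set} (P? : Decidable P) (Q? : Decidable Q) (R? : Decidable R) →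
        (∀ v → Q v → P v) → (∀ v → R v → P v) → (∀ v → Q v → R v → ⊥) →
        # Q? + # R? ≤ # P?
  #-⊎ P? Q? R? f g disj =
    ≤-trans (≤-reflexive (sym (∑-distrib-+ (λ v → 𝟙 (Q? v)) (λ v → 𝟙 (R? v))))) (sum-mono pointwise)
    where
    pointwise : ∀ v → 𝟙 (Q? v) + 𝟙 (R? v) ≤ 𝟙 (P? v)
    pointwise v with Q? v | R? v
    ... | yes q | yes r = ⊥-elim (disj v q r)
    ... | yes q | no _ = ≤-reflexive (sym (𝟙-yes (P? v) (f v q)))
    ... | no _ | yes r = ≤-reflexive (sym (𝟙-yes (P? v) (g v r)))
    ... | no _ | no _ = z≤n

  1≤# : ∀ {P : Fin n → Set} (P? : Decidable P) {v} → P v → 1 ≤ # P?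
  1≤# P? {v} p = ≤-trans (≤-reflexive (sym (𝟙-yes (P? v) p))) (term≤sum (λ u → 𝟙 (P? u)) v)

  #≡0 : ∀ {P : Fin n → Set} (P? : Decidable P) → (∀ v → ¬ P v) → # P? ≤ 0
  #≡0 P? none = ≤-trans (sum-mono {g = λ _ → 0} (λ v → ≤-reflexive (𝟙-no (P? v) (none v)))) (zeros n)
    where
    zeros : ∀ m → sum {m} (λ _ → 0) ≤ 0
    zeros zero = z≤n
    zeros (suc m) = zeros m

#-unique : ∀ {n} {P : Fin n → Set} (P? : Decidable P) → (∀ u v → P u → P v → u ≡ v) → # P? ≤ 1
#-unique {zero} P? uniq = z≤n
#-unique {suc n} P? uniq with P? zero
... | yes p = +-monoʳ-≤ 1 (#≡0 (λ v → P? (suc v)) (λ v q → FinP.0≢1+n (uniq _ _ p q)))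
... | no _ = #-unique (λ v → P? (suc v)) (λ u v p q → FinP.suc-injective (uniq _ _ p q))

module _ {n : ℕ} where

  1≤#⇒∃ : ∀ {P : Fin n → Set} (P? : Decidable P) → 1 ≤ # P? → ∃ P
  1≤#⇒∃ P? 1≤ with any? P?
  ... | yes e = e
  ... | no ¬e = ⊥-elim (<⇒≱ 1≤ (#≡0 P? (λ v p → ¬e (v , p))))

  #-singleton : ∀ (a : Fin n) → # (λ v → v ≟ a) ≡ 1
  #-singleton a = ≤-antisym (#-unique (λ v → v ≟ a) (λ u v p q → trans p (sym q)))
                            (1≤# (λ v → v ≟ a) refl)

  #-∪⁅⁆ : ∀ {P Q : Fin n → Set} (P? : Decidable P) (Q? : Decidable Q) (a : Fin n) →
          (∀ v → P v → Q v ⊎ v ≡ a) → # P? ≤ # Q? + 1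
  #-∪⁅⁆ P? Q? a f = ≤-trans (#-∪ P? Q? (λ v → v ≟ a) f)
                            (≤-reflexive (cong (# Q? +_) (#-singleton a)))

  #-⊎⁅⁆ : ∀ {P Q : Fin n → Set} (P? : Decidable P) (Q? : Decidable Q) (a : Fin n) →
          (∀ v → Q v → P v) → P a → ¬ Q a → # Q? + 1 ≤ # P?
  #-⊎⁅⁆ {P} {Q} P? Q? a f p ¬q =
    ≤-trans (≤-reflexive (cong (# Q? +_) (sym (#-singleton a))))
            (#-⊎ P? Q? (λ v → v ≟ a) f (λ v e → subst P (sym e) p)
              (λ v q e → ¬q (subst Q e q)))

  -- Used to identify neighbourhoods: once k neighbours of a vertex are known, regularity leaves no
  -- others.
  #⊆⇒⊇ : ∀ {P Q : Fin n → Set} (P? : Decidable P) (Q? : Decidable Q) →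
         (∀ v → P v → Q v) → # Q? ≤ # P? → ∀ v → Q v → P v
  #⊆⇒⊇ P? Q? f le v q with P? v
  ... | yes p = p
  ... | no ¬p = ⊥-elim (<⇒≱ (≤-trans (≤-reflexive (+-comm 1 _)) (#-⊎⁅⁆ Q? P? v f q ¬p)) le)

  #-diff : ∀ {P Q : Fin n → Set} (P? : Decidable P) (Q? : Decidable Q) →
           # Q? < # P? → ∃[ v ] P v × ¬ Q v
  #-diff P? Q? lt with any? (λ v → P? v ×-dec ¬? (Q? v))
  ... | yes e = e
  ... | no ¬e = ⊥-elim (<⇒≱ lt (#-mono P? Q? sub))
    where
    sub : ∀ v → _ → _
    sub v p with Q? v
    ... | yes q = q
    ... | no ¬q = ⊥-elim (¬e (v , p , ¬q))

  #-other : ∀ {P : Fin n → Set} (P? : Decidable P) → 2 ≤ # P? → ∀ a → ∃[ v ] P v × v ≢ a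
  #-other P? 2≤ a = #-diff P? (λ v → v ≟ a) (≤-trans (≤-reflexive (cong suc (#-singleton a))) 2≤)

  2≤# : ∀ {P : Fin n → Set} (P? : Decidable P) {u v} → P u → P v → u ≢ v → 2 ≤ # P?
  2≤# P? {u} {v} p q u≢v =
    ≤-trans (≤-reflexive (cong (_+ 1) (sym (#-singleton u))))
            (#-⊎⁅⁆ P? (λ w → w ≟ u) v (λ w e → subst _ (sym e) p) q (λ e → u≢v (sym e)))

  #≤1⇒≡ : ∀ {P : Fin n → Set} (P? : Decidable P) → # P? ≤ 1 → ∀ {u v} → P u → P v → u ≡ v
  #≤1⇒≡ P? le {u} {v} p q with u ≟ v
  ... | yes e = e
  ... | no ne = ⊥-elim (<⇒≱ (2≤# P? p q ne) le)

minimal : ∀ {A : Set} (search : ∀ {Q : A → Set} → Decidable Q → Dec (∃ Q)) →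
          ∀ {P : A → Set} (P? : Decidable P) (f : A → ℕ) → ∃ P →
          ∃[ v ] P v × (∀ u → P u → f v ≤ f u)
minimal {A} search {P} P? f (v , p) = go (f v) v p ≤-refl
  where
  go : ∀ b v → P v → f v ≤ b → ∃[ v ] P v × (∀ u → P u → f v ≤ f u)
  go b v p le with search (λ u → P? u ×-dec (f u <? f v))
  ... | no ¬e = v , p , λ u q → ≮⇒≥ (λ lt → ¬e (u , q , lt))
  go zero v p le | yes (u , q , lt) = ⊥-elim (<⇒≱ (<-≤-trans lt le) z≤n)
  go (suc b) v p le | yes (u , q , lt) = go b u q (≤-pred (<-≤-trans lt le))

∣∣≡# : ∀ {n} (p : Subset n) → ∣ p ∣ ≡ # (_∈? p)
∣∣≡# [] = refl
∣∣≡# (true ∷ p) = cong suc (trans (∣∣≡# p) (#-cong (_∈? p) (λ v → suc v ∈? (true ∷ p)) (λ v → there) (λ v → drop-there)))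
∣∣≡# (false ∷ p) = trans (∣∣≡# p) (#-cong (_∈? p) (λ v → suc v ∈? (false ∷ p)) (λ v → there) (λ v → drop-there))

⟦_⟧ : ∀ {n} {P : Fin n → Set} → Decidable P → Subset n
⟦ P? ⟧ = tabulate (λ v → ⌊ P? v ⌋)

∈⟦⟧⁺ : ∀ {n} {P : Fin n → Set} (P? : Decidable P) {v} → P v → v ∈ ⟦ P? ⟧
∈⟦⟧⁺ P? {v} p = lookup⇒[]= v ⟦ P? ⟧ (trans (lookup∘tabulate _ v) (isTrue (P? v)))
  where
  isTrue : (d : Dec _) → ⌊ d ⌋ ≡ true
  isTrue (yes _) = refl
  isTrue (no ¬p) = ⊥-elim (¬p p)

∈⟦⟧⁻ : ∀ {n} {P : Fin n → Set} (P? : Decidable P) {v} → v ∈ ⟦ P? ⟧ → P v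
∈⟦⟧⁻ P? {v} v∈ = witness (P? v) (trans (sym (lookup∘tabulate _ v)) ([]=⇒lookup v∈))
  where
  witness : (d : Dec _) → ⌊ d ⌋ ≡ true → _
  witness (yes p) _ = p

#⟦⟧ : ∀ {n} {P : Fin n → Set} (P? : Decidable P) → # (_∈? ⟦ P? ⟧) ≡ # P?
#⟦⟧ P? = #-cong (_∈? ⟦ P? ⟧) P? (λ v → ∈⟦⟧⁻ P?) (λ v → ∈⟦⟧⁺ P?)

#≤n : ∀ {n} {P : Fin n → Set} (P? : Decidable P) → # P? ≤ n
#≤n {zero} P? = z≤n
#≤n {suc n} P? = +-mono-≤ (𝟙≤ (P? zero) (λ _ → ≤-refl)) (#≤n (λ v → P? (suc v)))

#-Σ≤ : ∀ {m n} {Q : Fin m → Fin n → Set} (Q? : ∀ t → Decidable (Q t)) {P : Fin n → Set} (P? : Decidable P) →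
       (∀ t v → Q t v → P v) → (∀ t t′ v → Q t v → Q t′ v → t ≡ t′) → sum (λ t → # (Q? t)) ≤ # P?
#-Σ≤ {m} Q? P? sub uniq = ≤-trans (≤-reflexive (∑-comm (λ t v → 𝟙 (Q? t v)))) (sum-mono pointwise)
  where
  pointwise : ∀ v → # (λ t → Q? t v) ≤ 𝟙 (P? v)
  pointwise v with P? v
  ... | yes _ = #-unique (λ t → Q? t v) (λ t t′ → uniq t t′ v)
  ... | no ¬p = #≡0 (λ t → Q? t v) (λ t q → ¬p (sub t v q))

#≤-Σ : ∀ {m n} {Q : Fin m → Fin n → Set} (Q? : ∀ t → Decidable (Q t)) {P : Fin n → Set} (P? : Decidable P) →
       (∀ v → P v → ∃[ t ] Q t v) → # P? ≤ sum (λ t → # (Q? t))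
#≤-Σ {m} Q? P? sub = ≤-trans (sum-mono pointwise) (≤-reflexive (sym (∑-comm (λ t v → 𝟙 (Q? t v)))))
  where
  pointwise : ∀ v → 𝟙 (P? v) ≤ # (λ t → Q? t v)
  pointwise v = 𝟙≤ (P? v) λ p → 1≤# (λ t → Q? t v) (proj₂ (sub v p))

-- Regular graphs and maximal independent sets

module RegularGraph {n : ℕ} (G : Graph n) (r : ℕ) (1≤r : 1 ≤ r) (regular : Regular (suc (suc r)) G) where

  infix 4 _~_ _~?_

  _~_ : Fin n → Fin n → Set
  u ~ v = Adjacent G u v

  _~?_ : ∀ u v → Dec (u ~ v)
  u ~? v = T? (adj G u v)

  ~-sym : ∀ {u v} → u ~ v → v ~ u
  ~-sym {u} {v} = subst T (Graph.sym G u v)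

  ~⇒≢ : ∀ {u v} → u ~ v → u ≢ v
  ~⇒≢ {u} u~u refl = subst T (Graph.irrefl G u) u~u

  k : ℕ
  k = suc (suc r)

  deg : ∀ v → # (v ~?_) ≡ k
  deg v = trans (#-cong (v ~?_) (_∈? nbhd G v)
                   (λ u e → lookup⇒[]= u _ (trans (lookup∘tabulate _ u) (T⇒true e)))
                   (λ u e → true⇒T (trans (sym (lookup∘tabulate _ u)) ([]=⇒lookup e))))
                (trans (sym (∣∣≡# (nbhd G v))) (regular v))
    where
    T⇒true : ∀ {b} → T b → b ≡ true
    T⇒true {true} _ = refl
    true⇒T : ∀ {b} → b ≡ true → T b
    true⇒T refl = tt

  _⊆ᴺ_ : Fin n → Fin n → Set
  u ⊆ᴺ v = ∀ y → u ~ y → v ~ y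

  _⊆ᴺ?_ : ∀ u v → Dec (u ⊆ᴺ v)
  u ⊆ᴺ? v = all? (λ y → (u ~? y) →-dec (v ~? y))

  ⊆ᴺ-sym : ∀ {u v} → u ⊆ᴺ v → v ⊆ᴺ u
  ⊆ᴺ-sym {u} {v} u⊆v = #⊆⇒⊇ (u ~?_) (v ~?_) u⊆v (≤-reflexive (trans (deg v) (sym (deg u))))

  ID : Subset n → Set
  ID = IndependentDominating G

  size : Subset n → ℕ
  size S = # (_∈? S)

  abstract
    Independent? : ∀ S → Dec (Independent G S)
    Independent? S = all? (λ u → all? (λ v → (u ∈? S) →-dec ((v ∈? S) →-dec ¬? (u ~? v))))

    ID? : ∀ S → Dec (ID S)
    ID? S = Independent? S ×-dec
            all? (λ v → ¬? (v ∈? S) →-dec any? (λ u → (u ∈? S) ×-dec (u ~? v)))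

  -- An independent set containing I with the smallest complement is maximal, hence dominating. The
  -- last clause is what the exchange bound needs: a newcomer has no neighbour in I.
  extend : ∀ {I : Fin n → Set} (I? : Decidable I) → (∀ {u v} → I u → I v → ¬ u ~ v) →
           ∃[ X ] ID X × (∀ v → v ∈ X → I v ⊎ (∀ u → I u → ¬ u ~ v))
  extend {I} I? I-indep = X , (X-ind , X-dom) , X-new
    where
    U : Fin n → Set
    U v = ∀ u → I u → ¬ u ~ v
    U? : Decidable U
    U? v = all? (λ u → I? u →-dec ¬? (u ~? v))
    P : Subset n → Set
    P X = Independent G X × (∀ v → I v → v ∈ X) × (∀ v → v ∈ X → I v ⊎ U v)
    P? : Decidable P
    P? X = Independent? X ×-dec all? (λ v → I? v →-dec (v ∈? X)) ×-dec
           all? (λ v → (v ∈? X) →-dec (I? v ⊎-dec U? v))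
    best : ∃[ X ] P X × (∀ Y → P Y → # (λ v → ¬? (v ∈? X)) ≤ # (λ v → ¬? (v ∈? Y)))
    best = minimal anySubset? P? (λ X → # (λ v → ¬? (v ∈? X)))
             (⟦ I? ⟧ , (λ u v u∈ v∈ → I-indep (∈⟦⟧⁻ I? u∈) (∈⟦⟧⁻ I? v∈))
                     , (λ v → ∈⟦⟧⁺ I?) , (λ v v∈ → inj₁ (∈⟦⟧⁻ I? v∈)))
    X : Subset n
    X = proj₁ best
    X-ind : Independent G X
    X-ind = proj₁ (proj₁ (proj₂ best))
    I⊆X : ∀ v → I v → v ∈ X
    I⊆X = proj₁ (proj₂ (proj₁ (proj₂ best)))
    X-new : ∀ v → v ∈ X → I v ⊎ U v
    X-new = proj₂ (proj₂ (proj₁ (proj₂ best)))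
    X-dom : Dominating G X
    X-dom v v∉ with any? (λ u → (u ∈? X) ×-dec (u ~? v))
    ... | yes e = e
    ... | no ¬e = ⊥-elim (<⇒≱ smaller (proj₂ (proj₂ best) Y Y-P))
      where
      v? : Decidable (λ u → u ∈ X ⊎ u ≡ v)
      v? u = (u ∈? X) ⊎-dec (u ≟ v)
      Y : Subset n
      Y = ⟦ v? ⟧
      Y-ind : ∀ {a b} → a ∈ X ⊎ a ≡ v → b ∈ X ⊎ b ≡ v → ¬ a ~ b
      Y-ind (inj₁ a) (inj₁ b) = X-ind _ _ a b
      Y-ind (inj₁ a) (inj₂ refl) e = ¬e (_ , a , e)
      Y-ind (inj₂ refl) (inj₁ b) e = ¬e (_ , b , ~-sym e)
      Y-ind (inj₂ refl) (inj₂ refl) e = ~⇒≢ e refl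
      Y-P : P Y
      Y-P = (λ a b a∈ b∈ → Y-ind (∈⟦⟧⁻ v? a∈) (∈⟦⟧⁻ v? b∈))
          , (λ a i → ∈⟦⟧⁺ v? (inj₁ (I⊆X a i)))
          , (λ a a∈ → [ X-new a , (λ { refl → inj₂ (λ u i e → ¬e (u , I⊆X u i , e)) }) ] (∈⟦⟧⁻ v? a∈))
      smaller : # (λ u → ¬? (u ∈? Y)) < # (λ u → ¬? (u ∈? X))
      smaller = ≤-trans (≤-reflexive (+-comm 1 _))
        (#-⊎⁅⁆ (λ u → ¬? (u ∈? X)) (λ u → ¬? (u ∈? Y)) v (λ u u∉ u∈ → u∉ (∈⟦⟧⁺ v? (inj₁ u∈))) v∉ (λ v∉Y → v∉Y (∈⟦⟧⁺ v? (inj₂ refl))))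

  -- Configurations around a fixed set S

  module At (S : Subset n) where

    dS? : ∀ w → Decidable (λ y → y ∈ S × w ~ y)
    dS? w y = (y ∈? S) ×-dec (w ~? y)

    dS : Fin n → ℕ
    dS w = # (dS? w)

    _⊑_ : Fin n → Fin n → Set
    u ⊑ w = ∀ y → y ∈ S → u ~ y → w ~ y

    J : Fin n → Set
    J t = t ∉ S × (∀ y → t ~ y → y ∈ S)

    Priv : Fin n → Fin n → Set
    Priv w s = w ∉ S × s ∈ S × w ~ s × (∀ y → y ∈ S → w ~ y → y ≡ s)

    abstract
      _⊑?_ : ∀ u w → Dec (u ⊑ w)
      u ⊑? w = all? (λ y → (y ∈? S) →-dec ((u ~? y) →-dec (w ~? y)))

      J? : Decidable J
      J? t = ¬? (t ∈? S) ×-dec all? (λ y → (t ~? y) →-dec (y ∈? S))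

      Priv? : ∀ w s → Dec (Priv w s)
      Priv? w s = ¬? (w ∈? S) ×-dec (s ∈? S) ×-dec (w ~? s) ×-dec
                  all? (λ y → (y ∈? S) →-dec ((w ~? y) →-dec (y ≟ s)))

    m : Fin n → ℕ
    m s = # (λ w → Priv? w s)

    JN? : ∀ s → Decidable (λ t → J t × s ~ t)
    JN? s t = J? t ×-dec (s ~? t)

    j : Fin n → ℕ
    j s = # (JN? s)

    -- By `m+j≤k` the second bound is then an equality: the neighbours of s are one private vertex
    -- and k - 1 members of J.
    Bad : Fin n → Set
    Bad s = m s ≡ 1 × suc r ≤ j s

    Bad? : Decidable Bad
    Bad? s = (m s ≟ℕ 1) ×-dec (suc r ≤? j s)

    Star : Fin n → Set
    Star v = v ∉ S × dS v ≡ 1 × (∀ u → v ~ u → u ∉ S → dS u ≡ suc r)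

    -- Meant for t in J and x a neighbour of t: the two inclusions say that the neighbours of b in S
    -- are those of t except x, so b has exactly one neighbour outside S.
    InB : Fin n → Fin n → Fin n → Set
    InB t x b = b ∉ S × (∀ y → y ∈ S → b ~ y → t ~ y × y ≢ x) × (∀ y → t ~ y → y ≢ x → b ~ y)

    abstract
      Star? : Decidable Star
      Star? v = ¬? (v ∈? S) ×-dec (dS v ≟ℕ 1) ×-dec
                all? (λ u → (v ~? u) →-dec (¬? (u ∈? S) →-dec (dS u ≟ℕ suc r)))

      InB? : ∀ t x → Decidable (InB t x)
      InB? t x b = ¬? (b ∈? S) ×-dec
                   all? (λ y → (y ∈? S) →-dec ((b ~? y) →-dec ((t ~? y) ×-dec ¬? (y ≟ x)))) ×-dec
                   all? (λ y → (t ~? y) →-dec (¬? (y ≟ x) →-dec (b ~? y)))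

    Blk : Fin n → Fin n → Set
    Blk t x = J t × t ~ x × suc r ≤ # (InB? t x)

    -- The blocks whose t is not paid in full by x; the other neighbours of t have no private vertex.
    Good : Fin n → Fin n → Set
    Good t x = Blk t x × (1 ≤ m x → Bad x)

    -- The one way in which a member c of J can fail to pay in full: s is its only neighbour with a
    -- private vertex, and apart from b all neighbours of s are twins of c.
    Tw : Fin n → Fin n → Fin n → Set
    Tw s b c = Priv b s × J c × s ~ c ×
               (∀ c′ → s ~ c′ → c′ ≢ b → c ⊆ᴺ c′) × (∀ y w → c ~ y → y ≢ s → ¬ Priv w y)

    TW : Fin n → Set
    TW s = ∃[ b ] ∃[ c ] Tw s b c

    -- A private vertex of x adjacent to the block may be a star that the block exchange destroys
    -- while making t a star. Counting the blocks in this position lets the exchange still improve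
    -- something.
    Cl : Fin n → Set
    Cl t = ∃[ x ] ∃[ b ] ∃[ u ] Blk t x × Priv b x × InB t x u × b ~ u

    abstract
      Blk? : ∀ t x → Dec (Blk t x)
      Blk? t x = J? t ×-dec (t ~? x) ×-dec (suc r ≤? # (InB? t x))

      Good? : ∀ t x → Dec (Good t x)
      Good? t x = Blk? t x ×-dec ((1 ≤? m x) →-dec Bad? x)

      TW? : Decidable TW
      TW? s = any? λ b → any? λ c → Priv? b s ×-dec J? c ×-dec (s ~? c) ×-dec
              all? (λ c′ → (s ~? c′) →-dec (¬? (c′ ≟ b) →-dec (c ⊆ᴺ? c′))) ×-dec
              all? (λ y → all? (λ w → (c ~? y) →-dec (¬? (y ≟ s) →-dec ¬? (Priv? w y))))

      Cl? : Decidable Cl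
      Cl? t = any? λ x → any? λ b → any? λ u → Blk? t x ×-dec Priv? b x ×-dec InB? t x u ×-dec (b ~? u)

    -- Exchanges and the vertices they leave undominated

    record Swap (D W : Fin n → Set) : Set where
      field
        D⊆S : ∀ {v} → D v → v ∈ S
        W∉S : ∀ {v} → W v → v ∉ S
        W-indep : ∀ {u v} → W u → W v → ¬ u ~ v
        N[W]⊆D : ∀ {w y} → W w → y ∈ S → w ~ y → D y
        D-dom : ∀ {d} → D d → ∃[ w ] W w × d ~ w

    -- Restricted to vertices outside S because, by `D-dom`, every removed vertex keeps a neighbour
    -- in W.
    Undom : (D W : Fin n → Set) → Fin n → Set
    Undom D W v = v ∉ S × (∀ {y} → y ∈ S → v ~ y → D y) × ¬ W v × (∀ {w} → W w → ¬ v ~ w)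

    Minimum : Set
    Minimum = ∀ S′ → ID S′ → size S ≤ size S′

    module _ {D W : Fin n → Set} (D? : Decidable D) (W? : Decidable W) where

      I : Fin n → Set
      I v = (v ∈ S × ¬ D v) ⊎ W v

      I? : Decidable I
      I? v = ((v ∈? S) ×-dec ¬? (D? v)) ⊎-dec W? v

      size-split : (∀ {v} → D v → v ∈ S) → # I? + # D? ≤ size S + # W?
      size-split D⊆S = begin
        # I? + # D?             ≤⟨ +-monoˡ-≤ (# D?) (#-∪ I? S\D? W? (λ v → id)) ⟩
        # S\D? + # W? + # D?    ≡⟨ +-assoc (# S\D?) _ _ ⟩
        # S\D? + (# W? + # D?)  ≡⟨ cong (# S\D? +_) (+-comm (# W?) (# D?)) ⟩
        # S\D? + (# D? + # W?)  ≡⟨ sym (+-assoc (# S\D?) _ _) ⟩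
        # S\D? + # D? + # W?    ≤⟨ +-monoˡ-≤ (# W?) (#-⊎ (_∈? S) S\D? D? (λ v → proj₁) (λ v → D⊆S) (λ v p d → proj₂ p d)) ⟩
        size S + # W?           ∎
        where
        open ≤-Reasoning
        S\D? : Decidable (λ v → v ∈ S × ¬ D v)
        S\D? v = (v ∈? S) ×-dec ¬? (D? v)

      I-indep : Independent G S → Swap D W → ∀ {u v} → I u → I v → ¬ u ~ v
      I-indep ind sw (inj₁ (u∈S , _)) (inj₁ (v∈S , _)) e = ind _ _ u∈S v∈S e
      I-indep ind sw (inj₁ (u∈S , ¬d)) (inj₂ w) e = ¬d (Swap.N[W]⊆D sw w u∈S (~-sym e))
      I-indep ind sw (inj₂ w) (inj₁ (v∈S , ¬d)) e = ¬d (Swap.N[W]⊆D sw w v∈S e)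
      I-indep ind sw (inj₂ w) (inj₂ w′) e = Swap.W-indep sw w w′ e

      exchanged : Subset n
      exchanged = ⟦ I? ⟧

      exchange-ID : Independent G S → Swap D W → (∀ v → ¬ Undom D W v) → ID exchanged
      exchange-ID ind sw none =
        (λ u v u∈ v∈ → I-indep ind sw (∈⟦⟧⁻ I? u∈) (∈⟦⟧⁻ I? v∈)) , dom
        where
        dom : Dominating G exchanged
        dom v v∉ with any? (λ u → I? u ×-dec (u ~? v))
        ... | yes (u , i , e) = u , ∈⟦⟧⁺ I? i , e
        ... | no ¬e with v ∈? S
        ...   | yes v∈S with D? v
        ...     | no ¬d = ⊥-elim (v∉ (∈⟦⟧⁺ I? (inj₁ (v∈S , ¬d))))
        ...     | yes d with Swap.D-dom sw d
        ...       | w , ww , e = ⊥-elim (¬e (w , inj₂ ww , ~-sym e))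
        dom v v∉ | no ¬e | no v∉S =
          ⊥-elim (none v (v∉S , (λ {y} y∈S e → decidable-stable (D? y) (λ ¬d → ¬e (y , inj₁ (y∈S , ¬d) , ~-sym e)))
                              , (λ w → v∉ (∈⟦⟧⁺ I? (inj₂ w)))
                              , (λ {w} ww e → ¬e (w , inj₂ ww , ~-sym e))))

      exchange-size : (∀ {v} → D v → v ∈ S) → # W? ≤ # D? → size exchanged ≤ size S
      exchange-size D⊆S le = +-cancelʳ-≤ (# D?) (size exchanged) (size S)
        (≤-trans (≤-reflexive (cong (_+ # D?) (#⟦⟧ I?))) (≤-trans (size-split D⊆S) (+-monoʳ-≤ (size S) le)))

      -- S ∖ D ∪ W extends to a maximal independent set by adding vertices it leaves undominated.
      swap-≤ : ID S → Minimum → Swap D W → ∀ {V} (V? : Decidable V) →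
               (∀ v → Undom D W v → V v) → # D? ≤ # W? + # V?
      swap-≤ (ind , _) min sw {V} V? V-all =
        +-cancelˡ-≤ (size S) (# D?) (# W? + # V?) (begin
          size S + # D?             ≤⟨ +-monoˡ-≤ (# D?) (≤-trans (min S′ S′-ID) (#-∪ (_∈? S′) I? V? split)) ⟩
          # I? + # V? + # D?        ≡⟨ +-assoc (# I?) _ _ ⟩
          # I? + (# V? + # D?)      ≡⟨ cong (# I? +_) (+-comm (# V?) (# D?)) ⟩
          # I? + (# D? + # V?)      ≡⟨ sym (+-assoc (# I?) _ _) ⟩
          # I? + # D? + # V?        ≤⟨ +-monoˡ-≤ (# V?) (size-split D⊆S) ⟩
          size S + # W? + # V?      ≡⟨ +-assoc (size S) _ _ ⟩
          size S + (# W? + # V?)    ∎)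
        where
        open ≤-Reasoning
        open Swap sw
        ext : ∃[ X ] ID X × (∀ v → v ∈ X → I v ⊎ (∀ u → I u → ¬ u ~ v))
        ext = extend I? (I-indep ind sw)
        S′ : Subset n
        S′ = proj₁ ext
        S′-ID : ID S′
        S′-ID = proj₁ (proj₂ ext)
        split : ∀ v → v ∈ S′ → I v ⊎ V v
        split v v∈ with proj₂ (proj₂ ext) v v∈ | I? v
        ... | inj₁ i | _ = inj₁ i
        ... | inj₂ u | yes i = inj₁ i
        ... | inj₂ u | no ¬i with v ∈? S
        ...   | no v∉S = inj₂ (V-all v (v∉S , (λ {y} y∈S e → decidable-stable (D? y) (λ ¬d → u y (inj₁ (y∈S , ¬d)) (~-sym e)))
                                          , (λ w → ¬i (inj₂ w)) , (λ {w} ww e → u w (inj₂ ww) (~-sym e))))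
        ...   | yes v∈S with D? v
        ...     | no ¬d = ⊥-elim (¬i (inj₁ (v∈S , ¬d)))
        ...     | yes d with D-dom d
        ...       | w , ww , e = ⊥-elim (u w (inj₂ ww) (~-sym e))

  -- Degree counts and the structure of blocks

  module Facts (S : Subset n) (S-ID : ID S) where
    open At S

    r<k : suc r < k
    r<k = ≤-refl

    indep : ∀ {u v} → u ∈ S → v ∈ S → ¬ u ~ v
    indep = proj₁ S-ID _ _

    dominator : ∀ {v} → v ∉ S → ∃[ y ] y ∈ S × v ~ y
    dominator {v} v∉ with proj₂ S-ID v v∉
    ... | y , y∈ , e = y , y∈ , ~-sym e

    J⇒dS : ∀ {t} → J t → dS t ≡ k
    J⇒dS {t} (_ , N⊆S) = trans (#-cong (dS? t) (t ~?_) (λ y → proj₂) (λ y e → N⊆S y e , e)) (deg t)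

    dS⇒J : ∀ {t} → t ∉ S → k ≤ dS t → J t
    dS⇒J {t} t∉ le = t∉ , λ y e → proj₁ (#⊆⇒⊇ (dS? t) (t ~?_) (λ y → proj₂) (≤-trans (≤-reflexive (deg t)) le) y e)

    Priv⇒dS : ∀ {w s} → Priv w s → dS w ≡ 1
    Priv⇒dS {w} {s} (_ , s∈ , e , only) =
      trans (#-cong (dS? w) (_≟ s) (λ y p → only y (proj₁ p) (proj₂ p)) (λ { y refl → s∈ , e })) (#-singleton s)

    dS⇒Priv : ∀ {w} → w ∉ S → dS w ≡ 1 → ∃[ s ] Priv w s
    dS⇒Priv {w} w∉ eq with dominator w∉
    ... | s , s∈ , e = s , w∉ , s∈ , e , λ y y∈ e′ → #≤1⇒≡ (dS? w) (≤-reflexive eq) (y∈ , e′) (s∈ , e)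

    Priv⇒¬J : ∀ {w s} → Priv w s → ¬ J w
    Priv⇒¬J p jw with trans (sym (Priv⇒dS p)) (J⇒dS jw)
    ... | ()

    Star⇒Priv : ∀ {v} → Star v → ∃[ s ] Priv v s
    Star⇒Priv (v∉ , d1 , _) = dS⇒Priv v∉ d1

    J≁J : ∀ {u v} → J u → v ∉ S → ¬ u ~ v
    J≁J ju v∉ e = v∉ (proj₂ ju _ e)

    m+j≤k : ∀ s → m s + j s ≤ k
    m+j≤k s = ≤-trans (#-⊎ (s ~?_) (λ w → Priv? w s) (JN? s)
                        (λ w p → ~-sym (proj₁ (proj₂ (proj₂ p)))) (λ t p → proj₂ p)
                        (λ w p q → Priv⇒¬J p (proj₁ q)))
                      (≤-reflexive (deg s))

    out? : ∀ w → Decidable (λ y → w ~ y × y ∉ S)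
    out? w y = (w ~? y) ×-dec ¬? (y ∈? S)

    dS+out : ∀ w → dS w + # (out? w) ≤ k
    dS+out w = ≤-trans (#-⊎ (w ~?_) (dS? w) (out? w) (λ y → proj₂) (λ y → proj₁) (λ y p q → proj₂ q (proj₁ p)))
                       (≤-reflexive (deg w))

    -- All but one of the k edges at b go to S. Star leaves and block vertices are of this kind, so
    -- vertices outside S that share one of them coincide.
    out-unique : ∀ {b u v} → dS b ≡ suc r → b ~ u → u ∉ S → b ~ v → v ∉ S → u ≡ v
    out-unique {b} eq e u∉ e′ v∉ = #≤1⇒≡ (out? b) le (e , u∉) (e′ , v∉)
      where
      le : # (out? b) ≤ 1
      le = +-cancelˡ-≤ (suc r) _ _ (≤-trans (≤-trans (≤-reflexive (cong (_+ # (out? b)) (sym eq))) (dS+out b))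
                                            (≤-reflexive (cong suc (+-comm 1 r))))

    N∖? : ∀ t x → Decidable (λ y → t ~ y × y ≢ x)
    N∖? t x y = (t ~? y) ×-dec ¬? (y ≟ x)

    #N∖≥ : ∀ t x → suc r ≤ # (N∖? t x)
    #N∖≥ t x = ≤-pred (≤-trans (≤-reflexive (sym (deg t)))
               (≤-trans (#-∪⁅⁆ (t ~?_) (N∖? t x) x f) (≤-reflexive (+-comm _ 1))))
      where
      f : ∀ y → t ~ y → (t ~ y × y ≢ x) ⊎ y ≡ x
      f y e with y ≟ x
      ... | yes y≡x = inj₂ y≡x
      ... | no y≢x = inj₁ (e , y≢x)

    #N∖≤ : ∀ {t x} → t ~ x → # (N∖? t x) ≤ suc r
    #N∖≤ {t} {x} e = ≤-pred (≤-trans (≤-reflexive (+-comm 1 _))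
                    (≤-trans (#-⊎⁅⁆ (t ~?_) (N∖? t x) x (λ y → proj₁) e (λ q → proj₂ q refl)) (≤-reflexive (deg t))))

    InB⇒dS : ∀ {t x b} → J t → t ~ x → InB t x b → dS b ≡ suc r
    InB⇒dS {t} {x} {b} jt t~x (b∉ , f , g) =
      trans (#-cong (dS? b) (N∖? t x) (λ y p → f y (proj₁ p) (proj₂ p))
                    (λ y p → proj₂ jt y (proj₁ p) , g y (proj₁ p) (proj₂ p)))
            (≤-antisym (#N∖≤ t~x) (#N∖≥ t x))

    dS-r⇒¬J : ∀ {b} → dS b ≡ suc r → ¬ J b
    dS-r⇒¬J eq jb = <⇒≢ r<k (trans (sym eq) (J⇒dS jb))

    -- This is k ≥ 3: it separates private vertices and star centres from block vertices and star
    -- leaves.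
    1≢r : 1 ≢ suc r
    1≢r e = <⇒≢ (s≤s 1≤r) e

    exists-other : ∀ t x → ∃[ z ] t ~ z × z ≢ x
    exists-other t x = 1≤#⇒∃ (N∖? t x) (≤-trans (s≤s z≤n) (#N∖≥ t x))

    exists-other₂ : ∀ t x x′ → ∃[ z ] t ~ z × z ≢ x × z ≢ x′
    exists-other₂ t x x′ with #-other (N∖? t x) (≤-trans (s≤s 1≤r) (#N∖≥ t x)) x′
    ... | z , (e , z≢x) , z≢x′ = z , e , z≢x , z≢x′

    module Block {t x : Fin n} (blk : Blk t x) where

      tJ : J t
      tJ = proj₁ blk

      t~x : t ~ x
      t~x = proj₁ (proj₂ blk)

      #B≥ : suc r ≤ # (InB? t x)
      #B≥ = proj₂ (proj₂ blk)

      B-dS : ∀ {b} → InB t x b → dS b ≡ suc r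
      B-dS = InB⇒dS tJ t~x

      t∉B : ¬ InB t x t
      t∉B ib = dS-r⇒¬J (B-dS ib) tJ

      x≁B : ∀ {b} → InB t x b → ¬ b ~ x
      x≁B (_ , f , _) e = proj₂ (f x (proj₂ tJ x t~x) e) refl

      -- Writing Z for the neighbours of t except x, the vertex t and the k - 1 block vertices
      -- already fill the neighbourhood of each z in Z.
      Z~ : ∀ {z v} → t ~ z → z ≢ x → z ~ v → InB t x v ⊎ v ≡ t
      Z~ {z} t~z z≢x = #⊆⇒⊇ (λ v → InB? t x v ⊎-dec (v ≟ t)) (z ~?_) sub le _
        where
        sub : ∀ v → InB t x v ⊎ v ≡ t → z ~ v
        sub v (inj₁ (_ , _ , g)) = ~-sym (g z t~z z≢x)
        sub v (inj₂ refl) = ~-sym t~z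
        le : # (z ~?_) ≤ # (λ v → InB? t x v ⊎-dec (v ≟ t))
        le = ≤-trans (≤-reflexive (deg z)) (≤-trans (s≤s #B≥) (≤-trans (≤-reflexive (+-comm 1 _))
               (#-⊎⁅⁆ (λ v → InB? t x v ⊎-dec (v ≟ t)) (InB? t x) t (λ v → inj₁) (inj₂ refl) t∉B)))

      #B≤ : # (InB? t x) ≤ suc r
      #B≤ with exists-other t x
      ... | z , t~z , z≢x = ≤-pred (≤-trans (≤-reflexive (+-comm 1 _)) (≤-trans
            (#-⊎⁅⁆ (z ~?_) (InB? t x) t (λ v ib → ~-sym (proj₂ (proj₂ ib) z t~z z≢x)) (~-sym t~z) t∉B)
            (≤-reflexive (deg z))))

      b₀ : ∃[ b ] InB t x b
      b₀ = 1≤#⇒∃ (InB? t x) (≤-trans (s≤s z≤n) #B≥)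

      Z~J : ∀ {z t′} → t ~ z → z ≢ x → z ~ t′ → J t′ → t′ ≡ t
      Z~J t~z z≢x e jt′ with Z~ t~z z≢x e
      ... | inj₁ ib = ⊥-elim (dS-r⇒¬J (B-dS ib) jt′)
      ... | inj₂ eq = eq

      B~Z : ∀ {b z} → InB t x b → t ~ z → z ≢ x → b ~ z
      B~Z (_ , _ , g) = g _

      B~S : ∀ {b y} → InB t x b → y ∈ S → b ~ y → t ~ y × y ≢ x
      B~S (_ , f , _) = f _

    -- As k ≥ 3, some neighbour z of t avoids both x and x′. By `Z~` a vertex of the first block,
    -- being adjacent to z, lies in the second one too; yet it sees x′.
    x-unique : ∀ {t x x′} → Blk t x → Blk t x′ → x ≡ x′
    x-unique {t} {x} {x′} blk blk′ with x ≟ x′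
    ... | yes eq = eq
    ... | no x≢x′ with exists-other₂ t x x′ | Block.b₀ blk
    ...   | z , t~z , z≢x , z≢x′ | b , ib with Block.Z~ blk′ t~z z≢x′ (~-sym (Block.B~Z blk ib t~z z≢x))
    ...     | inj₂ refl = ⊥-elim (Block.t∉B blk ib)
    ...     | inj₁ ib′ = ⊥-elim (Block.x≁B blk′ ib′ (Block.B~Z blk ib (Block.t~x blk′) (λ e → x≢x′ (sym e))))

    -- The vertex b sees a z in Z, which must then be a neighbour of t′ as well; but t is the only
    -- neighbour of z in J.
    B-disjoint : ∀ {t x t′ x′ b} → Blk t x → Blk t′ x′ → InB t x b → InB t′ x′ b → t ≡ t′
    B-disjoint {t} {x} blk blk′ ib ib′ with exists-other t x
    ... | z , t~z , z≢x with Block.B~S blk′ ib′ (proj₂ (proj₁ blk) z t~z) (Block.B~Z blk ib t~z z≢x)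
    ...   | t′~z , _ = sym (Block.Z~J blk t~z z≢x (~-sym t′~z) (proj₁ blk′))

    -- Consequences of minimum size

    module Minimal (min : Minimum) where

      A? : ∀ w → Decidable (λ u → u ∉ S × u ⊑ w × ¬ w ~ u)
      A? w u = ¬? (u ∈? S) ×-dec (u ⊑? w) ×-dec ¬? (w ~? u)

      -- Exchange the neighbours of w in S for w. An undominated u satisfies u ⊑ w and misses w; the
      -- inserted w is itself counted on the right, as w ⊑ w.
      dS≤#A : ∀ {w} → w ∉ S → dS w ≤ # (A? w)
      dS≤#A {w} w∉ = ≤-trans (swap-≤ (dS? w) (_≟ w) S-ID min sw V? (λ v und → V-all v und))
        (≤-trans (≤-reflexive (trans (cong (_+ # V?) (#-singleton w)) (+-comm 1 _)))
          (#-⊎⁅⁆ (A? w) V? w (λ v → proj₁) (w∉ , (λ y _ e → e) , λ e → ~⇒≢ e refl) (λ p → proj₂ p refl)))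
        where
        V? : Decidable (λ u → (u ∉ S × u ⊑ w × ¬ w ~ u) × u ≢ w)
        V? u = A? w u ×-dec ¬? (u ≟ w)
        sw : Swap (λ y → y ∈ S × w ~ y) (_≡ w)
        sw = record
          { D⊆S = proj₁ ; W∉S = λ { refl → w∉ } ; W-indep = λ { refl refl e → ~⇒≢ e refl }
          ; N[W]⊆D = λ { refl y∈ e → y∈ , e } ; D-dom = λ { (_ , e) → w , refl , ~-sym e } }
        V-all : ∀ v → Undom (λ y → y ∈ S × w ~ y) (_≡ w) v → (v ∉ S × v ⊑ w × ¬ w ~ v) × v ≢ w
        V-all v (v∉ , cl , ¬w , ¬e) = (v∉ , (λ y y∈ e → proj₂ (cl y∈ e)) , λ e → ¬e refl (~-sym e)) , ¬w

      -- Any u ⊑ b outside S shares some z with the block and so belongs to it, t being excluded by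
      -- its neighbour x. An edge between b and b′ removes b′ from `A? b`, leaving fewer than dS b =
      -- k - 1 vertices.
      B-indep₁ : ∀ {t x b b′} → Blk t x → InB t x b → InB t x b′ → ¬ b ~ b′
      B-indep₁ {t} {x} {b} {b′} blk ib ib′ e = <⇒≱ smaller (≤-trans (≤-reflexive (sym (B-dS ib))) (dS≤#A (proj₁ ib)))
        where
        open Block blk
        sub : ∀ u → u ∉ S × u ⊑ b × ¬ b ~ u → InB t x u
        sub u (u∉ , u⊑b , _) with dominator u∉
        ... | z , z∈ , u~z with B~S ib z∈ (u⊑b z z∈ u~z)
        ...   | t~z , z≢x with Z~ t~z z≢x (~-sym u~z)
        ...     | inj₁ iu = iu
        ...     | inj₂ refl = ⊥-elim (x≁B ib (u⊑b x (proj₂ tJ x t~x) t~x))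
        smaller : # (A? b) < suc r
        smaller = ≤-trans (≤-reflexive (+-comm 1 _)) (≤-trans (#-⊎⁅⁆ (InB? t x) (A? b) b′ sub ib′ (λ p → proj₂ (proj₂ p) e)) #B≤)

      module _ {t x t′ x′ b b′} (blk : Blk t x) (blk′ : Blk t′ x′) (t≢t′ : t ≢ t′)
               (ib : InB t x b) (ib′ : InB t′ x′ b′) (b~b′ : b ~ b′) where
        private
          module B = Block blk
          module B′ = Block blk′

          D W : Fin n → Set
          D y = (t ~ y × y ≢ x) ⊎ (t′ ~ y × y ≢ x′)
          W u = (InB t x u × u ≢ b) ⊎ u ≡ b′

          D? : Decidable D
          D? y = N∖? t x y ⊎-dec N∖? t′ x′ y

          B∖? : Decidable (λ u → InB t x u × u ≢ b)
          B∖? u = InB? t x u ×-dec ¬? (u ≟ b)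

          W? : Decidable W
          W? u = B∖? u ⊎-dec (u ≟ b′)

          V? : Decidable (λ u → InB t′ x′ u × u ≢ b′)
          V? u = InB? t′ x′ u ×-dec ¬? (u ≟ b′)

          B≁b′ : ∀ {u} → InB t x u → u ≢ b → ¬ u ~ b′
          B≁b′ iu u≢b e = u≢b (out-unique (B′.B-dS ib′) (~-sym e) (proj₁ iu) (~-sym b~b′) (proj₁ ib))

          sw : Swap D W
          sw = record { D⊆S = D⊆S ; W∉S = W∉S ; W-indep = W-indep ; N[W]⊆D = N[W]⊆D ; D-dom = D-dom }
            where
            D⊆S : ∀ {v} → D v → v ∈ S
            D⊆S (inj₁ (e , _)) = proj₂ B.tJ _ e
            D⊆S (inj₂ (e , _)) = proj₂ B′.tJ _ e
            W∉S : ∀ {v} → W v → v ∉ S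
            W∉S (inj₁ (iv , _)) = proj₁ iv
            W∉S (inj₂ refl) = proj₁ ib′
            W-indep : ∀ {u v} → W u → W v → ¬ u ~ v
            W-indep (inj₁ (iu , _)) (inj₁ (iv , _)) = B-indep₁ blk iu iv
            W-indep (inj₁ (iu , u≢b)) (inj₂ refl) = B≁b′ iu u≢b
            W-indep (inj₂ refl) (inj₁ (iv , v≢b)) e = B≁b′ iv v≢b (~-sym e)
            W-indep (inj₂ refl) (inj₂ refl) e = ~⇒≢ e refl
            N[W]⊆D : ∀ {w y} → W w → y ∈ S → w ~ y → D y
            N[W]⊆D (inj₁ (iw , _)) y∈ e = inj₁ (B.B~S iw y∈ e)
            N[W]⊆D (inj₂ refl) y∈ e = inj₂ (B′.B~S ib′ y∈ e)
            D-dom : ∀ {d} → D d → ∃[ w ] W w × d ~ w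
            D-dom (inj₂ (e , ne)) = b′ , inj₂ refl , ~-sym (B′.B~Z ib′ e ne)
            D-dom (inj₁ (e , ne)) with #-other (InB? t x) (≤-trans (s≤s 1≤r) B.#B≥) b
            ... | w , iw , w≢b = w , inj₁ (iw , w≢b) , ~-sym (B.B~Z iw e ne)

          x∉Z′ : ∀ {x t t′ x′} → J t → t ~ x → Blk t′ x′ → t ≢ t′ → t′ ~ x → x ≢ x′ → ⊥
          x∉Z′ jt t~x blk′ t≢t′ e ne = t≢t′ (Block.Z~J blk′ e ne (~-sym t~x) jt)

          V-all : ∀ v → Undom D W v → InB t′ x′ v × v ≢ b′
          V-all v (v∉ , cl , ¬w , ¬e) with dominator v∉
          ... | z , z∈ , v~z with cl z∈ v~z
          ...   | inj₁ (t~z , z≢x) with B.Z~ t~z z≢x (~-sym v~z)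
          ...     | inj₂ refl = ⊥-elim ([ (λ p → proj₂ p refl) , (λ p → x∉Z′ B.tJ B.t~x blk′ t≢t′ (proj₁ p) (proj₂ p)) ]
                                         (cl (proj₂ B.tJ x B.t~x) B.t~x))
          ...     | inj₁ iv with v ≟ b
          ...       | yes refl = ⊥-elim (¬e (inj₂ refl) b~b′)
          ...       | no v≢b = ⊥-elim (¬w (inj₁ (iv , v≢b)))
          V-all v (v∉ , cl , ¬w , ¬e) | z , z∈ , v~z | inj₂ (t′~z , z≢x′) with B′.Z~ t′~z z≢x′ (~-sym v~z)
          ...     | inj₁ iv = iv , λ eq → ¬w (inj₂ eq)
          ...     | inj₂ refl = ⊥-elim ([ (λ p → x∉Z′ B′.tJ B′.t~x blk (λ e → t≢t′ (sym e)) (proj₁ p) (proj₂ p)) , (λ p → proj₂ p refl) ]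
                                         (cl (proj₂ B′.tJ x′ B′.t~x) B′.t~x))

          #D : suc r + suc r ≤ # D?
          #D = ≤-trans (+-mono-≤ (#N∖≥ t x) (#N∖≥ t′ x′))
                 (#-⊎ D? (N∖? t x) (N∖? t′ x′) (λ y → inj₁) (λ y → inj₂)
                   (λ { y (e , ne) (e′ , _) → t≢t′ (sym (B.Z~J e ne (~-sym e′) B′.tJ)) }))

          #W+V : suc (# W? + # V?) ≤ suc r + suc r
          #W+V = begin
            suc (# W? + # V?)              ≤⟨ s≤s (+-monoˡ-≤ (# V?) (#-∪⁅⁆ W? B∖? b′ (λ v → id))) ⟩
            suc (# B∖? + 1 + # V?)         ≡⟨ sym (+-suc _ (# V?)) ⟩
            # B∖? + 1 + suc (# V?)         ≡⟨ cong (# B∖? + 1 +_) (+-comm 1 _) ⟩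
            (# B∖? + 1) + (# V? + 1)       ≤⟨ +-mono-≤ (#-⊎⁅⁆ (InB? t x) B∖? b (λ v → proj₁) ib (λ p → proj₂ p refl))
                                                       (#-⊎⁅⁆ (InB? t′ x′) V? b′ (λ v → proj₁) ib′ (λ p → proj₂ p refl)) ⟩
            # (InB? t x) + # (InB? t′ x′)  ≤⟨ +-mono-≤ B.#B≤ B′.#B≤ ⟩
            suc r + suc r                  ∎
            where open ≤-Reasoning

        -- 2(k - 1) vertices leave S, (k - 2) + 1 enter, and at most k - 2 are left undominated: b
        -- is dominated by b′, while t and t′ keep x and x′.
        B-indep₂ : ⊥
        B-indep₂ = <⇒≱ #W+V (≤-trans #D (swap-≤ D? W? S-ID min sw V? V-all))

      B-indep : ∀ {t x t′ x′ b b′} → Blk t x → Blk t′ x′ → InB t x b → InB t′ x′ b′ → ¬ b ~ b′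
      B-indep {t} {x} {t′} blk blk′ ib ib′ e with t ≟ t′
      ... | no t≢t′ = B-indep₂ blk blk′ t≢t′ ib ib′ e
      ... | yes refl with x-unique blk blk′
      ...   | refl = B-indep₁ blk ib ib′ e

  -- Exchanging a bad vertex for its private vertex

  module Flip (S : Subset n) (S-ID : ID S) {s b : Fin n} (bad : At.Bad S s) (pb : At.Priv S b s) where
    open At S
    open Facts S S-ID

    b∉ : b ∉ S
    b∉ = proj₁ pb

    s∈ : s ∈ S
    s∈ = proj₁ (proj₂ pb)

    s~b : s ~ b
    s~b = ~-sym (proj₁ (proj₂ (proj₂ pb)))

    s≢b : s ≢ b
    s≢b refl = b∉ s∈

    priv-unique : ∀ {w} → Priv w s → w ≡ b
    priv-unique p = #≤1⇒≡ (λ w → Priv? w s) (≤-reflexive (proj₁ bad)) p pb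

    N[s] : ∀ {v} → s ~ v → v ≡ b ⊎ J v
    N[s] {v} e = [ (λ p → inj₂ (proj₁ p)) , inj₁ ] (#⊆⇒⊇ P? (s ~?_) (λ v → [ proj₂ , (λ { refl → s~b }) ]) le v e)
      where
      P? : Decidable (λ v → (J v × s ~ v) ⊎ v ≡ b)
      P? v = JN? s v ⊎-dec (v ≟ b)
      le : # (s ~?_) ≤ # P?
      le = ≤-trans (≤-reflexive (deg s)) (≤-trans (s≤s (proj₂ bad)) (≤-trans (≤-reflexive (+-comm 1 _))
             (#-⊎⁅⁆ P? (JN? s) b (λ v → inj₁) (inj₂ refl) (λ p → Priv⇒¬J pb (proj₁ p)))))

    S′ : Subset n
    S′ = exchanged (_≟ s) (_≟ b)

    keep : ∀ {v} → v ∈ S → v ≢ s → v ∈ S′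
    keep v∈ ne = ∈⟦⟧⁺ (I? (_≟ s) (_≟ b)) (inj₁ (v∈ , ne))

    b∈S′ : b ∈ S′
    b∈S′ = ∈⟦⟧⁺ (I? (_≟ s) (_≟ b)) (inj₂ refl)

    S′⁻ : ∀ {v} → v ∈ S′ → (v ∈ S × v ≢ s) ⊎ v ≡ b
    S′⁻ v∈ = ∈⟦⟧⁻ (I? (_≟ s) (_≟ b)) v∈

    s∉S′ : s ∉ S′
    s∉S′ s∈′ = [ (λ p → proj₂ p refl) , s≢b ] (S′⁻ s∈′)

    ∉S′⁺ : ∀ {v} → v ∉ S → v ≢ b → v ∉ S′
    ∉S′⁺ v∉ ne v∈ = [ (λ p → v∉ (proj₁ p)) , ne ] (S′⁻ v∈)

    ∉S′⁻ : ∀ {v} → v ∉ S′ → v ≢ s → v ∉ S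
    ∉S′⁻ v∉ ne v∈ = v∉ (keep v∈ ne)

    swap : Swap (_≡ s) (_≡ b)
    swap = record
      { D⊆S = λ { refl → s∈ } ; W∉S = λ { refl → b∉ } ; W-indep = λ { refl refl e → ~⇒≢ e refl }
      ; N[W]⊆D = λ { refl y∈ e → proj₂ (proj₂ (proj₂ pb)) _ y∈ e } ; D-dom = λ { refl → b , refl , s~b } }

    S′-ID : ID S′
    S′-ID = exchange-ID (_≟ s) (_≟ b) (proj₁ S-ID) swap none
      where
      none : ∀ v → ¬ Undom (_≡ s) (_≡ b) v
      none v (v∉ , cl , ¬w , _) with dominator v∉
      ... | y , y∈ , e with cl y∈ e
      ...   | refl = ¬w (priv-unique (v∉ , s∈ , e , λ y → cl))

    S′-size : size S′ ≤ size S
    S′-size = exchange-size (_≟ s) (_≟ b) (Swap.D⊆S swap)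
                (≤-reflexive (trans (#-singleton b) (sym (#-singleton s))))

    module ′ = At S′
    module F′ = Facts S′ S′-ID

    keep~ : ∀ {w y} → ¬ w ~ s → y ∈ S → w ~ y → y ∈ S′
    keep~ w≁s y∈ e = keep y∈ λ { refl → w≁s e }

    back~ : ∀ {w y} → ¬ w ~ b → y ∈ S′ → w ~ y → y ∈ S
    back~ w≁b y∈ e = [ proj₁ , (λ { refl → ⊥-elim (w≁b e) }) ] (S′⁻ y∈)

    dS-same : ∀ {w} → ¬ w ~ s → ¬ w ~ b → ′.dS w ≡ dS w
    dS-same {w} w≁s w≁b = #-cong (′.dS? w) (dS? w)
      (λ y p → back~ w≁b (proj₁ p) (proj₂ p) , proj₂ p)
      (λ y p → keep~ w≁s (proj₁ p) (proj₂ p) , proj₂ p)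

    priv-s : ′.Priv s b
    priv-s = s∉S′ , b∈S′ , s~b , λ y y∈ e → [ (λ p → ⊥-elim (indep s∈ (proj₁ p) e)) , id ] (S′⁻ y∈)

    -- The neighbours of s other than b are in J, so no other star centre and no leaf of its star
    -- sees s. They do not see b either, by 1 ≠ k - 1 for the centre and `out-unique` for the
    -- leaves. Hence the degrees into the set are unchanged.
    star-kept : ∀ {v} → Star v → v ≢ b → ′.Star v
    star-kept {v} (v∉ , d1 , leaves) v≢b = ∉S′⁺ v∉ v≢b , trans (dS-same v≁s v≁b) d1 , leaves′
      where
      v≁b : ¬ v ~ b
      v≁b e = 1≢r (trans (sym (Priv⇒dS pb)) (leaves b e b∉))
      ¬Jv : ¬ J v
      ¬Jv jv with trans (sym d1) (J⇒dS jv)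
      ... | ()
      v≁s : ¬ v ~ s
      v≁s e = [ v≢b , ¬Jv ] (N[s] (~-sym e))
      leaves′ : ∀ u → v ~ u → u ∉ S′ → ′.dS u ≡ suc r
      leaves′ u e u∉′ = trans (dS-same u≁s u≁b) du
        where
        u∉ : u ∉ S
        u∉ = ∉S′⁻ u∉′ λ { refl → v≁s e }
        du : dS u ≡ suc r
        du = leaves u e u∉
        u≁s : ¬ u ~ s
        u≁s e′ = [ (λ { refl → v≁b e }) , dS-r⇒¬J du ] (N[s] (~-sym e′))
        u≁b : ¬ u ~ b
        u≁b e′ = v≢b (out-unique du (~-sym e) v∉ e′ b∉)

    -- The other neighbours of s were in J and lose exactly s, which leaves them k - 1 neighbours in
    -- the new set.
    star-s : ′.Star s
    star-s = s∉S′ , F′.Priv⇒dS priv-s , leaves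
      where
      leaves : ∀ u → s ~ u → u ∉ S′ → ′.dS u ≡ suc r
      leaves u e u∉′ with N[s] e
      ... | inj₁ refl = ⊥-elim (u∉′ b∈S′)
      ... | inj₂ ju = trans (#-cong (′.dS? u) (N∖? u s)
                        (λ y p → proj₂ p , λ { refl → s∉S′ (proj₁ p) })
                        (λ y p → keep (proj₂ ju y (proj₁ p)) (proj₂ p) , proj₁ p))
                      (≤-antisym (#N∖≤ (~-sym e)) (#N∖≥ u s))

    private
      ¬star-s : ¬ Star s
      ¬star-s st = proj₁ st s∈

      rest? : Decidable (λ v → Star v × v ≢ b)
      rest? v = Star? v ×-dec ¬? (v ≟ b)

      rest+1 : # rest? + 1 ≤ # ′.Star?
      rest+1 = #-⊎⁅⁆ ′.Star? rest? s (λ v p → star-kept (proj₁ p) (proj₂ p)) star-s (λ p → ¬star-s (proj₁ p))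

    stars-≤ : # Star? ≤ # ′.Star?
    stars-≤ = ≤-trans (#-∪⁅⁆ Star? rest? b f) rest+1
      where
      f : ∀ v → Star v → (Star v × v ≢ b) ⊎ v ≡ b
      f v st with v ≟ b
      ... | yes e = inj₂ e
      ... | no ne = inj₁ (st , ne)

    stars-< : ¬ Star b → # Star? < # ′.Star?
    stars-< ¬st = ≤-trans (s≤s (#-mono Star? rest? (λ { v st → st , λ { refl → ¬st st } })))
                          (≤-trans (≤-reflexive (+-comm 1 _)) rest+1)

  -- Tight twin configurations do not survive a flip

  module Twins (S : Subset n) (S-ID : ID S) {s b c : Fin n} (tw : At.Tw S s b c) where
    open At S
    open Facts S S-ID

    private
      pb : Priv b s
      pb = proj₁ tw
      jc : J c
      jc = proj₁ (proj₂ tw)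
      s~c : s ~ c
      s~c = proj₁ (proj₂ (proj₂ tw))

    twin : ∀ {c′} → s ~ c′ → c′ ≢ b → c ⊆ᴺ c′
    twin = proj₁ (proj₂ (proj₂ (proj₂ tw))) _

    no-priv : ∀ {y w} → c ~ y → y ≢ s → ¬ Priv w y
    no-priv = proj₂ (proj₂ (proj₂ (proj₂ tw))) _ _

    J-twin : ∀ {c′} → s ~ c′ → c′ ≢ b → J c′
    J-twin {c′} e ne = (λ c′∈ → indep (proj₁ (proj₂ pb)) c′∈ e)
                     , λ y e′ → proj₂ jc y (⊆ᴺ-sym (twin e ne) y e′)

    bad : Bad s
    bad = ≤-antisym (#-unique (λ w → Priv? w s) (λ u v p q → trans (is-b p) (sym (is-b q)))) (1≤# (λ w → Priv? w s) pb)
        , ≤-trans (#N∖≥ s b) (#-mono (N∖? s b) (JN? s) (λ v p → J-twin (proj₁ p) (proj₂ p) , proj₁ p))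
      where
      is-b : ∀ {w} → Priv w s → w ≡ b
      is-b {w} p with w ≟ b
      ... | yes e = e
      ... | no ne = ⊥-elim (Priv⇒¬J p (J-twin (~-sym (proj₁ (proj₂ (proj₂ p)))) ne))

    -- As k ≥ 3, no vertex is adjacent to two disjoint sets of k - 1 vertices.
    two-fans : suc r + suc r ≤ k → ⊥
    two-fans le = <⇒≱ (+-monoʳ-< (suc r) (s≤s 1≤r)) (≤-trans le (≤-reflexive (+-comm 1 (suc r))))

    module _ (min : Minimum) (star-b : Star b) where
      open Minimal min
      open Flip S S-ID bad pb

      private
        other-kept : ∀ {s′} → ′.TW s′ → s′ ≢ b → TW s′
        other-kept {s′} (b′ , c′ , pb′ , jc′ , s′~c′ , tw′ , np′) s′≢b =
          b′ , c′ , (b′∉ , s′∈ , b′~s′ , λ y y∈ e → proj₂ (proj₂ (proj₂ pb′)) y (keep~ b′≁s y∈ e) e)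
             , (c′∉ , λ y e → back~ c′≁b (proj₂ jc′ y e) e) , s′~c′ , tw′ , np
          where
          s′∈′ : s′ ∈ S′
          s′∈′ = proj₁ (proj₂ pb′)
          s′∈ : s′ ∈ S
          s′∈ = [ proj₁ , (λ e → ⊥-elim (s′≢b e)) ] (S′⁻ s′∈′)
          b≢s′ : b ≢ s′
          b≢s′ e = s′≢b (sym e)
          b′~s′ : b′ ~ s′
          b′~s′ = proj₁ (proj₂ (proj₂ pb′))
          c′≁b : ¬ c′ ~ b
          c′≁b e = np′ b s e b≢s′ priv-s
          c′∉ : c′ ∉ S
          c′∉ = ∉S′⁻ (proj₁ jc′) λ { refl → c′≁b s~b }
          b′≁b : ¬ b′ ~ b
          b′≁b e = b≢s′ (proj₂ (proj₂ (proj₂ pb′)) b b∈S′ e)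
          b′∉ : b′ ∉ S
          b′∉ = ∉S′⁻ (proj₁ pb′) λ { refl → b′≁b s~b }
          -- A neighbour b′ of s would be a twin of c and so have a neighbour in the new set besides
          -- s′.
          b′≁s : ¬ b′ ~ s
          b′≁s e with exists-other₂ c s s′
          ... | y , c~y , y≢s , y≢s′ =
            y≢s′ (proj₂ (proj₂ (proj₂ pb′)) y (keep (proj₂ jc y c~y) y≢s)
                   (twin (~-sym e) (λ { refl → proj₁ pb′ b∈S′ }) y c~y))
          np : ∀ y w → c′ ~ y → y ≢ s′ → ¬ Priv w y
          np y w c′~y y≢s′ p@(w∉ , y∈ , w~y , only) = np′ y w c′~y y≢s′
            (∉S′⁺ w∉ w≢b , proj₂ jc′ y c′~y , w~y , λ y′ y′∈ e → only y′ (back~ w≁b y′∈ e) e)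
            where
            w≢b : w ≢ b
            w≢b refl = s∉S′ (subst (_∈ S′) (sym (only s s∈ (~-sym s~b))) (proj₂ jc′ y c′~y))
            w≁b : ¬ w ~ b
            w≁b e = 1≢r (trans (sym (Priv⇒dS p)) (proj₂ (proj₂ star-b) w (~-sym e) w∉))

        -- If the flip makes b tight in turn, exchanging the two full neighbourhoods of the twin classes of c and u₀ for
        -- the classes themselves must leave a vertex w undominated, and w contradicts the minimality of S.
        module _ {b₀ u₀ : Fin n} (tw′ : ′.Tw b b₀ u₀) where
          private
            pb₀ : ′.Priv b₀ b
            pb₀ = proj₁ tw′
            ju : ′.J u₀
            ju = proj₁ (proj₂ tw′)
            b~u : b ~ u₀
            b~u = proj₁ (proj₂ (proj₂ tw′))

            -- Any other b₀ had a neighbour in S, which survives the flip as b₀ does not see s;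
            -- being private to b, it would force b into S.
            b₀≡s : b₀ ≡ s
            b₀≡s with b₀ ≟ s
            ... | yes e = e
            ... | no b₀≢s with dominator b₀∉
              where
              b₀∉ : b₀ ∉ S
              b₀∉ = ∉S′⁻ (proj₁ pb₀) b₀≢s
            ...   | y , y∈ , e = ⊥-elim (b∉ (subst (_∈ S) (proj₂ (proj₂ (proj₂ pb₀)) y (keep~ b₀≁s y∈ e) e) y∈))
              where
              b~b₀ : b ~ b₀
              b~b₀ = ~-sym (proj₁ (proj₂ (proj₂ pb₀)))
              b₀≁s : ¬ b₀ ~ s
              b₀≁s e = [ (λ { refl → ~⇒≢ b~b₀ refl }) , (λ j′ → b∉ (proj₂ j′ b (~-sym b~b₀))) ] (N[s] (~-sym e))

            twin′ : ∀ {u} → b ~ u → u ≢ s → u₀ ⊆ᴺ u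
            twin′ e ne = proj₁ (proj₂ (proj₂ (proj₂ tw′))) _ e (λ eq → ne (trans eq b₀≡s))

            u₀≢s : u₀ ≢ s
            u₀≢s refl = F′.Priv⇒¬J priv-s ju

            leaf∉ : ∀ {u} → b ~ u → u ≢ s → u ∉ S
            leaf∉ e ne u∈ = ne (proj₂ (proj₂ (proj₂ pb)) _ u∈ e)

            leaf-dS : ∀ {u} → b ~ u → u ≢ s → dS u ≡ suc r
            leaf-dS e ne = proj₂ (proj₂ star-b) _ e (leaf∉ e ne)

            U⊆S : ∀ {y} → u₀ ~ y → y ≢ b → y ∈ S
            U⊆S e ne = [ proj₁ , (λ eq → ⊥-elim (ne eq)) ] (S′⁻ (proj₂ ju _ e))

            U∌s : ∀ {y} → u₀ ~ y → y ≢ s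
            U∌s e refl = s∉S′ (proj₂ ju _ e)

            fans-disjoint : ∀ v → (s ~ v × v ≢ b) → (b ~ v × v ≢ s) → ⊥
            fans-disjoint v (e , ne) (e′ , _) = b∉ (proj₂ (J-twin e ne) b (~-sym e′))

            disjoint : ∀ {y} → c ~ y → u₀ ~ y → y ≢ b → ⊥
            disjoint {y} e e′ _ = two-fans (≤-trans (+-mono-≤ (#N∖≥ s b) (#N∖≥ b s))
              (≤-trans (#-⊎ (y ~?_) (N∖? s b) (N∖? b s)
                         (λ v p → ~-sym (twin (proj₁ p) (proj₂ p) y e))
                         (λ v p → ~-sym (twin′ (proj₁ p) (proj₂ p) y e′)) fans-disjoint)
                       (≤-reflexive (deg y))))

            D W : Fin n → Set
            D y = c ~ y ⊎ (u₀ ~ y × y ≢ b)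
            W v = (s ~ v × v ≢ b) ⊎ (b ~ v × v ≢ s)

            D? : Decidable D
            D? y = (c ~? y) ⊎-dec N∖? u₀ b y

            W? : Decidable W
            W? v = N∖? s b v ⊎-dec N∖? b s v

            V? : Decidable (λ v → v ∉ S × ¬ W v × v ≢ b × (∀ y → y ∈ S → v ~ y → D y))
            V? v = ¬? (v ∈? S) ×-dec ¬? (W? v) ×-dec ¬? (v ≟ b) ×-dec
                   all? (λ y → (y ∈? S) →-dec ((v ~? y) →-dec D? y))

            sw : Swap D W
            sw = record { D⊆S = D⊆S ; W∉S = W∉S ; W-indep = W-indep ; N[W]⊆D = N[W]⊆D ; D-dom = D-dom }
              where
              D⊆S : ∀ {v} → D v → v ∈ S
              D⊆S (inj₁ e) = proj₂ jc _ e
              D⊆S (inj₂ (e , ne)) = U⊆S e ne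
              W∉S : ∀ {v} → W v → v ∉ S
              W∉S (inj₁ (e , ne)) = proj₁ (J-twin e ne)
              W∉S (inj₂ (e , ne)) = leaf∉ e ne
              W-indep : ∀ {u v} → W u → W v → ¬ u ~ v
              W-indep (inj₁ (e , ne)) w′ = J≁J (J-twin e ne) (W∉S w′)
              W-indep (inj₂ p) (inj₁ (e , ne)) e′ = J≁J (J-twin e ne) (W∉S (inj₂ p)) (~-sym e′)
              W-indep (inj₂ (e , ne)) (inj₂ (e₂ , ne₂)) e′ =
                ~⇒≢ e₂ (out-unique (leaf-dS e ne) (~-sym e) b∉ e′ (leaf∉ e₂ ne₂))
              N[W]⊆D : ∀ {w y} → W w → y ∈ S → w ~ y → D y
              N[W]⊆D (inj₁ (e , ne)) y∈ e′ = inj₁ (⊆ᴺ-sym (twin e ne) _ e′)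
              N[W]⊆D (inj₂ (e , ne)) y∈ e′ = inj₂ (⊆ᴺ-sym (twin′ e ne) _ e′ , λ { refl → b∉ y∈ })
              D-dom : ∀ {d} → D d → ∃[ w ] W w × d ~ w
              D-dom (inj₁ e) = c , inj₁ (s~c , λ { refl → Priv⇒¬J pb jc }) , ~-sym e
              D-dom (inj₂ (e , _)) = u₀ , inj₂ (b~u , u₀≢s) , ~-sym e

            -- The removed sets, all neighbours of c and those of u₀ except b, are disjoint and have
            -- 2k - 1 vertices; the two fans replacing them have 2k - 2.
            ∃V : 1 ≤ # V?
            ∃V = +-cancelˡ-≤ (suc r + suc r) _ _ (begin
              suc r + suc r + 1                     ≡⟨ +-comm _ 1 ⟩
              k + suc r                             ≤⟨ +-mono-≤ (≤-reflexive (sym (deg c))) (#N∖≥ u₀ b) ⟩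
              # (c ~?_) + # (N∖? u₀ b)              ≤⟨ #-⊎ D? (c ~?_) (N∖? u₀ b) (λ v → inj₁) (λ v → inj₂) (λ v e p → disjoint e (proj₁ p) (proj₂ p)) ⟩
              # D?                                  ≤⟨ swap-≤ D? W? S-ID min sw V? (λ { v (v∉ , cl , ¬w , ¬e) →
                                                        v∉ , ¬w , (λ { refl → ¬e (inj₂ (b~u , u₀≢s)) b~u }) , λ y y∈ e → cl y∈ e }) ⟩
              # W? + # V?                           ≤⟨ +-monoˡ-≤ (# V?) (#-∪ W? (N∖? s b) (N∖? b s) (λ v → id)) ⟩
              # (N∖? s b) + # (N∖? b s) + # V?      ≤⟨ +-monoˡ-≤ (# V?) (+-mono-≤ (#N∖≤ s~b) (#N∖≤ (~-sym s~b))) ⟩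
              suc r + suc r + # V?                  ∎)
              where open ≤-Reasoning

            module _ {w} (w∉ : w ∉ S) (¬Ww : ¬ W w) (w≢b : w ≢ b) (w⊑ : ∀ y → y ∈ S → w ~ y → D y) where

              w≁s : ¬ w ~ s
              w≁s e = ¬Ww (inj₁ (~-sym e , w≢b))

              w≁b : ¬ w ~ b
              w≁b e = ¬Ww (inj₂ (~-sym e , λ { refl → w∉ s∈ }))

              N[fan] : ∀ {Q : Fin n → Set} (Q? : Decidable Q) → suc r ≤ # Q? → ¬ Q w →
                       ∀ {p} → (∀ v → Q v → p ~ v) → p ~ w → ∀ {v} → p ~ v → Q v ⊎ v ≡ w
              N[fan] Q? le ¬q {p} Q⊆ p~w {v} = #⊆⇒⊇ (λ v → Q? v ⊎-dec (v ≟ w)) (p ~?_)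
                (λ v → [ Q⊆ v , (λ { refl → p~w }) ])
                (≤-trans (≤-reflexive (deg p)) (≤-trans (s≤s le) (≤-trans (≤-reflexive (+-comm 1 _))
                  (#-⊎⁅⁆ (λ v → Q? v ⊎-dec (v ≟ w)) Q? w (λ v → inj₁) (inj₂ refl) ¬q)))) v

              N[C] : ∀ {p v} → c ~ p → w ~ p → p ~ v → (s ~ v × v ≢ b) ⊎ v ≡ w
              N[C] c~p w~p = N[fan] (N∖? s b) (#N∖≥ s b) (λ q → ¬Ww (inj₁ q))
                (λ v q → ~-sym (twin (proj₁ q) (proj₂ q) _ c~p)) (~-sym w~p)

              N[U] : ∀ {p v} → u₀ ~ p → w ~ p → p ~ v → (b ~ v × v ≢ s) ⊎ v ≡ w
              N[U] u~p w~p = N[fan] (N∖? b s) (#N∖≥ b s) (λ q → ¬Ww (inj₂ q))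
                (λ v q → ~-sym (twin′ (proj₁ q) (proj₂ q) _ u~p)) (~-sym w~p)

              module _ (U⊆w : ∀ p → u₀ ~ p → p ≢ b → w ~ p) where

                D₂ W₂ : Fin n → Set
                D₂ y = (y ∈ S × w ~ y) ⊎ y ≡ s
                W₂ v = v ≡ b ⊎ v ≡ w

                D₂? : Decidable D₂
                D₂? y = dS? w y ⊎-dec (y ≟ s)

                W₂? : Decidable W₂
                W₂? v = (v ≟ b) ⊎-dec (v ≟ w)

                sw₂ : Swap D₂ W₂
                sw₂ = record { D⊆S = [ proj₁ , (λ { refl → s∈ }) ] ; W∉S = [ (λ { refl → b∉ }) , (λ { refl → w∉ }) ]
                             ; W-indep = W-indep ; N[W]⊆D = N[W]⊆D ; D-dom = D-dom }
                  where
                  W-indep : ∀ {u v} → W₂ u → W₂ v → ¬ u ~ v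
                  W-indep (inj₁ refl) (inj₁ refl) e = ~⇒≢ e refl
                  W-indep (inj₁ refl) (inj₂ refl) e = w≁b (~-sym e)
                  W-indep (inj₂ refl) (inj₁ refl) e = w≁b e
                  W-indep (inj₂ refl) (inj₂ refl) e = ~⇒≢ e refl
                  N[W]⊆D : ∀ {v y} → W₂ v → y ∈ S → v ~ y → D₂ y
                  N[W]⊆D (inj₁ refl) y∈ e = inj₂ (proj₂ (proj₂ (proj₂ pb)) _ y∈ e)
                  N[W]⊆D (inj₂ refl) y∈ e = inj₁ (y∈ , e)
                  D-dom : ∀ {d} → D₂ d → ∃[ v ] W₂ v × d ~ v
                  D-dom (inj₁ (_ , e)) = w , inj₂ refl , ~-sym e
                  D-dom (inj₂ refl) = b , inj₁ refl , s~b

                -- An undominated v has to see s: the S-neighbours of w meet only w, the fan of s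
                -- and the fan of b, and the last is dominated by b. So v is a twin of c, and w sees
                -- k - 1 neighbours of c besides k - 1 neighbours of u₀.
                none : ∀ v → Undom D₂ W₂ v → ⊥
                none v (v∉ , cl , ¬w , ¬e) = two-fans (≤-trans (+-mono-≤ (#N∖≥ c s) (#N∖≥ u₀ b))
                  (≤-trans (#-⊎ (w ~?_) (N∖? c s) (N∖? u₀ b)
                             (λ p q → C⊆w (proj₁ q) (proj₂ q)) (λ p q → U⊆w p (proj₁ q) (proj₂ q))
                             (λ p q q′ → disjoint (proj₁ q) (proj₁ q′) (proj₂ q′)))
                           (≤-reflexive (deg w))))
                  where
                  v≢b : v ≢ b
                  v≢b eq = ¬w (inj₁ eq)
                  s~v : s ~ v
                  s~v with dominator v∉
                  ... | y , y∈ , v~y with cl y∈ v~y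
                  ...   | inj₂ refl = ~-sym v~y
                  ...   | inj₁ (_ , w~y) with w⊑ y y∈ w~y
                  ...     | inj₁ c~y = [ proj₁ , (λ eq → ⊥-elim (¬w (inj₂ eq))) ] (N[C] c~y w~y (~-sym v~y))
                  ...     | inj₂ (u~y , _) = ⊥-elim ([ (λ q → ¬e (inj₁ refl) (~-sym (proj₁ q))) , (λ eq → ¬w (inj₂ eq)) ]
                                                        (N[U] u~y w~y (~-sym v~y)))
                  C⊆w : ∀ {p} → c ~ p → p ≢ s → w ~ p
                  C⊆w {p} c~p p≢s = [ proj₂ , (λ eq → ⊥-elim (p≢s eq)) ] (cl (proj₂ jc p c~p) (twin s~v v≢b p c~p))

                -- The k - 1 neighbours of u₀ other than b, all seen by w, make up k vertices
                -- together with s, and only two are put in their place.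
                absurd₁ : ⊥
                absurd₁ = <⇒≱ (s≤s (s≤s 1≤r)) (begin
                  k                             ≤⟨ s≤s (#N∖≥ u₀ b) ⟩
                  suc (# (N∖? u₀ b))            ≤⟨ s≤s (#-mono (N∖? u₀ b) (dS? w) (λ p q → U⊆S (proj₁ q) (proj₂ q) , U⊆w p (proj₁ q) (proj₂ q))) ⟩
                  suc (dS w)                    ≡⟨ +-comm 1 _ ⟩
                  dS w + 1                      ≤⟨ #-⊎⁅⁆ D₂? (dS? w) s (λ v → inj₁) (inj₂ refl) (λ q → w≁s (proj₂ q)) ⟩
                  # D₂?                         ≤⟨ swap-≤ D₂? W₂? S-ID min sw₂ (λ _ → no id) none ⟩
                  # W₂? + # {n} (λ _ → no id)   ≤⟨ +-mono-≤ (#-∪⁅⁆ W₂? (_≟ b) w (λ v → id)) (#≡0 {n} (λ _ → no id) (λ _ → id)) ⟩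
                  # (_≟ b) + 1 + 0              ≡⟨ cong (λ a → a + 1 + 0) (#-singleton b) ⟩
                  2                             ∎)
                  where open ≤-Reasoning

              module _ {p₀} (u~p₀ : u₀ ~ p₀) (p₀≢b : p₀ ≢ b) (w≁p₀ : ¬ w ~ p₀) where

                -- Members of the fan of s see s and those of the fan of b see p₀, but w sees
                -- neither.
                only-w : ∀ v → v ∉ S × v ⊑ w × ¬ w ~ v → v ≡ w
                only-w v (v∉ , v⊑w , _) with dominator v∉
                ... | p , p∈ , v~p with w⊑ p p∈ (v⊑w p p∈ v~p)
                ...   | inj₁ c~p = [ (λ q → ⊥-elim (w≁s (v⊑w s s∈ (~-sym (proj₁ q))))) , id ] (N[C] c~p (v⊑w p p∈ v~p) (~-sym v~p))
                ...   | inj₂ (u~p , _) = [ (λ q → ⊥-elim (w≁p₀ (v⊑w p₀ (U⊆S u~p₀ p₀≢b) (twin′ (proj₁ q) (proj₂ q) p₀ u~p₀)))) , id ]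
                                           (N[U] u~p (v⊑w p p∈ v~p) (~-sym v~p))

                dS≤1 : dS w ≤ 1
                dS≤1 = ≤-trans (dS≤#A w∉) (≤-trans (#-mono (A? w) (_≟ w) only-w) (≤-reflexive (#-singleton w)))

                -- With one neighbour in S, w is private to a neighbour of c before the flip or of
                -- u₀ after it; the last clause of `Tw` excludes both.
                absurd₂ : ⊥
                absurd₂ with dominator w∉
                ... | p , p∈ , w~p with w⊑ p p∈ w~p
                ...   | inj₁ c~p = no-priv c~p (λ { refl → w≁s w~p })
                                     (w∉ , p∈ , w~p , λ y y∈ e → #≤1⇒≡ (dS? w) dS≤1 (y∈ , e) (p∈ , w~p))
                ...   | inj₂ (u~p , p≢b) = proj₂ (proj₂ (proj₂ (proj₂ tw′))) p w u~p p≢b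
                                     (∉S′⁺ w∉ w≢b , keep p∈ (U∌s u~p) , w~p ,
                                      λ y y∈ e → #≤1⇒≡ (dS? w) dS≤1 (back~ w≁b y∈ e , e) (p∈ , w~p))

          absurd : ⊥
          absurd = from-V (1≤#⇒∃ V? ∃V)
            where
            from-V : ∃[ v ] v ∉ S × ¬ W v × v ≢ b × (∀ y → y ∈ S → v ~ y → D y) → ⊥
            from-V (w , w∉ , ¬Ww , w≢b , w⊑) = by-U (any? (λ p → N∖? u₀ b p ×-dec ¬? (w ~? p)))
              where
              by-U : Dec (∃[ p ] (u₀ ~ p × p ≢ b) × ¬ w ~ p) → ⊥
              by-U (yes (p , (e , ne) , w≁p)) = absurd₂ w∉ ¬Ww w≢b w⊑ e ne w≁p
              by-U (no ¬∃) = absurd₁ w∉ ¬Ww w≢b w⊑ λ p e ne →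
                decidable-stable (w ~? p) (λ w≁p → ¬∃ (p , (e , ne) , w≁p))

      -- The vertex s leaves the set, so its configuration is gone, and no vertex acquires a new
      -- one: not b, by `absurd`, nor any other, by `other-kept`.
      twins-< : # ′.TW? < # TW?
      twins-< = ≤-trans (≤-reflexive (+-comm 1 _)) (#-⊎⁅⁆ TW? ′.TW? s kept (b , c , tw) (λ { (_ , _ , p , _) → s∉S′ (proj₁ (proj₂ p)) }))
        where
        kept : ∀ v → ′.TW v → TW v
        kept v t with v ≟ b
        ... | no ne = other-kept t ne
        kept v (_ , _ , tw′) | yes refl = ⊥-elim (absurd tw′)

  -- Exchanging the two sides of a block

  module BlockSwap (S : Subset n) (S-ID : ID S) (min : At.Minimum S) {t x : Fin n} (blk : At.Blk S t x) where
    open At S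
    open Facts S S-ID
    open Minimal min
    open Block blk

    S′ : Subset n
    S′ = exchanged (N∖? t x) (InB? t x)

    keep : ∀ {v} → v ∈ S → ¬ (t ~ v × v ≢ x) → v ∈ S′
    keep v∈ ¬z = ∈⟦⟧⁺ (I? (N∖? t x) (InB? t x)) (inj₁ (v∈ , ¬z))

    B∈S′ : ∀ {b} → InB t x b → b ∈ S′
    B∈S′ ib = ∈⟦⟧⁺ (I? (N∖? t x) (InB? t x)) (inj₂ ib)

    S′⁻ : ∀ {v} → v ∈ S′ → (v ∈ S × ¬ (t ~ v × v ≢ x)) ⊎ InB t x v
    S′⁻ v∈ = ∈⟦⟧⁻ (I? (N∖? t x) (InB? t x)) v∈

    Z∉S′ : ∀ {z} → t ~ z → z ≢ x → z ∉ S′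
    Z∉S′ e ne z∈ = [ (λ p → proj₂ p (e , ne)) , (λ ib → proj₁ ib (proj₂ tJ _ e)) ] (S′⁻ z∈)

    t∉S′ : t ∉ S′
    t∉S′ t∈ = [ (λ p → proj₁ tJ (proj₁ p)) , t∉B ] (S′⁻ t∈)

    x∈S′ : x ∈ S′
    x∈S′ = keep (proj₂ tJ x t~x) (λ p → proj₂ p refl)

    ∈S∖S′ : ∀ {v} → v ∉ S′ → v ∈ S → t ~ v × v ≢ x
    ∈S∖S′ {v} v∉ v∈ = decidable-stable (N∖? t x v) (λ ¬z → v∉ (keep v∈ ¬z))

    ∉S′⁺ : ∀ {v} → v ∉ S → ¬ InB t x v → v ∉ S′
    ∉S′⁺ v∉ ¬ib v∈ = [ (λ p → v∉ (proj₁ p)) , ¬ib ] (S′⁻ v∈)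

    swap : Swap (λ y → t ~ y × y ≢ x) (InB t x)
    swap = record
      { D⊆S = λ p → proj₂ tJ _ (proj₁ p) ; W∉S = proj₁ ; W-indep = B-indep₁ blk
      ; N[W]⊆D = B~S ; D-dom = λ p → proj₁ b₀ , proj₂ b₀ , ~-sym (B~Z (proj₂ b₀) (proj₁ p) (proj₂ p)) }

    S′-ID : ID S′
    S′-ID = exchange-ID (N∖? t x) (InB? t x) (proj₁ S-ID) swap none
      where
      none : ∀ v → ¬ Undom (λ y → t ~ y × y ≢ x) (InB t x) v
      none v (v∉ , cl , ¬w , _) with dominator v∉
      ... | y , y∈ , e with cl y∈ e
      ...   | t~y , y≢x with Z~ t~y y≢x (~-sym e)
      ...     | inj₁ ib = ¬w ib
      ...     | inj₂ refl = proj₂ (cl (proj₂ tJ x t~x) t~x) refl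

    S′-size : size S′ ≤ size S
    S′-size = exchange-size (N∖? t x) (InB? t x) (Swap.D⊆S swap) (≤-trans #B≤ (#N∖≥ t x))

    module ′ = At S′
    module F′ = Facts S′ S′-ID

    B≁ : Fin n → Set
    B≁ v = ∀ b → InB t x b → ¬ v ~ b

    -- Vertices whose neighbours in the old and in the new set are the same: by `Z≁` they miss the
    -- removed side, by the last clause the inserted one.
    Away : Fin n → Set
    Away w = w ∉ S × w ≢ t × ¬ InB t x w × B≁ w

    Z≁ : ∀ {w z} → w ≢ t → ¬ InB t x w → t ~ z → z ≢ x → ¬ w ~ z
    Z≁ w≢t ¬ib e ne e′ = [ ¬ib , w≢t ] (Z~ e ne (~-sym e′))

    keep~ : ∀ {w y} → Away w → y ∈ S → w ~ y → y ∈ S′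
    keep~ (_ , w≢t , ¬ib , _) y∈ e = keep y∈ (λ p → Z≁ w≢t ¬ib (proj₁ p) (proj₂ p) e)

    back~ : ∀ {w y} → B≁ w → y ∈ S′ → w ~ y → y ∈ S
    back~ w≁ y∈ e = [ proj₁ , (λ ib → ⊥-elim (w≁ _ ib e)) ] (S′⁻ y∈)

    dS-same : ∀ {w} → Away w → ′.dS w ≡ dS w
    dS-same {w} aw = #-cong (′.dS? w) (dS? w)
      (λ y p → back~ (proj₂ (proj₂ (proj₂ aw))) (proj₁ p) (proj₂ p) , proj₂ p)
      (λ y p → keep~ aw (proj₁ p) (proj₂ p) , proj₂ p)

    priv-t : ′.Priv t x
    priv-t = t∉S′ , x∈S′ , t~x , λ y y∈ e →
      [ (λ p → decidable-stable (y ≟ x) (λ ne → proj₂ p (e , ne))) , (λ ib → ⊥-elim (proj₁ ib (proj₂ tJ y e))) ] (S′⁻ y∈)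

    -- Only x remains in the set among the neighbours of t; each of the others now sees k - 1
    -- members of the set, namely the block.
    star-t : ′.Star t
    star-t = t∉S′ , F′.Priv⇒dS priv-t , leaves
      where
      leaves : ∀ u → t ~ u → u ∉ S′ → ′.dS u ≡ suc r
      leaves u e u∉′ = trans (#-cong (′.dS? u) (InB? t x)
          (λ y p → [ (λ q → ⊥-elim (indep u∈ (proj₁ q) (proj₂ p))) , id ] (S′⁻ (proj₁ p)))
          (λ y ib → B∈S′ ib , ~-sym (B~Z ib e u≢x)))
        (≤-antisym #B≤ #B≥)
        where
        u∈ : u ∈ S
        u∈ = proj₂ tJ u e
        u≢x : u ≢ x
        u≢x refl = u∉′ x∈S′

    -- A leaf has its centre as only neighbour outside S, so a leaf seeing a block vertex would put
    -- the centre into the block, against 1 ≠ k - 1. Only centres adjacent to the block are at risk.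
    star-kept : ∀ {v} → Star v → B≁ v → ′.Star v
    star-kept {v} (v∉ , d1 , leaves) v≁ = ∉S′⁺ v∉ ¬ib , trans (dS-same (v∉ , v≢t , ¬ib , v≁)) d1 , leaves′
      where
      ¬ib : ¬ InB t x v
      ¬ib ib = 1≢r (trans (sym d1) (B-dS ib))
      v≢t : v ≢ t
      v≢t refl with trans (sym d1) (J⇒dS tJ)
      ... | ()
      leaves′ : ∀ u → v ~ u → u ∉ S′ → ′.dS u ≡ suc r
      leaves′ u e u∉′ = trans (dS-same (u∉ , u≢t , v≁u , u≁)) du
        where
        u∉ : u ∉ S
        u∉ u∈ = Z≁ v≢t ¬ib (proj₁ (∈S∖S′ u∉′ u∈)) (proj₂ (∈S∖S′ u∉′ u∈)) e
        du : dS u ≡ suc r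
        du = leaves u e u∉
        u≢t : u ≢ t
        u≢t refl = J≁J tJ v∉ (~-sym e)
        v≁u : ¬ InB t x u
        v≁u ib = v≁ u ib e
        u≁ : B≁ u
        u≁ b ib e′ = ¬ib (subst (InB t x) (sym (out-unique du (~-sym e) v∉ e′ (proj₁ ib))) ib)

    Near : Fin n → Set
    Near v = ∃[ b ] InB t x b × v ~ b

    Near? : Decidable Near
    Near? v = any? (λ b → InB? t x b ×-dec (v ~? b))

    far? : Decidable (λ v → Star v × ¬ Near v)
    far? v = Star? v ×-dec ¬? (Near? v)

    far+1 : # far? + 1 ≤ # ′.Star?
    far+1 = #-⊎⁅⁆ ′.Star? far? t (λ v p → star-kept (proj₁ p) (λ b ib e → proj₂ p (b , ib , e))) star-t
              (λ { ((_ , d1 , _) , _) → contra (trans (sym d1) (J⇒dS tJ)) })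
      where
      contra : 1 ≢ k
      contra ()

    J′⇒∉ : ∀ {v} → ′.J v → v ∉ S
    J′⇒∉ jv v∈ = t∉S′ (proj₂ jv t (~-sym (proj₁ (∈S∖S′ (proj₁ jv) v∈))))

    J′⇒J : ∀ {v} → ′.J v → B≁ v → J v
    J′⇒J jv v≁ = J′⇒∉ jv , λ y e → back~ v≁ (proj₂ jv y e) e

    J′⇒≢t : ∀ {v} → ′.J v → v ≢ t
    J′⇒≢t jv refl with exists-other t x
    ... | z , e , ne = Z∉S′ e ne (proj₂ jv z e)

    -- If every star near the block hangs on x, exchanging Z for B keeps the number of stars.
    module Closed {b̂ : Fin n} (bad : Bad x) (pb : Priv b̂ x) (near : Near b̂)
                  (only-near : ∀ {v} → Star v → Near v → v ≡ b̂)
                  (bad⇒star : ∀ {s b} → Bad s → Priv b s → Star b) where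

      priv-unique : ∀ {w} → Priv w x → w ≡ b̂
      priv-unique p = #≤1⇒≡ (λ w → Priv? w x) (≤-reflexive (proj₁ bad)) p pb

      -- Otherwise exchange all k neighbours of t for b̂ and t: an undominated vertex would be
      -- private to x and hence equal b̂.
      not-all : ¬ (∀ b → InB t x b → b̂ ~ b)
      not-all all = <⇒≱ (s≤s (s≤s 1≤r)) (begin
        k                             ≡⟨ sym (deg t) ⟩
        # (t ~?_)                     ≤⟨ swap-≤ (t ~?_) W? S-ID min sw (λ _ → no id) none ⟩
        # W? + # {n} (λ _ → no id)    ≤⟨ +-mono-≤ (#-∪⁅⁆ W? (_≟ b̂) t (λ v → id)) (#≡0 {n} (λ _ → no id) (λ _ → id)) ⟩
        # (_≟ b̂) + 1 + 0              ≡⟨ cong (λ a → a + 1 + 0) (#-singleton b̂) ⟩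
        2                             ∎)
        where
        open ≤-Reasoning
        W : Fin n → Set
        W v = v ≡ b̂ ⊎ v ≡ t
        W? : Decidable W
        W? v = (v ≟ b̂) ⊎-dec (v ≟ t)
        sw : Swap (t ~_) W
        sw = record { D⊆S = proj₂ tJ _ ; W∉S = W∉S ; W-indep = W-indep ; N[W]⊆D = N[W]⊆D
                    ; D-dom = λ e → t , inj₂ refl , ~-sym e }
          where
          W∉S : ∀ {v} → W v → v ∉ S
          W∉S (inj₁ refl) = proj₁ pb
          W∉S (inj₂ refl) = proj₁ tJ
          W-indep : ∀ {u v} → W u → W v → ¬ u ~ v
          W-indep (inj₁ refl) (inj₁ refl) e = ~⇒≢ e refl
          W-indep (inj₁ refl) (inj₂ refl) e = J≁J tJ (proj₁ pb) (~-sym e)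
          W-indep (inj₂ refl) w e = J≁J tJ (W∉S w) e
          N[W]⊆D : ∀ {w y} → W w → y ∈ S → w ~ y → t ~ y
          N[W]⊆D (inj₁ refl) y∈ e = subst (t ~_) (sym (proj₂ (proj₂ (proj₂ pb)) _ y∈ e)) t~x
          N[W]⊆D (inj₂ refl) y∈ e = e
        none : ∀ v → Undom (t ~_) W v → ⊥
        none v (v∉ , cl , ¬w , ¬e) = ¬w (inj₁ (priv-unique (v∉ , proj₂ tJ x t~x , v~x , only-x)))
          where
          only-x : ∀ y → y ∈ S → v ~ y → y ≡ x
          only-x y y∈ e with y ≟ x
          ... | yes eq = eq
          ... | no ne = ⊥-elim ([ (λ ib → ¬e (inj₁ refl) (~-sym (all v ib))) , (λ eq → ¬w (inj₂ eq)) ]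
                                  (Z~ (cl y∈ e) ne (~-sym e)))
          v~x : v ~ x
          v~x with dominator v∉
          ... | y , y∈ , e = subst (v ~_) (only-x y y∈ e) e

      TW-kept : ∀ s′ → ′.TW s′ → TW s′
      TW-kept s′ (b′ , c′ , tw) = b′ , c′ , pb″ , J′⇒J jc c′≁ , s′~c′ , proj₁ (proj₂ (proj₂ (proj₂ tw))) , np
        where
        module T′ = Twins S′ S′-ID tw
        pb′ : ′.Priv b′ s′
        pb′ = proj₁ tw
        jc : ′.J c′
        jc = proj₁ (proj₂ tw)
        s′~c′ : s′ ~ c′
        s′~c′ = proj₁ (proj₂ (proj₂ tw))
        only′ : ∀ y → y ∈ S′ → b′ ~ y → y ≡ s′
        only′ = proj₂ (proj₂ (proj₂ pb′))
        -- All k - 1 ≥ 2 twins of c′ would see b, which has only one neighbour outside S.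
        c′≁ : B≁ c′
        c′≁ b ib e with #-other (N∖? s′ b′) (≤-trans (s≤s 1≤r) (#N∖≥ s′ b′)) c′
        ... | c″ , (s′~c″ , c″≢b′) , c″≢c′ = c″≢c′ (out-unique (B-dS ib)
                (~-sym (T′.twin s′~c″ c″≢b′ b e)) (J′⇒∉ (T′.J-twin s′~c″ c″≢b′)) (~-sym e) (J′⇒∉ jc))
        s′∈ : s′ ∈ S
        s′∈ = proj₂ (J′⇒J jc c′≁) s′ (~-sym s′~c′)
        b′∉ : b′ ∉ S
        b′∉ b′∈ with ∈S∖S′ (proj₁ pb′) b′∈ | b₀
        ... | e , ne | b , ib = proj₁ ib (subst (_∈ S) (sym (only′ b (B∈S′ ib) (~-sym (B~Z ib e ne)))) s′∈)
        b′≁ : B≁ b′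
        b′≁ b ib e = proj₁ ib (subst (_∈ S) (sym (only′ b (B∈S′ ib) e)) s′∈)
        -- If b′ were t then s′ would be x, so b̂ would be a twin of c′ and c′ would see the block.
        b′≢t : b′ ≢ t
        b′≢t refl with only′ x x∈S′ t~x
        ... | refl = c′≁ _ (proj₁ (proj₂ near))
                (⊆ᴺ-sym (T′.twin (~-sym (proj₁ (proj₂ (proj₂ pb)))) (λ { refl → Priv⇒¬J pb tJ })) _ (proj₂ (proj₂ near)))
        b′-away : Away b′
        b′-away = b′∉ , b′≢t , (λ ib → proj₁ pb′ (B∈S′ ib)) , b′≁
        pb″ : Priv b′ s′
        pb″ = b′∉ , s′∈ , proj₁ (proj₂ (proj₂ pb′)) , λ y y∈ e → only′ y (keep~ b′-away y∈ e) e
        np : ∀ y w → c′ ~ y → y ≢ s′ → ¬ Priv w y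
        np y w c′~y y≢s′ p@(w∉ , y∈ , w~y , only) with Near? w
        ... | no ¬near = T′.no-priv c′~y y≢s′ (∉S′⁺ w∉ ¬ib , proj₂ jc y c′~y , w~y ,
                           λ y′ y′∈ e → only y′ (back~ (λ b ib e′ → ¬near (b , ib , e′)) y′∈ e) e)
          where
          ¬ib : ¬ InB t x w
          ¬ib ib = 1≢r (trans (sym (Priv⇒dS p)) (B-dS ib))
        -- The twins of c′ make y bad, so w is a star near the block. Hence w is b̂ and y is x; but
        -- after the exchange t is private to x.
        ... | yes near-w = T′.no-priv c′~y y≢s′ (subst (′.Priv t) (sym y≡x) priv-t)
          where
          twins-y : suc r ≤ j y
          twins-y = ≤-trans (#N∖≥ s′ b′) (#-mono (N∖? s′ b′) (JN? y) λ v q →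
            J′⇒J (T′.J-twin (proj₁ q) (proj₂ q)) (λ b ib e → c′≁ b ib (⊆ᴺ-sym (T′.twin (proj₁ q) (proj₂ q)) b e))
            , ~-sym (T′.twin (proj₁ q) (proj₂ q) y c′~y))
          bad-y : Bad y
          bad-y = ≤-antisym (+-cancelʳ-≤ (suc r) _ _ (≤-trans (+-monoʳ-≤ (m y) twins-y) (m+j≤k y)))
                            (1≤# (λ v → Priv? v y) p) , twins-y
          y≡x : y ≡ x
          y≡x = proj₂ (proj₂ (proj₂ pb)) y y∈ (subst (_~ y) (only-near (bad⇒star bad-y p) near-w) w~y)

      Cl-kept : ∀ t′ → ′.Cl t′ → Cl t′
      Cl-kept t′ (x′ , b′ , u , blk′ , pb′ , iu , b′~u) =
        x′ , b′ , u , (jt′ , t′~x′ , ≤-trans (proj₂ (proj₂ blk′)) (#-mono (′.InB? t′ x′) (InB? t′ x′) (λ _ → InB-kept)))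
           , pb″ , InB-kept iu , b′~u
        where
        j′ : ′.J t′
        j′ = proj₁ blk′
        t′~x′ : t′ ~ x′
        t′~x′ = proj₁ (proj₂ blk′)
        only′ : ∀ y → y ∈ S′ → b′ ~ y → y ≡ x′
        only′ = proj₂ (proj₂ (proj₂ pb′))
        -- If b is x′, then b′ equals t′ or is a removed vertex adjacent to the whole inserted
        -- block, which is not private. Otherwise u sees b; u cannot equal t′, so it is a removed
        -- vertex, and t′ sees the whole block. Then t′ is b̂, against `not-all`.
        t′≁ : B≁ t′
        t′≁ b ib e with b ≟ x′
        ... | yes refl with b′ ∈? S
        ...   | no b′∉ = F′.Priv⇒¬J pb′ (subst ′.J (out-unique (B-dS ib) (~-sym e) (J′⇒∉ j′)
                           (~-sym (proj₁ (proj₂ (proj₂ pb′)))) b′∉) j′)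
        ...   | yes b′∈ with ∈S∖S′ (proj₁ pb′) b′∈ | #-other (InB? t x) (≤-trans (s≤s 1≤r) #B≥) b
        ...     | e₁ , ne | b₂ , ib₂ , b₂≢b = b₂≢b (only′ b₂ (B∈S′ ib₂) (~-sym (B~Z ib₂ e₁ ne)))
        t′≁ b ib e | no b≢x′ with u ∈? S
        ... | no u∉ = F′.Block.t∉B blk′ (subst (′.InB t′ x′) (out-unique (B-dS ib)
                        (~-sym (F′.Block.B~Z blk′ iu e b≢x′)) u∉ (~-sym e) (J′⇒∉ j′)) iu)
        ... | yes u∈ with ∈S∖S′ (proj₁ iu) u∈
        ...   | t~u , u≢x = not-all (λ b₁ ib₁ → subst (_~ b₁) t′≡b̂ (t′~B b₁ ib₁))
          where
          t′~B : ∀ b₁ → InB t x b₁ → t′ ~ b₁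
          t′~B b₁ ib₁ = proj₁ (F′.Block.B~S blk′ iu (B∈S′ ib₁) (~-sym (B~Z ib₁ t~u u≢x)))
          t′≡b̂ : t′ ≡ b̂
          t′≡b̂ = out-unique (B-dS (proj₁ (proj₂ near))) (~-sym (t′~B _ (proj₁ (proj₂ near)))) (J′⇒∉ j′)
                   (~-sym (proj₂ (proj₂ near))) (proj₁ pb)
        jt′ : J t′
        jt′ = J′⇒J j′ t′≁
        x′∈ : x′ ∈ S
        x′∈ = proj₂ jt′ x′ t′~x′
        InB-∉ : ∀ {v} → ′.InB t′ x′ v → v ∉ S
        InB-∉ iv v∈ with ∈S∖S′ (proj₁ iv) v∈ | b₀
        ... | e , ne | b , ib = t′≁ b ib (proj₁ (F′.Block.B~S blk′ iv (B∈S′ ib) (~-sym (B~Z ib e ne))))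
        InB-kept : ∀ {v} → ′.InB t′ x′ v → InB t′ x′ v
        InB-kept {v} iv@(v∉′ , f , g) = InB-∉ iv , (λ y y∈ e → f y (keep~ away y∈ e) e) , g
          where
          v≢t : v ≢ t
          v≢t refl with exists-other₂ t′ x′ x
          ... | y , e , y≢x′ , y≢x = y≢x (proj₂ (proj₂ (proj₂ priv-t)) y (proj₂ j′ y e) (g y e y≢x′))
          away : Away v
          away = InB-∉ iv , v≢t , (λ ib → v∉′ (B∈S′ ib)) , λ b ib e → t′≁ b ib (proj₁ (f b (B∈S′ ib) e))
        b′≁ : B≁ b′
        b′≁ b ib e = proj₁ ib (subst (_∈ S) (sym (only′ b (B∈S′ ib) e)) x′∈)
        b′∉ : b′ ∉ S
        b′∉ b′∈ with ∈S∖S′ (proj₁ pb′) b′∈ | b₀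
        ... | e , ne | b , ib = b′≁ b ib (~-sym (B~Z ib e ne))
        b′-away : Away b′
        b′-away = b′∉ , (λ { refl → InB-∉ iu (proj₂ tJ u b′~u) }) , (λ ib → proj₁ pb′ (B∈S′ ib)) , b′≁
        pb″ : Priv b′ x′
        pb″ = b′∉ , x′∈ , proj₁ (proj₂ (proj₂ pb′)) , λ y y∈ e → only′ y (keep~ b′-away y∈ e) e

      -- No block enters the count, and t drops out of it: it has lost neighbours from the set and
      -- is no longer in J.
      Cl-< : # ′.Cl? < # Cl?
      Cl-< = ≤-trans (≤-reflexive (+-comm 1 _)) (#-⊎⁅⁆ Cl? ′.Cl? t Cl-kept
               (x , b̂ , proj₁ near , blk , pb , proj₁ (proj₂ near) , proj₂ (proj₂ near))
               (λ { (_ , _ , _ , blk′ , _) → J′⇒≢t (proj₁ blk′) refl }))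

      TW-≤ : # ′.TW? ≤ # TW?
      TW-≤ = #-mono ′.TW? TW? TW-kept

  -- The lexicographically optimal set

  record Optimal (S : Subset n) : Set where
    field
      S-ID : ID S
      size-min : ∀ S′ → ID S′ → size S ≤ size S′
      stars-max : ∀ S′ → ID S′ → size S′ ≤ size S → # (At.Star? S′) ≤ # (At.Star? S)
      TW-min : ∀ S′ → ID S′ → size S′ ≤ size S → # (At.Star? S) ≤ # (At.Star? S′) →
               # (At.TW? S) ≤ # (At.TW? S′)
      Cl-min : ∀ S′ → ID S′ → size S′ ≤ size S → # (At.Star? S) ≤ # (At.Star? S′) →
               # (At.TW? S′) ≤ # (At.TW? S) → # (At.Cl? S) ≤ # (At.Cl? S′)

  optimal-exists : ∀ S₀ → ID S₀ → ∃ Optimal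
  optimal-exists S₀ id₀ with minimal anySubset? ID? size (S₀ , id₀)
  ... | S₁ , id₁ , min₁
    -- The number of stars is at most n, so maximising it means minimising its difference from n.
    with minimal anySubset? (λ S → ID? S ×-dec (size S ≤? size S₁)) (λ S → n ∸ # (At.Star? S)) (S₁ , id₁ , ≤-refl)
  ...   | S₂ , (id₂ , le₂) , min₂
    with minimal anySubset? (λ S → (ID? S ×-dec (size S ≤? size S₁)) ×-dec (# (At.Star? S₂) ≤? # (At.Star? S)))
                 (λ S → # (At.TW? S)) (S₂ , (id₂ , le₂) , ≤-refl)
  ...     | S₃ , ((id₃ , le₃) , st₃) , min₃
    with minimal anySubset? (λ S → ((ID? S ×-dec (size S ≤? size S₁)) ×-dec (# (At.Star? S₂) ≤? # (At.Star? S)))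
                                     ×-dec (# (At.TW? S) ≤? # (At.TW? S₃)))
                 (λ S → # (At.Cl? S)) (S₃ , ((id₃ , le₃) , st₃) , ≤-refl)
  ...       | S , (((id′ , le) , st) , tw) , min₄ = S , record
    { S-ID = id′
    ; size-min = λ S′ i → ≤-trans le (min₁ S′ i)
    ; stars-max = λ S′ i l → ≤-trans (stars₂ S′ i (≤-trans l le)) st
    ; TW-min = λ S′ i l s → ≤-trans tw (min₃ S′ ((i , ≤-trans l le) , ≤-trans st s))
    ; Cl-min = λ S′ i l s t → min₄ S′ (((i , ≤-trans l le) , ≤-trans st s) , ≤-trans t tw)
    }
    where
    stars₂ : ∀ S′ → ID S′ → size S′ ≤ size S₁ → # (At.Star? S′) ≤ # (At.Star? S₂)
    stars₂ S′ i l = ≤-trans (≤-reflexive (sym (m∸[m∸n]≡n (#≤n (At.Star? S′)))))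
      (≤-trans (∸-monoʳ-≤ n (min₂ S′ (i , l))) (≤-reflexive (m∸[m∸n]≡n (#≤n (At.Star? S₂)))))

  module OptimalFacts (S : Subset n) (opt : Optimal S) where
    open Optimal opt public
    open At S
    open Facts S S-ID
    open Minimal size-min

    -- The flip makes s a star and can only lose the star b; were b none, the number of stars would
    -- grow.
    bad⇒star : ∀ {s b} → Bad s → Priv b s → Star b
    bad⇒star {s} {b} bad pb = decidable-stable (Star? b) λ ¬st →
      <⇒≱ (Flip.stars-< S S-ID bad pb ¬st) (stars-max _ (Flip.S′-ID S S-ID bad pb) (Flip.S′-size S S-ID bad pb))

    ¬TW : ∀ s → ¬ TW s
    ¬TW s (b , c , tw) = <⇒≱ (twins-< size-min (bad⇒star bad pb))
      (TW-min _ (Flip.S′-ID S S-ID bad pb) (Flip.S′-size S S-ID bad pb) (Flip.stars-≤ S S-ID bad pb))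
      where
      open Twins S S-ID tw
      pb : Priv b s
      pb = proj₁ tw

    -- Otherwise all stars near the block are private to x. If there is none, the block exchange
    -- gains a star. If there is one, x is bad, so this star is unique, the new star t makes up for
    -- its loss, and `Cl` drops.
    near-star : ∀ {t x} → Good t x → ∃[ v ] ∃[ s ] ∃[ b ] Star v × Priv v s × ¬ t ~ s × InB t x b × v ~ b
    near-star {t} {x} (blk , weak) =
      decidable-stable (any? λ v → any? λ s → any? λ b →
                          Star? v ×-dec Priv? v s ×-dec ¬? (t ~? s) ×-dec InB? t x b ×-dec (v ~? b)) absurd
      where
      open BlockSwap S S-ID size-min blk
      open Block blk
      absurd : ¬ ¬ (∃[ v ] ∃[ s ] ∃[ b ] Star v × Priv v s × ¬ t ~ s × InB t x b × v ~ b)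
      absurd none = case (any? λ v → Star? v ×-dec Near? v)
        where
        near-x : ∀ {v} → Star v → Near v → Priv v x
        near-x {v} st (b , ib , e) with Star⇒Priv st
        ... | s , p with t ~? s | s ≟ x
        ...   | no t≁s | _ = ⊥-elim (none (v , s , b , st , p , t≁s , ib , e))
        ...   | yes t~s | yes refl = p
        ...   | yes t~s | no s≢x with Z~ t~s s≢x (~-sym (proj₁ (proj₂ (proj₂ p))))
        ...     | inj₁ iv = ⊥-elim (1≢r (trans (sym (Priv⇒dS p)) (B-dS iv)))
        ...     | inj₂ refl = ⊥-elim (Priv⇒¬J p tJ)
        far-or : ∀ v → Star v → (Star v × ¬ Near v) ⊎ (Star v × Near v)
        far-or v st with Near? v
        ... | yes nr = inj₂ (st , nr)
        ... | no ¬nr = inj₁ (st , ¬nr)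
        case : Dec (∃[ v ] Star v × Near v) → ⊥
        case (no ¬e) = <⇒≱ (≤-trans (s≤s (#-mono Star? far? λ v st → st , λ nr → ¬e (v , st , nr)))
                                    (≤-trans (≤-reflexive (+-comm 1 _)) far+1))
                           (stars-max S′ S′-ID S′-size)
        case (yes (b̂ , st , nr)) = <⇒≱ Cl-< (Cl-min S′ S′-ID S′-size stars TW-≤)
          where
          pb : Priv b̂ x
          pb = near-x st nr
          bad : Bad x
          bad = weak (1≤# (λ w → Priv? w x) pb)
          only-near : ∀ {v} → Star v → Near v → v ≡ b̂
          only-near st′ nr′ = #≤1⇒≡ (λ w → Priv? w x) (≤-reflexive (proj₁ bad)) (near-x st′ nr′) pb
          open Closed bad pb nr only-near bad⇒star
          stars : # Star? ≤ # ′.Star?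
          stars = ≤-trans (#-∪⁅⁆ Star? far? b̂ λ v st′ →
                    [ inj₁ , (λ p → inj₂ (only-near (proj₁ p) (proj₂ p))) ] (far-or v st′)) far+1

  -- Blocks attached to the private vertices of s

  module Groups (S : Subset n) (opt : Optimal S) where
    open OptimalFacts S opt
    open At S
    open Facts S S-ID
    open Minimal size-min

    m≤1 : ∀ {t x} → Good t x → m x ≤ 1
    m≤1 {x = x} (_ , weak) with 1 ≤? m x
    ... | yes le = ≤-reflexive (proj₁ (weak le))
    ... | no ¬le = <⇒≤ (≰⇒> ¬le)

    small⇒¬J : ∀ {u a b} → (∀ {y} → y ∈ S → u ~ y → y ≡ a ⊎ y ≡ b) → ¬ J u
    small⇒¬J {u} {a} {b} sub ju with exists-other₂ u a b
    ... | y , e , y≢a , y≢b = [ y≢a , y≢b ] (sub (proj₂ ju y e) e)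

    only⇒Priv : ∀ {u a} → u ∉ S → (∀ {y} → y ∈ S → u ~ y → y ≡ a) → Priv u a
    only⇒Priv {u} u∉ sub with dominator u∉
    ... | y , y∈ , e with sub y∈ e
    ...   | refl = u∉ , y∈ , e , λ _ → sub

    module Group (s : Fin n) where

      Att : Fin n → Fin n → Set
      Att v t = ∃[ x ] ∃[ b ] Good t x × ¬ t ~ s × InB t x b × v ~ b

      Full : Fin n → Set
      Full v = ∃[ t ] ∃[ x ] Good t x × ¬ t ~ s × (∀ b → InB t x b → v ~ b)

      Ma : Fin n → Set
      Ma v = Priv v s × ∃ (Att v)

      Hit : Fin n → Set
      Hit t = ∃[ v ] Priv v s × Att v t

      abstract
        Att? : ∀ v → Decidable (Att v)
        Att? v t = any? λ x → any? λ b → Good? t x ×-dec ¬? (t ~? s) ×-dec InB? t x b ×-dec (v ~? b)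

        Full? : Decidable Full
        Full? v = any? λ t → any? λ x → Good? t x ×-dec ¬? (t ~? s) ×-dec all? (λ b → InB? t x b →-dec (v ~? b))

      abstract
        Ma? : Decidable Ma
        Ma? v = Priv? v s ×-dec any? (Att? v)

        Hit? : Decidable Hit
        Hit? t = any? λ v → Priv? v s ×-dec Att? v t

      -- A private vertex has at most k - 1 neighbours outside S, and the block supplies that many.
      leaves⊆B : ∀ {v t x} → Priv v s → Blk t x → (∀ b → InB t x b → v ~ b) →
                 ∀ {y} → v ~ y → y ∉ S → InB t x y
      leaves⊆B {v} {t} {x} p blk all e y∉ =
        #⊆⇒⊇ (InB? t x) (out? v) (λ b ib → all b ib , proj₁ ib) le _ (e , y∉)
        where
        le : # (out? v) ≤ # (InB? t x)
        le = ≤-trans (≤-pred (≤-trans (≤-reflexive (cong (_+ # (out? v)) (sym (Priv⇒dS p)))) (dS+out v)))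
                     (Block.#B≥ blk)

      full⇒one : ∀ {v} → Priv v s → Full v → # (Att? v) ≤ 1
      full⇒one {v} p (t , x , (blk , _) , _ , all) = #-unique (Att? v) λ t₁ t₂ a₁ a₂ → trans (is-t a₁) (sym (is-t a₂))
        where
        is-t : ∀ {t′} → Att v t′ → t′ ≡ t
        is-t (x′ , b′ , (blk′ , _) , _ , ib′ , e) = B-disjoint blk′ blk ib′ (leaves⊆B p blk all e (proj₁ ib′))

      -- Exchange s and the shared neighbours of all blocks not seeing s for v and the block vertices not adjacent to v.
      -- Each block attached to v is a vertex ahead, and only the members of Priv s attached to no block are lost.
      module NotFull {v} (pv : Priv v s) (¬full : ¬ Full v) where

        private
          s∈ : s ∈ S
          s∈ = proj₁ (proj₂ pv)

          Z : Fin n → Fin n → Set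
          Z t y = ∃[ x ] Good t x × ¬ t ~ s × t ~ y × y ≢ x

          B : Fin n → Fin n → Set
          B t u = ∃[ x ] Good t x × ¬ t ~ s × InB t x u × ¬ v ~ u

          Z? : ∀ t → Decidable (Z t)
          Z? t y = any? λ x → Good? t x ×-dec ¬? (t ~? s) ×-dec (t ~? y) ×-dec ¬? (y ≟ x)

          B? : ∀ t → Decidable (B t)
          B? t u = any? λ x → Good? t x ×-dec ¬? (t ~? s) ×-dec InB? t x u ×-dec ¬? (v ~? u)

          ∃Z? : Decidable (λ y → ∃[ t ] Z t y)
          ∃Z? y = any? λ t → Z? t y

          ∃B? : Decidable (λ u → ∃[ t ] B t u)
          ∃B? u = any? λ t → B? t u

          D W : Fin n → Set
          D y = (∃[ t ] Z t y) ⊎ y ≡ s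
          W u = (∃[ t ] B t u) ⊎ u ≡ v

          D? : Decidable D
          D? y = ∃Z? y ⊎-dec (y ≟ s)

          W? : Decidable W
          W? u = ∃B? u ⊎-dec (u ≟ v)

          V? : Decidable (λ u → Priv u s × ¬ Ma u)
          V? u = Priv? u s ×-dec ¬? (Ma? u)

          sw : Swap D W
          sw = record { D⊆S = D⊆S ; W∉S = W∉S ; W-indep = W-indep ; N[W]⊆D = N[W]⊆D ; D-dom = D-dom }
            where
            D⊆S : ∀ {y} → D y → y ∈ S
            D⊆S (inj₁ (t , x , (blk , _) , _ , e , _)) = proj₂ (proj₁ blk) _ e
            D⊆S (inj₂ refl) = s∈
            W∉S : ∀ {y} → W y → y ∉ S
            W∉S (inj₁ (_ , _ , _ , _ , ib , _)) = proj₁ ib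
            W∉S (inj₂ refl) = proj₁ pv
            W-indep : ∀ {u w} → W u → W w → ¬ u ~ w
            W-indep (inj₁ (_ , _ , (blk , _) , _ , ib , _)) (inj₁ (_ , _ , (blk′ , _) , _ , ib′ , _)) = B-indep blk blk′ ib ib′
            W-indep (inj₁ (_ , _ , _ , _ , _ , ≁)) (inj₂ refl) e = ≁ (~-sym e)
            W-indep (inj₂ refl) (inj₁ (_ , _ , _ , _ , _ , ≁)) e = ≁ e
            W-indep (inj₂ refl) (inj₂ refl) e = ~⇒≢ e refl
            N[W]⊆D : ∀ {w y} → W w → y ∈ S → w ~ y → D y
            N[W]⊆D (inj₁ (t , x , good , t≁s , ib , _)) y∈ e =
              inj₁ (t , x , good , t≁s , Block.B~S (proj₁ good) ib y∈ e)
            N[W]⊆D (inj₂ refl) y∈ e = inj₂ (proj₂ (proj₂ (proj₂ pv)) _ y∈ e)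
            D-dom : ∀ {d} → D d → ∃[ w ] W w × d ~ w
            D-dom (inj₂ refl) = v , inj₂ refl , ~-sym (proj₁ (proj₂ (proj₂ pv)))
            D-dom (inj₁ (t , x , good , t≁s , e , ne)) with any? (λ b → InB? t x b ×-dec ¬? (v ~? b))
            ... | yes (b , ib , ≁) = b , inj₁ (t , x , good , t≁s , ib , ≁) , ~-sym (Block.B~Z (proj₁ good) ib e ne)
            ... | no ¬∃ = ⊥-elim (¬full (t , x , good , t≁s ,
                            λ b ib → decidable-stable (v ~? b) (λ ≁ → ¬∃ (b , ib , ≁))))

          -- The blocks stay dominated: t keeps x, and a block vertex is inserted or sees v. So u is
          -- private to s. If it were attached to a block it would see an inserted vertex or, by
          -- `out-unique`, be v.
          V-all : ∀ u → Undom D W u → Priv u s × ¬ Ma u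
          V-all u (u∉ , cl , ¬w , ¬e) = only⇒Priv u∉ only , not-Ma
            where
            u≁Z : ∀ {y t} → Z t y → ¬ u ~ y
            u≁Z {t = t} (x , good@(blk , _) , t≁s , e , ne) u~y with Block.Z~ blk e ne (~-sym u~y)
            ... | inj₁ iu with v ~? u
            ...   | yes v~u = ¬e (inj₂ refl) (~-sym v~u)
            ...   | no v≁u = ¬w (inj₁ (t , x , good , t≁s , iu , v≁u))
            u≁Z {t = t} (x , good@(blk , _) , t≁s , e , ne) u~y | inj₂ refl with cl (proj₂ (proj₁ blk) x (Block.t~x blk)) (Block.t~x blk)
            ...   | inj₂ refl = t≁s (Block.t~x blk)
            ...   | inj₁ (t′ , x′ , (blk′ , _) , _ , t′~x , x≢x′) with Block.Z~J blk′ t′~x x≢x′ (~-sym (Block.t~x blk)) (proj₁ blk)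
            ...     | refl = x≢x′ (x-unique blk blk′)
            only : ∀ {y} → y ∈ S → u ~ y → y ≡ s
            only y∈ e with cl y∈ e
            ... | inj₁ (_ , z) = ⊥-elim (u≁Z z e)
            ... | inj₂ eq = eq
            not-Ma : ¬ Ma u
            not-Ma (_ , t , x , b , good , t≁s , ib , u~b) with v ~? b
            ... | no v≁b = ¬e (inj₁ (t , x , good , t≁s , ib , v≁b)) u~b
            ... | yes v~b = ¬w (inj₂ (out-unique (Block.B-dS (proj₁ good) ib) (~-sym u~b) u∉ (~-sym v~b) (proj₁ pv)))

          -- The removed and the inserted side have k - 1 vertices each before the neighbours of v
          -- are left out; an attached block omits at least one.
          block-gain : ∀ t → # (B? t) + 𝟙 (Att? v t) ≤ # (Z? t)
          block-gain t with any? (λ x → Good? t x ×-dec ¬? (t ~? s))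
          ... | no ¬∃ = ≤-trans (+-mono-≤ (#≡0 (B? t) λ { u (x , good , t≁s , _) → ¬∃ (x , good , t≁s) })
                                          (≤-reflexive (𝟙-no (Att? v t) λ { (x , _ , good , t≁s , _) → ¬∃ (x , good , t≁s) }))) z≤n
          ... | yes (x , good@(blk , _) , t≁s) = ≤-trans gain (≤-trans (≤-trans (Block.#B≤ blk) (#N∖≥ t x))
                  (#-mono (N∖? t x) (Z? t) λ y p → x , good , t≁s , p))
            where
            ⊆B : ∀ u → B t u → InB t x u
            ⊆B u (x′ , (blk′ , _) , _ , iu , _) = subst (λ a → InB t a u) (x-unique blk′ blk) iu
            gain : # (B? t) + 𝟙 (Att? v t) ≤ # (InB? t x)
            gain with Att? v t
            ... | no _ = ≤-trans (≤-reflexive (+-identityʳ _)) (#-mono (B? t) (InB? t x) ⊆B)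
            ... | yes (x′ , b , (blk′ , _) , _ , ib , v~b) =
              #-⊎⁅⁆ (InB? t x) (B? t) b ⊆B (subst (λ a → InB t a b) (x-unique blk′ blk) ib)
                    (λ { (_ , _ , _ , _ , ≁) → ≁ v~b })

          ∑B = sum (λ t → # (B? t))
          ∑Z = sum (λ t → # (Z? t))

          ∑Z≤ : ∑Z + 1 ≤ ∑B + 1 + # V?
          ∑Z≤ = begin
            ∑Z + 1              ≤⟨ +-monoˡ-≤ 1 (#-Σ≤ Z? ∃Z? (λ t y z → t , z) same) ⟩
            # ∃Z? + 1           ≤⟨ #-⊎⁅⁆ D? ∃Z? s (λ y → inj₁) (inj₂ refl) s∉Z ⟩
            # D?                ≤⟨ swap-≤ D? W? S-ID size-min sw V? V-all ⟩
            # W? + # V?         ≤⟨ +-monoˡ-≤ (# V?) (#-∪⁅⁆ W? ∃B? v (λ u → id)) ⟩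
            # ∃B? + 1 + # V?    ≤⟨ +-monoˡ-≤ (# V?) (+-monoˡ-≤ 1 (#≤-Σ B? ∃B? (λ u → id))) ⟩
            ∑B + 1 + # V?       ∎
            where
            open ≤-Reasoning
            same : ∀ t t′ y → Z t y → Z t′ y → t ≡ t′
            same t t′ y (x , (blk , _) , _ , e , ne) (x′ , (blk′ , _) , _ , e′ , _) =
              sym (Block.Z~J blk e ne (~-sym e′) (proj₁ blk′))
            s∉Z : ¬ (∃[ t ] Z t s)
            s∉Z (_ , _ , _ , t≁s , e , _) = t≁s e

          Att≤V : # (Att? v) ≤ # V?
          Att≤V = +-cancelˡ-≤ (∑B + 1) _ _ (begin
            ∑B + 1 + # (Att? v)     ≡⟨ +-assoc ∑B 1 _ ⟩
            ∑B + suc (# (Att? v))   ≡⟨ cong (∑B +_) (+-comm 1 _) ⟩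
            ∑B + (# (Att? v) + 1)   ≡⟨ sym (+-assoc ∑B _ 1) ⟩
            ∑B + # (Att? v) + 1     ≡⟨ cong (_+ 1) (sym (∑-distrib-+ (λ t → # (B? t)) (λ t → 𝟙 (Att? v t)))) ⟩
            _                       ≤⟨ +-monoˡ-≤ 1 (sum-mono block-gain) ⟩
            ∑Z + 1                  ≤⟨ ∑Z≤ ⟩
            ∑B + 1 + # V?           ∎)
            where open ≤-Reasoning

        few : # (Att? v) + # Ma? ≤ m s
        few = ≤-trans (+-monoˡ-≤ (# Ma?) Att≤V)
                (#-⊎ (λ w → Priv? w s) V? Ma? (λ u → proj₁) (λ u → proj₁) (λ u p q → proj₂ p q))

      -- Here t itself goes back into the set together with v, in exchange for s and all of N(t).
      module _ {v} (pv : Priv v s) (full : Full v) (m≡1 : m s ≡ 1) (r≤j : r ≤ j s) where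
        private
          t x : Fin n
          t = proj₁ full
          x = proj₁ (proj₂ full)
          good : Good t x
          good = proj₁ (proj₂ (proj₂ full))
          t≁s : ¬ t ~ s
          t≁s = proj₁ (proj₂ (proj₂ (proj₂ full)))
          v~B : ∀ b → InB t x b → v ~ b
          v~B = proj₂ (proj₂ (proj₂ (proj₂ full)))
          open Block (proj₁ good)

          D W : Fin n → Set
          D y = t ~ y ⊎ y ≡ s
          W u = u ≡ t ⊎ u ≡ v

          D? : Decidable D
          D? y = (t ~? y) ⊎-dec (y ≟ s)

          W? : Decidable W
          W? u = (u ≟ t) ⊎-dec (u ≟ v)

          sw : Swap D W
          sw = record { D⊆S = [ proj₂ tJ _ , (λ { refl → proj₁ (proj₂ pv) }) ] ; W∉S = W∉S ; W-indep = W-indep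
                      ; N[W]⊆D = N[W]⊆D ; D-dom = D-dom }
            where
            W∉S : ∀ {y} → W y → y ∉ S
            W∉S (inj₁ refl) = proj₁ tJ
            W∉S (inj₂ refl) = proj₁ pv
            W-indep : ∀ {u w} → W u → W w → ¬ u ~ w
            W-indep (inj₁ refl) w e = J≁J tJ (W∉S w) e
            W-indep w (inj₁ refl) e = J≁J tJ (W∉S w) (~-sym e)
            W-indep (inj₂ refl) (inj₂ refl) e = ~⇒≢ e refl
            N[W]⊆D : ∀ {w y} → W w → y ∈ S → w ~ y → D y
            N[W]⊆D (inj₁ refl) y∈ e = inj₁ e
            N[W]⊆D (inj₂ refl) y∈ e = inj₂ (proj₂ (proj₂ (proj₂ pv)) _ y∈ e)
            D-dom : ∀ {d} → D d → ∃[ w ] W w × d ~ w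
            D-dom (inj₁ e) = t , inj₁ refl , ~-sym e
            D-dom (inj₂ refl) = v , inj₂ refl , ~-sym (proj₁ (proj₂ (proj₂ pv)))

          only-xs : ∀ {u} → Undom D W u → ∀ {y} → y ∈ S → u ~ y → y ≡ x ⊎ y ≡ s
          only-xs {u} (_ , cl , ¬w , ¬e) {y} y∈ e with cl y∈ e | y ≟ x
          ... | inj₂ eq | _ = inj₂ eq
          ... | inj₁ _ | yes eq = inj₁ eq
          ... | inj₁ t~y | no ne = ⊥-elim ([ (λ iu → ¬e (inj₂ refl) (~-sym (v~B u iu))) , (λ eq → ¬w (inj₁ eq)) ]
                                             (Z~ t~y ne (~-sym e)))

          -- k + 1 vertices leave S and two enter, so at least k - 1 ≥ 2 are left undominated.
          bound : ∀ {V} (V? : Decidable V) → (∀ u → Undom D W u → V u) → # V? ≤ 1 → ⊥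
          bound V? V-all le = <⇒≱ (s≤s (s≤s (s≤s 1≤r))) (begin
            suc k                       ≡⟨ +-comm 1 k ⟩
            k + 1                       ≡⟨ cong (_+ 1) (sym (deg t)) ⟩
            # (t ~?_) + 1               ≤⟨ #-⊎⁅⁆ D? (t ~?_) s (λ y → inj₁) (inj₂ refl) t≁s ⟩
            # D?                        ≤⟨ swap-≤ D? W? S-ID size-min sw V? V-all ⟩
            # W? + # V?                 ≤⟨ +-mono-≤ (#-∪⁅⁆ W? (_≟ t) v (λ u → id)) le ⟩
            # (_≟ t) + 1 + 1            ≡⟨ cong (λ a → a + 1 + 1) (#-singleton t) ⟩
            3                           ∎)
            where open ≤-Reasoning

        -- Undominated vertices have no S-neighbours but x and s. If x has a private vertex then x
        -- is bad, and only that vertex qualifies. If not, they are neighbours of s outside J and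
        -- different from v, of which r ≤ j s leaves at most one.
        full-small : ⊥
        full-small with 1 ≤? m x
        ... | yes 1≤m with 1≤#⇒∃ (λ w → Priv? w x) 1≤m
        ...   | b̂ , pb = bound (_≟ b̂) V-all (≤-reflexive (#-singleton b̂))
          where
          V-all : ∀ u → Undom D W u → u ≡ b̂
          V-all u und@(u∉ , cl , ¬w , _) with u ~? x
          ... | yes u~x = [ id , (λ ju → ⊥-elim (small⇒¬J (only-xs und) ju)) ] (Flip.N[s] S S-ID (proj₂ good 1≤m) pb (~-sym u~x))
          ... | no u≁x = ⊥-elim (¬w (inj₂ (#≤1⇒≡ (λ w → Priv? w s) (≤-reflexive m≡1)
                           (only⇒Priv u∉ λ y∈ e → [ (λ { refl → ⊥-elim (u≁x e) }) , id ] (only-xs und y∈ e)) pv)))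
        full-small | no ¬1≤m = bound V? V-all #V≤1
          where
          V? : Decidable (λ u → (s ~ u × u ≢ v) × ¬ J u)
          V? u = N∖? s v u ×-dec ¬? (J? u)
          V-all : ∀ u → Undom D W u → (s ~ u × u ≢ v) × ¬ J u
          V-all u und@(u∉ , cl , ¬w , _) = (s~u , λ eq → ¬w (inj₂ eq)) , small⇒¬J (only-xs und)
            where
            s~u : s ~ u
            s~u = decidable-stable (s ~? u) λ s≁u → ¬1≤m (1≤# (λ w → Priv? w x)
                    (only⇒Priv u∉ λ y∈ e → [ id , (λ { refl → ⊥-elim (s≁u (~-sym e)) }) ] (only-xs und y∈ e)))
          #V≤1 : # V? ≤ 1
          #V≤1 = +-cancelʳ-≤ r _ _ (begin
            # V? + r          ≤⟨ +-monoʳ-≤ (# V?) r≤j ⟩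
            # V? + j s        ≤⟨ #-⊎ (N∖? s v) V? (JN? s) (λ u → proj₁) (λ u p → proj₂ p , λ { refl → Priv⇒¬J pv (proj₁ p) })
                                      (λ u p q → proj₂ p (proj₁ q)) ⟩
            # (N∖? s v)       ≤⟨ #N∖≤ (~-sym (proj₁ (proj₂ (proj₂ pv)))) ⟩
            suc r             ∎)
            where open ≤-Reasoning

      module _ {v₁ v₂} (v₁≢v₂ : v₁ ≢ v₂) (p₁ : Priv v₁ s) (p₂ : Priv v₂ s) (f₁ : Full v₁) (f₂ : Full v₂)
               (m≡2 : m s ≡ 2) (k≤ : k ≤ m s + j s) where
        private
          t₁ t₂ x₁ x₂ : Fin n
          t₁ = proj₁ f₁
          t₂ = proj₁ f₂
          x₁ = proj₁ (proj₂ f₁)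
          x₂ = proj₁ (proj₂ f₂)
          good₁ : Good t₁ x₁
          good₁ = proj₁ (proj₂ (proj₂ f₁))
          good₂ : Good t₂ x₂
          good₂ = proj₁ (proj₂ (proj₂ f₂))
          t₁≁s : ¬ t₁ ~ s
          t₁≁s = proj₁ (proj₂ (proj₂ (proj₂ f₁)))
          t₂≁s : ¬ t₂ ~ s
          t₂≁s = proj₁ (proj₂ (proj₂ (proj₂ f₂)))
          v₁~B : ∀ b → InB t₁ x₁ b → v₁ ~ b
          v₁~B = proj₂ (proj₂ (proj₂ (proj₂ f₁)))
          v₂~B : ∀ b → InB t₂ x₂ b → v₂ ~ b
          v₂~B = proj₂ (proj₂ (proj₂ (proj₂ f₂)))
          module B₁ = Block (proj₁ good₁)
          module B₂ = Block (proj₁ good₂)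

          s~v₁ : s ~ v₁
          s~v₁ = ~-sym (proj₁ (proj₂ (proj₂ p₁)))

          t₁≢t₂ : t₁ ≢ t₂
          t₁≢t₂ eq with B₁.b₀
          ... | b , ib = v₁≢v₂ (out-unique (B₁.B-dS ib) (~-sym (v₁~B b ib)) (proj₁ p₁)
                                 (~-sym (v₂~B b (subst₂ (λ t x → InB t x b) eq x₁≡x₂ ib))) (proj₁ p₂))
            where
            x₁≡x₂ : x₁ ≡ x₂
            x₁≡x₂ = x-unique (subst (λ t → Blk t x₁) eq (proj₁ good₁)) (proj₁ good₂)

          v₁≁B₂ : ∀ {b} → InB t₂ x₂ b → ¬ v₁ ~ b
          v₁≁B₂ ib e = v₁≢v₂ (out-unique (B₂.B-dS ib) (~-sym e) (proj₁ p₁) (~-sym (v₂~B _ ib)) (proj₁ p₂))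

          v₁≁v₂ : ¬ v₁ ~ v₂
          v₁≁v₂ e = 1≢r (trans (sym (Priv⇒dS p₂)) (B₁.B-dS (leaves⊆B p₁ (proj₁ good₁) v₁~B e (proj₁ p₂))))

          N[s] : ∀ {u} → s ~ u → Priv u s ⊎ J u
          N[s] {u} e = [ inj₁ , (λ q → inj₂ (proj₁ q)) ] (#⊆⇒⊇ P? (s ~?_) (λ u → [ (λ p → ~-sym (proj₁ (proj₂ (proj₂ p)))) , proj₂ ]) le u e)
            where
            P? : Decidable (λ u → Priv u s ⊎ (J u × s ~ u))
            P? u = Priv? u s ⊎-dec JN? s u
            le : # (s ~?_) ≤ # P?
            le = ≤-trans (≤-reflexive (deg s)) (≤-trans k≤ (#-⊎ P? (λ w → Priv? w s) (JN? s) (λ u → inj₁) (λ u → inj₂)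
                   (λ u p q → Priv⇒¬J p (proj₁ q))))

          two-privs : ∀ {u} → Priv u s → u ≡ v₁ ⊎ u ≡ v₂
          two-privs {u} = #⊆⇒⊇ P? (λ w → Priv? w s) (λ w → [ (λ { refl → p₁ }) , (λ { refl → p₂ }) ]) le u
            where
            P? : Decidable (λ u → u ≡ v₁ ⊎ u ≡ v₂)
            P? u = (u ≟ v₁) ⊎-dec (u ≟ v₂)
            le : m s ≤ # P?
            le = ≤-trans (≤-reflexive m≡2) (2≤# P? (inj₁ refl) (inj₂ refl) v₁≢v₂)

          D : Fin n → Set
          D y = (t₁ ~ y ⊎ (t₂ ~ y × y ≢ x₂)) ⊎ y ≡ s

          NZ? : Decidable (λ y → t₁ ~ y ⊎ (t₂ ~ y × y ≢ x₂))
          NZ? y = (t₁ ~? y) ⊎-dec N∖? t₂ x₂ y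

          D? : Decidable D
          D? y = NZ? y ⊎-dec (y ≟ s)

          D⊆S : ∀ {y} → D y → y ∈ S
          D⊆S (inj₁ (inj₁ e)) = proj₂ B₁.tJ _ e
          D⊆S (inj₁ (inj₂ (e , _))) = proj₂ B₂.tJ _ e
          D⊆S (inj₂ refl) = proj₁ (proj₂ p₁)

          #D : k + suc r + 1 ≤ # D?
          #D = ≤-trans (+-monoˡ-≤ 1 (≤-trans (+-mono-≤ (≤-reflexive (sym (deg t₁))) (#N∖≥ t₂ x₂))
                 (#-⊎ NZ? (t₁ ~?_) (N∖? t₂ x₂) (λ y → inj₁) (λ y → inj₂)
                   (λ y e p → t₁≢t₂ (B₂.Z~J (proj₁ p) (proj₂ p) (~-sym e) B₁.tJ)))))
                 (#-⊎⁅⁆ D? NZ? s (λ y → inj₁) (inj₂ refl) [ t₁≁s , (λ p → t₂≁s (proj₁ p)) ])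

          module _ {W : Fin n → Set} (W-v₁ : W v₁) (W-t₁ : W t₁) (W-v₂ : (∃[ w ] W w × v₂ ~ w) ⊎ W v₂)
                   (W-B₂ : ∀ {u} → InB t₂ x₂ u → ¬ W u → (∀ {w} → W w → ¬ u ~ w) → ⊥)
                   (W-t₂ : Undom D W t₂ → ⊥) where

            -- The neighbours of s are v₁, v₂ and members of J. The first two are inserted or
            -- dominated, the others have more than two neighbours in S; so an undominated u does
            -- not see s.
            only-x : ∀ {u} → Undom D W u → ∀ {y} → y ∈ S → u ~ y → y ≡ x₁
            only-x {u} und@(u∉ , cl , ¬w , ¬e) {y} y∈ e = [ id , (λ { refl → ⊥-elim (s≁ (~-sym e)) }) ] (x₁-or-s y∈ e)
              where
              u≁Z₁ : ∀ {z} → t₁ ~ z → z ≢ x₁ → ¬ u ~ z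
              u≁Z₁ t~z ne e′ = [ (λ iu → ¬e W-v₁ (~-sym (v₁~B u iu))) , (λ { refl → ¬w W-t₁ }) ] (B₁.Z~ t~z ne (~-sym e′))
              u≁Z₂ : ∀ {z} → t₂ ~ z → z ≢ x₂ → ¬ u ~ z
              u≁Z₂ {z} t~z ne e′ = [ (λ iu → W-B₂ iu ¬w ¬e) , (λ { refl → W-t₂ und }) ] (B₂.Z~ t~z ne (~-sym e′))
              x₁-or-s : ∀ {y} → y ∈ S → u ~ y → y ≡ x₁ ⊎ y ≡ s
              x₁-or-s {y} y∈ e with cl y∈ e
              ... | inj₂ eq = inj₂ eq
              ... | inj₁ (inj₂ (t~y , ne)) = ⊥-elim (u≁Z₂ t~y ne e)
              ... | inj₁ (inj₁ t~y) with y ≟ x₁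
              ...   | yes eq = inj₁ eq
              ...   | no ne = ⊥-elim (u≁Z₁ t~y ne e)
              s≁ : ¬ s ~ u
              s≁ s~u with N[s] s~u
              ... | inj₂ ju = small⇒¬J x₁-or-s ju
              ... | inj₁ pu = [ (λ eq → ¬w (subst W (sym eq) W-v₁)) , (λ eq → v₂-case eq W-v₂) ] (two-privs pu)
                where
                v₂-case : u ≡ v₂ → (∃[ w ] W w × v₂ ~ w) ⊎ W v₂ → ⊥
                v₂-case eq (inj₁ (w , ww , v~w)) = ¬e ww (subst (_~ w) (sym eq) v~w)
                v₂-case eq (inj₂ wv) = ¬w (subst W (sym eq) wv)

          -- 2k vertices leave S, at most k + 1 enter and at most m x₁ ≤ 1 are left undominated,
          -- which contradicts k ≥ 3.
          finish : ∀ {W} (W? : Decidable W) → Swap D W → (∀ u → Undom D W u → Priv u x₁) →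
                   # W? ≤ suc r + 2 → ⊥
          finish W? sw V-all le = <⇒≱ (s≤s (s≤s (s≤s 1≤r))) (+-cancelʳ-≤ (suc r) _ _ (begin
            suc k + suc r             ≡⟨ +-comm 1 (k + suc r) ⟩
            k + suc r + 1             ≤⟨ #D ⟩
            # D?                      ≤⟨ swap-≤ D? W? S-ID size-min sw (λ w → Priv? w x₁) V-all ⟩
            # W? + m x₁               ≤⟨ +-mono-≤ le (m≤1 good₁) ⟩
            suc r + 2 + 1             ≡⟨ +-assoc (suc r) 2 1 ⟩
            suc r + 3                 ≡⟨ +-comm (suc r) 3 ⟩
            3 + suc r                 ∎))
            where open ≤-Reasoning

          -- The second block keeps its k - 1 vertices; if x₁ ≡ x₂ this would leave t₂ undominated.
          different : x₁ ≢ x₂ → ⊥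
          different x₁≢x₂ = finish W? sw V-all le
            where
            W : Fin n → Set
            W u = (InB t₂ x₂ u ⊎ u ≡ v₁) ⊎ u ≡ t₁
            Bv? : Decidable (λ u → InB t₂ x₂ u ⊎ u ≡ v₁)
            Bv? u = InB? t₂ x₂ u ⊎-dec (u ≟ v₁)
            W? : Decidable W
            W? u = Bv? u ⊎-dec (u ≟ t₁)
            W∉S : ∀ {u} → W u → u ∉ S
            W∉S (inj₁ (inj₁ iu)) = proj₁ iu
            W∉S (inj₁ (inj₂ refl)) = proj₁ p₁
            W∉S (inj₂ refl) = proj₁ B₁.tJ
            sw : Swap D W
            sw = record { D⊆S = D⊆S ; W∉S = W∉S ; W-indep = W-indep ; N[W]⊆D = N[W]⊆D ; D-dom = D-dom }
              where
              W-indep : ∀ {u w} → W u → W w → ¬ u ~ w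
              W-indep (inj₂ refl) w e = J≁J B₁.tJ (W∉S w) e
              W-indep w (inj₂ refl) e = J≁J B₁.tJ (W∉S w) (~-sym e)
              W-indep (inj₁ (inj₁ iu)) (inj₁ (inj₁ iw)) = B-indep₁ (proj₁ good₂) iu iw
              W-indep (inj₁ (inj₁ iu)) (inj₁ (inj₂ refl)) e = v₁≁B₂ iu (~-sym e)
              W-indep (inj₁ (inj₂ refl)) (inj₁ (inj₁ iw)) e = v₁≁B₂ iw e
              W-indep (inj₁ (inj₂ refl)) (inj₁ (inj₂ refl)) e = ~⇒≢ e refl
              N[W]⊆D : ∀ {w y} → W w → y ∈ S → w ~ y → D y
              N[W]⊆D (inj₁ (inj₁ iw)) y∈ e = inj₁ (inj₂ (B₂.B~S iw y∈ e))
              N[W]⊆D (inj₁ (inj₂ refl)) y∈ e = inj₂ (proj₂ (proj₂ (proj₂ p₁)) _ y∈ e)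
              N[W]⊆D (inj₂ refl) y∈ e = inj₁ (inj₁ e)
              D-dom : ∀ {d} → D d → ∃[ w ] W w × d ~ w
              D-dom (inj₁ (inj₁ e)) = t₁ , inj₂ refl , ~-sym e
              D-dom (inj₁ (inj₂ (e , ne))) with B₂.b₀
              ... | b , ib = b , inj₁ (inj₁ ib) , ~-sym (B₂.B~Z ib e ne)
              D-dom (inj₂ refl) = v₁ , inj₁ (inj₂ refl) , s~v₁
            t₂-dominated : Undom D W t₂ → ⊥
            t₂-dominated (_ , cl , _ , _) with cl (proj₂ B₂.tJ x₂ B₂.t~x) B₂.t~x
            ... | inj₂ eq = t₂≁s (subst (t₂ ~_) eq B₂.t~x)
            ... | inj₁ (inj₂ (_ , ne)) = ne refl
            ... | inj₁ (inj₁ e) = t₁≢t₂ (sym (B₁.Z~J e (λ eq → x₁≢x₂ (sym eq)) (~-sym B₂.t~x) B₂.tJ))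
            V-all : ∀ u → Undom D W u → Priv u x₁
            V-all u und = only⇒Priv (proj₁ und)
              (only-x {W} (inj₁ (inj₂ refl)) (inj₂ refl) (inj₁ (proj₁ B₂.b₀ , inj₁ (inj₁ (proj₂ B₂.b₀)) , v₂~B _ (proj₂ B₂.b₀)))
                (λ iu ¬w _ → ¬w (inj₁ (inj₁ iu))) t₂-dominated und)
            le : # W? ≤ suc r + 2
            le = begin
              # W?                       ≤⟨ #-∪⁅⁆ W? Bv? t₁ (λ u → id) ⟩
              # Bv? + 1                  ≤⟨ +-monoˡ-≤ 1 (#-∪⁅⁆ Bv? (InB? t₂ x₂) v₁ (λ u → id)) ⟩
              # (InB? t₂ x₂) + 1 + 1     ≡⟨ +-assoc (# (InB? t₂ x₂)) 1 1 ⟩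
              # (InB? t₂ x₂) + 2         ≤⟨ +-monoˡ-≤ 2 B₂.#B≤ ⟩
              suc r + 2                  ∎
              where open ≤-Reasoning

          -- Inserting t₂ instead of its block is allowed here: its remaining neighbour x₂ is
          -- removed anyway, being a neighbour of t₁.
          same : x₁ ≡ x₂ → ⊥
          same x₁≡x₂ = finish W? sw V-all le
            where
            W : Fin n → Set
            W u = ((u ≡ v₁ ⊎ u ≡ v₂) ⊎ u ≡ t₁) ⊎ u ≡ t₂
            V₂? : Decidable (λ u → u ≡ v₁ ⊎ u ≡ v₂)
            V₂? u = (u ≟ v₁) ⊎-dec (u ≟ v₂)
            V₃? : Decidable (λ u → (u ≡ v₁ ⊎ u ≡ v₂) ⊎ u ≡ t₁)
            V₃? u = V₂? u ⊎-dec (u ≟ t₁)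
            W? : Decidable W
            W? u = V₃? u ⊎-dec (u ≟ t₂)
            W∉S : ∀ {u} → W u → u ∉ S
            W∉S (inj₁ (inj₁ (inj₁ refl))) = proj₁ p₁
            W∉S (inj₁ (inj₁ (inj₂ refl))) = proj₁ p₂
            W∉S (inj₁ (inj₂ refl)) = proj₁ B₁.tJ
            W∉S (inj₂ refl) = proj₁ B₂.tJ
            sw : Swap D W
            sw = record { D⊆S = D⊆S ; W∉S = W∉S ; W-indep = W-indep ; N[W]⊆D = N[W]⊆D ; D-dom = D-dom }
              where
              W-indep : ∀ {u w} → W u → W w → ¬ u ~ w
              W-indep (inj₂ refl) w e = J≁J B₂.tJ (W∉S w) e
              W-indep w (inj₂ refl) e = J≁J B₂.tJ (W∉S w) (~-sym e)
              W-indep (inj₁ (inj₂ refl)) w e = J≁J B₁.tJ (W∉S w) e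
              W-indep w (inj₁ (inj₂ refl)) e = J≁J B₁.tJ (W∉S w) (~-sym e)
              W-indep (inj₁ (inj₁ (inj₁ refl))) (inj₁ (inj₁ (inj₁ refl))) e = ~⇒≢ e refl
              W-indep (inj₁ (inj₁ (inj₁ refl))) (inj₁ (inj₁ (inj₂ refl))) e = v₁≁v₂ e
              W-indep (inj₁ (inj₁ (inj₂ refl))) (inj₁ (inj₁ (inj₁ refl))) e = v₁≁v₂ (~-sym e)
              W-indep (inj₁ (inj₁ (inj₂ refl))) (inj₁ (inj₁ (inj₂ refl))) e = ~⇒≢ e refl
              N[W]⊆D : ∀ {w y} → W w → y ∈ S → w ~ y → D y
              N[W]⊆D (inj₁ (inj₁ (inj₁ refl))) y∈ e = inj₂ (proj₂ (proj₂ (proj₂ p₁)) _ y∈ e)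
              N[W]⊆D (inj₁ (inj₁ (inj₂ refl))) y∈ e = inj₂ (proj₂ (proj₂ (proj₂ p₂)) _ y∈ e)
              N[W]⊆D (inj₁ (inj₂ refl)) y∈ e = inj₁ (inj₁ e)
              N[W]⊆D {y = y} (inj₂ refl) y∈ e with y ≟ x₂
              ... | yes eq = inj₁ (inj₁ (subst (t₁ ~_) (trans x₁≡x₂ (sym eq)) B₁.t~x))
              ... | no ne = inj₁ (inj₂ (e , ne))
              D-dom : ∀ {d} → D d → ∃[ w ] W w × d ~ w
              D-dom (inj₁ (inj₁ e)) = t₁ , inj₁ (inj₂ refl) , ~-sym e
              D-dom (inj₁ (inj₂ (e , ne))) = t₂ , inj₂ refl , ~-sym e
              D-dom (inj₂ refl) = v₁ , inj₁ (inj₁ (inj₁ refl)) , s~v₁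
            V-all : ∀ u → Undom D W u → Priv u x₁
            V-all u und = only⇒Priv (proj₁ und)
              (only-x {W} (inj₁ (inj₁ (inj₁ refl))) (inj₁ (inj₂ refl)) (inj₂ (inj₁ (inj₁ (inj₂ refl))))
                (λ iu _ ¬e → ¬e (inj₁ (inj₁ (inj₂ refl))) (~-sym (v₂~B _ iu))) (λ und′ → proj₁ (proj₂ (proj₂ und′)) (inj₂ refl)) und)
            le : # W? ≤ suc r + 2
            le = begin
              # W?                    ≤⟨ #-∪⁅⁆ W? V₃? t₂ (λ u → id) ⟩
              # V₃? + 1               ≤⟨ +-monoˡ-≤ 1 (#-∪⁅⁆ V₃? V₂? t₁ (λ u → id)) ⟩
              # V₂? + 1 + 1           ≤⟨ +-monoˡ-≤ 1 (+-monoˡ-≤ 1 (#-∪⁅⁆ V₂? (_≟ v₁) v₂ (λ u → id))) ⟩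
              # (_≟ v₁) + 1 + 1 + 1   ≡⟨ cong (λ a → a + 1 + 1 + 1) (#-singleton v₁) ⟩
              2 + 2                   ≤⟨ +-monoˡ-≤ 2 (s≤s 1≤r) ⟩
              suc r + 2               ∎
              where open ≤-Reasoning

        full-pair : ⊥
        full-pair with x₁ ≟ x₂
        ... | yes eq = same eq
        ... | no ne = different ne

  -- Charging J to the surplus of the other vertices

  module Charging (S : Subset n) (opt : Optimal S) where
    open OptimalFacts S opt
    open At S
    open Facts S S-ID
    open Minimal size-min
    open Groups S opt

    module Bound (s : Fin n) where
      open Group s

      private
        a : ℕ
        a = # Ma?

        a≤m : a ≤ m s
        a≤m = #-mono Ma? (λ w → Priv? w s) (λ w → proj₁)

        P? : ∀ v → Decidable (λ t → Ma v × Att v t)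
        P? v t = Ma? v ×-dec Att? v t

        Hit≤Σ : # Hit? ≤ sum (λ v → # (P? v))
        Hit≤Σ = #≤-Σ P? Hit? λ { t (v , p , att) → v , (p , t , att) , att }

      -- If every private vertex is attached, one that is not full would give 1 + m s ≤ m s in
      -- `NotFull.few`.
      all-full : m s ≤ a → ∀ {v} → Priv v s → Full v
      all-full m≤a {v} p = decidable-stable (Full? v) λ ¬full →
        <⇒≱ (≤-trans (s≤s m≤a) (+-monoˡ-≤ a (1≤# (Att? v) (proj₂ (proj₂ ma))))) (NotFull.few p ¬full)
        where
        ma : Ma v
        ma = #⊆⇒⊇ Ma? (λ w → Priv? w s) (λ w → proj₁) m≤a v p

      bad⇒no-hit : Bad s → ∀ t → ¬ Hit t
      bad⇒no-hit (m≡1 , le) t (v , p , att) = full-small p (all-full m≤a p) m≡1 (≤-trans (n≤1+n r) le)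
        where
        m≤a : m s ≤ a
        m≤a = ≤-trans (≤-reflexive m≡1) (1≤# Ma? (p , t , att))

      private
        -- Here a and c count the attached and the unattached private vertices, and an attached one
        -- sees at most c blocks. The only case with c > r is a = 1, j = 0.
        arith : ∀ a c j → 1 ≤ a → 1 ≤ c → (a + c) + j ≤ 2 + r → j + c * a ≤ (a + c) * r
        arith a c j 1≤a 1≤c le with c ≤? r
        ... | yes c≤r = begin
          j + c * a        ≤⟨ +-mono-≤ (≤-trans j≤r (m≤n*m r c {{>-nonZero 1≤c}})) (*-monoˡ-≤ a c≤r) ⟩
          c * r + r * a    ≡⟨ cong (c * r +_) (*-comm r a) ⟩
          c * r + a * r    ≡⟨ +-comm (c * r) (a * r) ⟩
          a * r + c * r    ≡⟨ sym (*-distribʳ-+ r a c) ⟩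
          (a + c) * r      ∎
          where
          open ≤-Reasoning
          j≤r : j ≤ r
          j≤r = +-cancelˡ-≤ 2 _ _ (≤-trans (+-monoˡ-≤ j (+-mono-≤ 1≤a 1≤c)) le)
        arith (suc a) c j _ _ le | no c≰r = begin
          j + c * suc a       ≡⟨ cong₂ (λ j a → j + c * suc a) j≡0 a≡0 ⟩
          c * 1               ≡⟨ *-identityʳ c ⟩
          c                   ≤⟨ subst (c ≤_) (*-comm r c) (m≤n*m c r {{>-nonZero 1≤r}}) ⟩
          c * r               ≤⟨ m≤n+m (c * r) (r + a * r) ⟩
          r + a * r + c * r   ≡⟨ sym (*-distribʳ-+ r (suc a) c) ⟩
          (suc a + c) * r     ∎
          where
          open ≤-Reasoning
          a+j≤0 : a + j ≤ 0
          a+j≤0 = +-cancelʳ-≤ (suc (suc r)) _ _ (begin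
            a + j + suc (suc r)   ≤⟨ +-monoʳ-≤ (a + j) (s≤s (≰⇒> c≰r)) ⟩
            a + j + suc c         ≡⟨ +-assoc a j (suc c) ⟩
            a + (j + suc c)       ≡⟨ cong (a +_) (trans (+-suc j c) (cong suc (+-comm j c))) ⟩
            a + suc (c + j)       ≡⟨ trans (+-suc a (c + j)) (cong suc (sym (+-assoc a c j))) ⟩
            suc (a + c + j)       ≤⟨ le ⟩
            2 + r                 ∎)
          a≡0 : a ≡ 0
          a≡0 = n≤0⇒n≡0 (≤-trans (m≤m+n a j) a+j≤0)
          j≡0 : j ≡ 0
          j≡0 = n≤0⇒n≡0 (≤-trans (m≤n+m j a) a+j≤0)

      module _ (1≤m : 1 ≤ m s) (¬bad : ¬ Bad s) where

        private
          j≤m*r : ∀ q → q ≡ m s → j s ≤ q * r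
          j≤m*r zero eq = ⊥-elim (<⇒≱ 1≤m (≤-reflexive (sym eq)))
          j≤m*r (suc zero) eq = ≤-trans (≤-pred (≰⇒> λ le → ¬bad (sym eq , le))) (≤-reflexive (sym (+-identityʳ r)))
          j≤m*r (suc (suc q)) eq = ≤-trans (+-cancelˡ-≤ 2 _ _ (≤-trans (+-monoˡ-≤ (j s) (≤-trans (m≤m+n 2 q) (≤-reflexive eq))) (m+j≤k s)))
                                           (m≤m+n r (suc q * r))

          -- Every private vertex is full and sees one block. The cases m s = 1 and m s = 2 rest on
          -- `full-small` and `full-pair`; from three on, m s + j s ≤ k ≤ 3r suffices.
          j+m≤m*r : (m s ≤ a) → ∀ q → q ≡ m s → j s + q ≤ q * r
          j+m≤m*r m≤a zero eq = ⊥-elim (<⇒≱ 1≤m (≤-reflexive (sym eq)))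
          j+m≤m*r m≤a (suc zero) eq with 1≤#⇒∃ (λ w → Priv? w s) 1≤m
          ... | v , p = ≤-trans (≤-reflexive (+-comm (j s) 1))
                          (≤-trans (≰⇒> (full-small p (all-full m≤a p) (sym eq))) (≤-reflexive (sym (+-identityʳ r))))
          j+m≤m*r m≤a (suc (suc zero)) eq with 1≤#⇒∃ (λ w → Priv? w s) 1≤m
          ... | v₁ , p₁ with #-other (λ w → Priv? w s) (≤-reflexive eq) v₁
          ...   | v₂ , p₂ , v₂≢v₁ = begin
            j s + 2       ≡⟨ +-comm (j s) 2 ⟩
            2 + j s       ≤⟨ ≤-pred (≰⇒> λ le → full-pair (λ e → v₂≢v₁ (sym e)) p₁ p₂ (all-full m≤a p₁) (all-full m≤a p₂)
                               (sym eq) (≤-trans le (≤-reflexive (cong (_+ j s) eq)))) ⟩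
            suc r         ≡⟨ +-comm 1 r ⟩
            r + 1         ≤⟨ +-monoʳ-≤ r 1≤r ⟩
            r + r         ≡⟨ cong (r +_) (sym (+-identityʳ r)) ⟩
            2 * r         ∎
            where open ≤-Reasoning
          j+m≤m*r m≤a (suc (suc (suc q))) eq = begin
            j s + suc (suc (suc q))     ≡⟨ +-comm (j s) _ ⟩
            suc (suc (suc q)) + j s     ≡⟨ cong (_+ j s) eq ⟩
            m s + j s                   ≤⟨ m+j≤k s ⟩
            1 + (1 + r)                 ≤⟨ +-mono-≤ 1≤r (+-monoˡ-≤ r 1≤r) ⟩
            r + (r + r)                 ≤⟨ +-monoʳ-≤ r (+-monoʳ-≤ r (m≤m+n r (q * r))) ⟩
            suc (suc (suc q)) * r       ∎
            where open ≤-Reasoning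

          P≤ : ∀ c → 1 ≤ c → a + c ≡ m s → ∀ v → # (P? v) ≤ c * 𝟙 (Ma? v)
          P≤ c 1≤c eq v with Ma? v
          ... | no ¬ma = ≤-trans (#≡0 (λ t → no ¬ma ×-dec Att? v t) (λ t p → ¬ma (proj₁ p))) z≤n
          ... | yes ma = ≤-trans (≤-trans (#-mono (λ t → yes ma ×-dec Att? v t) (Att? v) (λ t → proj₂)) Att≤c)
                                 (≤-reflexive (sym (*-identityʳ c)))
            where
            Att≤c : # (Att? v) ≤ c
            Att≤c with Full? v
            ... | yes full = ≤-trans (full⇒one (proj₁ ma) full) 1≤c
            ... | no ¬full = +-cancelʳ-≤ a _ _ (≤-trans (NotFull.few (proj₁ ma) ¬full) (≤-reflexive (trans (sym eq) (+-comm a c))))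

          Hit≤c*a : ∀ c → 1 ≤ c → a + c ≡ m s → # Hit? ≤ c * a
          Hit≤c*a c 1≤c eq = ≤-trans Hit≤Σ (≤-trans (sum-mono (P≤ c 1≤c eq))
                               (≤-reflexive (sym (*-distribˡ-sum c (λ v → 𝟙 (Ma? v))))))

          Hit≤a : m s ≤ a → # Hit? ≤ a
          Hit≤a m≤a = ≤-trans Hit≤Σ (sum-mono λ v → pointwise v)
            where
            pointwise : ∀ v → # (P? v) ≤ 𝟙 (Ma? v)
            pointwise v with Ma? v
            ... | no ¬ma = #≡0 (λ t → no ¬ma ×-dec Att? v t) (λ t p → ¬ma (proj₁ p))
            ... | yes ma = ≤-trans (#-mono (λ t → yes ma ×-dec Att? v t) (Att? v) (λ t → proj₂))
                                   (full⇒one (proj₁ ma) (all-full m≤a (proj₁ ma)))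

        -- The right side is the joint surplus of the private vertices of s, k - 2 each; it covers
        -- both the members of J at s and the blocks charging s.
        j+Hit≤ : j s + # Hit? ≤ m s * r
        j+Hit≤ with m s ≤? a | 1 ≤? a
        ... | yes m≤a | _ = ≤-trans (+-monoʳ-≤ (j s) (≤-trans (Hit≤a m≤a) a≤m)) (j+m≤m*r m≤a (m s) refl)
        ... | no m≰a | no a<1 = ≤-trans (+-monoʳ-≤ (j s) (#≡0 Hit? λ { t (v , p , att) → a<1 (1≤# Ma? (p , t , att)) }))
                                  (≤-trans (≤-reflexive (+-identityʳ (j s))) (j≤m*r (m s) refl))
        ... | no m≰a | yes 1≤a = begin
          j s + # Hit?            ≤⟨ +-monoʳ-≤ (j s) (Hit≤c*a (m s ∸ a) 1≤c a+c) ⟩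
          j s + (m s ∸ a) * a     ≤⟨ arith a (m s ∸ a) (j s) 1≤a 1≤c (≤-trans (≤-reflexive (cong (_+ j s) a+c)) (m+j≤k s)) ⟩
          (a + (m s ∸ a)) * r     ≡⟨ cong (_* r) a+c ⟩
          m s * r                 ∎
          where
          open ≤-Reasoning
          a+c : a + (m s ∸ a) ≡ m s
          a+c = m+[n∸m]≡n a≤m
          1≤c : 1 ≤ m s ∸ a
          1≤c = m<n⇒0<n∸m (≰⇒> m≰a)

    Cls? : ∀ w → Decidable (λ u → u ∉ S × u ⊑ w × w ⊑ u)
    Cls? w u = ¬? (u ∈? S) ×-dec (u ⊑? w) ×-dec (w ⊑? u)

    ⊑⇒dS≤ : ∀ {u w} → u ⊑ w → dS u ≤ dS w
    ⊑⇒dS≤ {u} {w} u⊑w = #-mono (dS? u) (dS? w) (λ y p → proj₁ p , u⊑w y (proj₁ p) (proj₂ p))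

    ⊑-sym : ∀ {u w} → u ⊑ w → dS w ≤ dS u → w ⊑ u
    ⊑-sym {u} {w} u⊑w le y y∈ e =
      proj₂ (#⊆⇒⊇ (dS? u) (dS? w) (λ y p → proj₁ p , u⊑w y (proj₁ p) (proj₂ p)) le y (y∈ , e))

    1≤dS : ∀ {w} → w ∉ S → 1 ≤ dS w
    1≤dS {w} w∉ with dominator w∉
    ... | y , y∈ , e = 1≤# (dS? w) (y∈ , e)

    -- All charges are doubled: t pays 1 for each w with Ch₁ t w, 1 for each s with Ch₂ t s, 1 for each s with Ch₃ t s
    -- and 2 for each s with Ch₄ t s.  A vertex s passes its charge on to the w with Priv w s.
    Ch₁ : Fin n → Fin n → Set
    Ch₁ t w = J t × w ∉ S × 2 ≤ dS w × dS w ≤ r × dS w ≤ # (Cls? w) × w ⊑ t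

    Ch₂ Ch₃ Ch₄ : Fin n → Fin n → Set
    Ch₂ t s = (J t × s ~ t) × 1 ≤ m s
    Ch₃ t s = Ch₂ t s × ¬ Bad s
    Ch₄ t s = Group.Hit s t

    abstract
      Ch₁? : ∀ t → Decidable (Ch₁ t)
      Ch₁? t w = J? t ×-dec ¬? (w ∈? S) ×-dec (2 ≤? dS w) ×-dec (dS w ≤? r) ×-dec (dS w ≤? # (Cls? w)) ×-dec (w ⊑? t)

      Ch₂? : ∀ t → Decidable (Ch₂ t)
      Ch₂? t s = JN? s t ×-dec (1 ≤? m s)

      Ch₃? : ∀ t → Decidable (Ch₃ t)
      Ch₃? t s = Ch₂? t s ×-dec ¬? (Bad? s)

    Ch₄? : ∀ t → Decidable (Ch₄ t)
    Ch₄? t s = Group.Hit? s t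

    module PerJ (few-twins : ∀ t → # (t ⊆ᴺ?_) ≤ suc r) {t : Fin n} (jt : J t) where

      charge : ℕ
      charge = # (Ch₁? t) + (# (Ch₂? t) + # (Ch₃? t) + 2 * # (Ch₄? t))

      by₁ : 2 ≤ # (Ch₁? t) → 2 ≤ charge
      by₁ le = ≤-trans le (m≤m+n _ _)

      by₂₃ : 2 ≤ # (Ch₂? t) + # (Ch₃? t) → 2 ≤ charge
      by₂₃ le = ≤-trans le (≤-trans (m≤m+n _ _) (m≤n+m _ (# (Ch₁? t))))

      by₄ : 1 ≤ # (Ch₄? t) → 2 ≤ charge
      by₄ le = ≤-trans (*-monoʳ-≤ 2 le) (≤-trans (m≤n+m _ (# (Ch₂? t) + # (Ch₃? t))) (m≤n+m _ (# (Ch₁? t))))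

      Q : Fin n → Set
      Q w = w ∉ S × w ⊑ t × 2 ≤ dS w × dS w ≤ suc r

      Q? : Decidable Q
      Q? w = ¬? (w ∈? S) ×-dec (w ⊑? t) ×-dec (2 ≤? dS w) ×-dec (dS w ≤? suc r)

      module _ (all-bad : ∀ {s} → t ~ s → 1 ≤ m s → Bad s) where

        module _ {w} (qw : Q w) (w-min : ∀ u → Q u → dS w ≤ dS u) where

          w∉ : w ∉ S
          w∉ = proj₁ qw

          w⊑t : w ⊑ t
          w⊑t = proj₁ (proj₂ qw)

          -- Either u is in Q and dS w is minimal there, or u is private to a bad vertex, whose
          -- neighbours are u and members of J; w is neither.
          below : ∀ {u} → u ∉ S → u ⊑ w → w ⊑ u
          below {u} u∉ u⊑w = ⊑-sym u⊑w (w-min u (u∉ , (λ y y∈ e → w⊑t y y∈ (u⊑w y y∈ e)) , 2≤ , ≤-trans (⊑⇒dS≤ u⊑w) (proj₂ (proj₂ (proj₂ qw)))))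
            where
            2≤ : 2 ≤ dS u
            2≤ with 2 ≤? dS u
            ... | yes le = le
            ... | no ¬le with dS⇒Priv u∉ (≤-antisym (≤-pred (≰⇒> ¬le)) (1≤dS u∉))
            ...   | s′ , pu with Flip.N[s] S S-ID (all-bad (w⊑t s′ (proj₁ (proj₂ pu)) w~s′) (1≤# (λ v → Priv? v s′) pu)) pu (~-sym w~s′)
              where
              w~s′ : w ~ s′
              w~s′ = u⊑w s′ (proj₁ (proj₂ pu)) (proj₁ (proj₂ (proj₂ pu)))
            ...     | inj₁ refl = proj₁ (proj₂ (proj₂ qw))
            ...     | inj₂ jw = ⊥-elim (<⇒≱ (s≤s (proj₂ (proj₂ (proj₂ qw)))) (≤-reflexive (sym (J⇒dS jw))))

          dS≤Cls : dS w ≤ # (Cls? w)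
          dS≤Cls = ≤-trans (dS≤#A w∉) (#-mono (A? w) (Cls? w) λ u p → proj₁ p , proj₁ (proj₂ p) , below (proj₁ p) (proj₁ (proj₂ p)))

          -- The whole class of w is charged, and it has at least dS w ≥ 2 members.
          small : dS w ≤ r → 2 ≤ charge
          small dS≤r = by₁ (≤-trans (≤-trans (proj₁ (proj₂ (proj₂ qw))) dS≤Cls) (#-mono (Cls? w) (Ch₁? t) cls))
            where
            cls : ∀ u → u ∉ S × u ⊑ w × w ⊑ u → Ch₁ t u
            cls u (u∉ , u⊑w , w⊑u) = jt , u∉ , ≤-trans (proj₁ (proj₂ (proj₂ qw))) (⊑⇒dS≤ w⊑u)
              , ≤-trans (⊑⇒dS≤ u⊑w) dS≤r
              , ≤-trans (⊑⇒dS≤ u⊑w) (≤-trans dS≤Cls (#-mono (Cls? w) (Cls? u)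
                  λ { v (v∉ , v⊑w , w⊑v) → v∉ , (λ y y∈ e → w⊑u y y∈ (v⊑w y y∈ e)) , (λ y y∈ e → w⊑v y y∈ (u⊑w y y∈ e)) }))
              , λ y y∈ e → w⊑t y y∈ (u⊑w y y∈ e)

          module _ (r<dS : suc r ≤ dS w) {x} (t~x : t ~ x) (¬w~x : ¬ (x ∈ S × w ~ x)) where

            w≢x : ∀ {y} → y ∈ S → w ~ y → y ≢ x
            w≢x y∈ e refl = ¬w~x (y∈ , e)

            N⊆w : ∀ y → t ~ y → y ≢ x → w ~ y
            N⊆w y e ne = proj₂ (#⊆⇒⊇ (dS? w) (N∖? t x) (λ y p → w⊑t y (proj₁ p) (proj₂ p) , w≢x (proj₁ p) (proj₂ p))
                                 (≤-trans (#N∖≤ t~x) r<dS) y (e , ne))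

            inB : ∀ u → u ∉ S × u ⊑ w × w ⊑ u → InB t x u
            inB u (u∉ , u⊑w , w⊑u) = u∉ , (λ y y∈ e → w⊑t y y∈ (u⊑w y y∈ e) , w≢x y∈ (u⊑w y y∈ e))
                                        , (λ y e ne → w⊑u y (proj₂ jt y e) (N⊆w y e ne))

            good : Good t x
            good = (jt , t~x , ≤-trans r<dS (≤-trans dS≤Cls (#-mono (Cls? w) (InB? t x) inB))) , all-bad t~x

          -- The class of w now has k - 1 members, all missing the same neighbour x of t, and so
          -- forms a block.
          large : suc r ≤ dS w → 2 ≤ charge
          large r<dS with #-diff (t ~?_) (dS? w) (≤-trans (s≤s (proj₂ (proj₂ (proj₂ qw)))) (≤-reflexive (sym (deg t))))
          ... | x , t~x , ¬w~x = from-star (near-star good′)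
            where
            good′ : Good t x
            good′ = good r<dS t~x ¬w~x
            from-star : ∃[ v ] ∃[ s ] ∃[ b ] Star v × Priv v s × ¬ t ~ s × InB t x b × v ~ b → 2 ≤ charge
            from-star (v , s , b , _ , pv , t≁s , ib , v~b) = by₄ (1≤# (Ch₄? t) {s} (v , pv , x , b , good′ , t≁s , ib , v~b))

        module _ (¬Q : ∀ w → ¬ Q w) (one : # (Ch₂? t) ≤ 1) where

          twin-or-priv : ∀ u → u ∉ S → u ⊑ t → (t ⊆ᴺ u) ⊎ ∃[ s ] Priv u s
          twin-or-priv u u∉ u⊑t with dS u ≤? 1 | dS u ≤? suc r
          ... | yes le | _ = inj₂ (dS⇒Priv u∉ (≤-antisym le (1≤dS u∉)))
          ... | no ¬le | yes le = ⊥-elim (¬Q u (u∉ , u⊑t , ≰⇒> ¬le , le))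
          ... | no _ | no ¬le = inj₁ (⊆ᴺ-sym λ y e → u⊑t y (proj₂ (dS⇒J u∉ (≰⇒> ¬le)) y e) e)

          -- Everything below t is a twin of t or private. With no private vertex in reach t has k
          -- twins, which is excluded. With a single bad neighbour s it has k - 1, which fill the
          -- neighbourhood of s except b: a forbidden `Tw`.
          no-Q : ⊥
          no-Q with any? (Ch₂? t)
          ... | no ¬∃ = <⇒≱ (≤-trans (≤-reflexive (sym (J⇒dS jt))) (≤-trans (dS≤#A (proj₁ jt)) (#-mono (A? t) (t ⊆ᴺ?_) twin))) (few-twins t)
            where
            twin : ∀ u → u ∉ S × u ⊑ t × ¬ t ~ u → t ⊆ᴺ u
            twin u (u∉ , u⊑t , _) = [ id , (λ { (s , pu) → ⊥-elim (¬∃ (s , (jt ,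
              ~-sym (u⊑t s (proj₁ (proj₂ pu)) (proj₁ (proj₂ (proj₂ pu))))) , 1≤# (λ v → Priv? v s) pu)) }) ] (twin-or-priv u u∉ u⊑t)
          ... | yes (s , ch@((_ , s~t) , 1≤m)) with 1≤#⇒∃ (λ v → Priv? v s) 1≤m
          ...   | b , pb = ¬TW s (b , t , pb , jt , s~t ,
                    (λ c e ne → #⊆⇒⊇ (t ⊆ᴺ?_) (N∖? s b) twin-N (≤-trans (#N∖≤ s~b) #twins) c (e , ne)) ,
                    λ y w e ne pw → ne (unique (jt , ~-sym e) pw))
            where
            s~b : s ~ b
            s~b = ~-sym (proj₁ (proj₂ (proj₂ pb)))
            unique : ∀ {y w} → J t × y ~ t → Priv w y → y ≡ s
            unique p pw = #≤1⇒≡ (Ch₂? t) one (p , 1≤# (λ v → Priv? v _) pw) ch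
            twin-N : ∀ c → t ⊆ᴺ c → s ~ c × c ≢ b
            twin-N c tw = ~-sym (tw s (~-sym s~t)) , λ { refl → Priv⇒¬J pb (proj₁ pb , λ y e → proj₂ jt y (⊆ᴺ-sym tw y e)) }
            bad : Bad s
            bad = all-bad (~-sym s~t) 1≤m
            twin-or-b : ∀ u → u ∉ S × u ⊑ t × ¬ t ~ u → (t ⊆ᴺ u) ⊎ u ≡ b
            twin-or-b u (u∉ , u⊑t , _) with twin-or-priv u u∉ u⊑t
            ... | inj₁ tw = inj₁ tw
            ... | inj₂ (s′ , pu) with unique (jt , ~-sym (u⊑t s′ (proj₁ (proj₂ pu)) (proj₁ (proj₂ (proj₂ pu))))) pu
            ...   | refl = inj₂ (#≤1⇒≡ (λ v → Priv? v s) (≤-reflexive (proj₁ bad)) pu pb)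
            #twins : suc r ≤ # (t ⊆ᴺ?_)
            #twins = +-cancelʳ-≤ 1 _ _ (≤-trans (≤-reflexive (+-comm (suc r) 1)) (≤-trans (≤-reflexive (sym (J⇒dS jt)))
                       (≤-trans (dS≤#A (proj₁ jt)) (#-∪⁅⁆ (A? t) (t ⊆ᴺ?_) b twin-or-b))))

      2≤charge : 2 ≤ charge
      2≤charge with any? (Ch₃? t) | 2 ≤? # (Ch₂? t)
      ... | yes (s , ch) | _ = by₂₃ (+-mono-≤ (1≤# (Ch₂? t) (proj₁ ch)) (1≤# (Ch₃? t) ch))
      ... | no _ | yes 2≤ = by₂₃ (≤-trans 2≤ (m≤m+n _ _))
      ... | no ¬∃ | no ¬2≤ = by-Q (any? Q?)
        where
        all-bad : ∀ {s} → t ~ s → 1 ≤ m s → Bad s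
        all-bad {s} e le = decidable-stable (Bad? s) (λ ¬b → ¬∃ (s , ((jt , ~-sym e) , le) , ¬b))
        by-Q : Dec (∃ Q) → 2 ≤ charge
        by-Q (no ¬Q) = ⊥-elim (no-Q all-bad (λ w q → ¬Q (w , q)) (≤-pred (≰⇒> ¬2≤)))
        by-Q (yes e) with minimal any? Q? dS e
        ... | w , qw , w-min with dS w ≤? r
        ...   | yes le = small all-bad qw w-min le
        ...   | no ¬le = large all-bad qw w-min (≰⇒> ¬le)

    privs : Fin n → ℕ
    privs w = # (λ s → Priv? w s)

    -- Truncation makes the surplus 0 on J, where dS exceeds k - 1 by one; this excess is the
    -- indicator of J in `balance`.
    σ : Fin n → ℕ
    σ w = 𝟙 (¬? (w ∈? S)) * (suc r ∸ dS w)

    -- A private w has dS w = 1 and receives no `Ch₁`. For the others, the payers of w and the class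
    -- of w share a neighbour, so there are at most k - dS w payers. This is one more than the
    -- surplus, which dS w ≤ r makes positive, so the doubling covers it.
    per-w : ∀ w → # (λ t → Ch₁? t w) + (2 * r) * privs w ≤ 2 * σ w
    per-w w with any? (λ s → Priv? w s)
    ... | yes (s , p) = begin
      # (λ t → Ch₁? t w) + (2 * r) * privs w   ≤⟨ +-mono-≤ (#≡0 (λ t → Ch₁? t w) λ { t (_ , _ , 2≤ , _) → <⇒≱ 2≤ (≤-reflexive (Priv⇒dS p)) })
                                                   (*-monoʳ-≤ (2 * r) (#-unique (λ s → Priv? w s) λ s₁ s₂ p₁ p₂ →
                                                     proj₂ (proj₂ (proj₂ p₂)) s₁ (proj₁ (proj₂ p₁)) (proj₁ (proj₂ (proj₂ p₁))))) ⟩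
      (2 * r) * 1                              ≡⟨ *-identityʳ (2 * r) ⟩
      2 * r                                    ≡⟨ cong (2 *_) (sym (trans (cong₂ (λ a d → a * (suc r ∸ d)) (𝟙-yes (¬? (w ∈? S)) (proj₁ p)) (Priv⇒dS p)) (+-identityʳ r))) ⟩
      2 * σ w                                  ∎
      where open ≤-Reasoning
    ... | no ¬∃ = ≤-trans (≤-reflexive (trans (cong (λ q → # (λ t → Ch₁? t w) + (2 * r) * q) (n≤0⇒n≡0 (#≡0 (λ s → Priv? w s) λ s p → ¬∃ (s , p))))
                            (trans (cong (# (λ t → Ch₁? t w) +_) (*-zeroʳ (2 * r))) (+-identityʳ _)))) bound
      where
      bound : # (λ t → Ch₁? t w) ≤ 2 * σ w
      bound with any? (λ t → Ch₁? t w)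
      ... | no ¬t = ≤-trans (#≡0 (λ t → Ch₁? t w) λ t c → ¬t (t , c)) z≤n
      ... | yes (t , _ , w∉ , 2≤ , ≤r , ≤cls , _) with dominator w∉
      ...   | p , p∈ , w~p = begin
        # (λ t → Ch₁? t w)                ≤⟨ m+n≤o⇒m≤o∸n _ (≤-trans (+-monoʳ-≤ _ ≤cls) count) ⟩
        k ∸ dS w                          ≡⟨ +-∸-assoc 1 (≤-trans ≤r (n≤1+n r)) ⟩
        1 + (suc r ∸ dS w)                ≤⟨ +-monoˡ-≤ (suc r ∸ dS w) (m<n⇒0<n∸m (s≤s ≤r)) ⟩
        (suc r ∸ dS w) + (suc r ∸ dS w)   ≡⟨ cong ((suc r ∸ dS w) +_) (sym (+-identityʳ _)) ⟩
        2 * (suc r ∸ dS w)                ≡⟨ cong (2 *_) (sym (trans (cong (_* (suc r ∸ dS w)) (𝟙-yes (¬? (w ∈? S)) w∉)) (+-identityʳ _))) ⟩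
        2 * σ w                           ∎
        where
        open ≤-Reasoning
        count : # (λ t → Ch₁? t w) + # (Cls? w) ≤ k
        count = ≤-trans (#-⊎ (p ~?_) (λ t → Ch₁? t w) (Cls? w)
                          (λ { t (_ , _ , _ , _ , _ , w⊑t) → ~-sym (w⊑t p p∈ w~p) })
                          (λ { u (_ , _ , w⊑u) → ~-sym (w⊑u p p∈ w~p) })
                          (λ { u (ju , _) (_ , u⊑w , _) → <⇒≱ (s≤s (≤-trans (⊑⇒dS≤ u⊑w) (≤-trans ≤r (n≤1+n r)))) (≤-reflexive (sym (J⇒dS ju))) }))
                        (≤-reflexive (deg p))

    -- A bad s receives only `Ch₂`, at most k - 1 ≤ 2r. Otherwise `Ch₂` and `Ch₃` together cost two
    -- per member of J at s, and `j+Hit≤` is used doubled.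
    per-s : ∀ s → # (λ t → Ch₂? t s) + # (λ t → Ch₃? t s) + 2 * # (λ t → Ch₄? t s) ≤ (2 * r) * m s
    per-s s with 1 ≤? m s
    ... | no m<1 = ≤-trans (+-mono-≤ (+-mono-≤ (#≡0 (λ t → Ch₂? t s) λ t c → m<1 (proj₂ c)) (#≡0 (λ t → Ch₃? t s) λ t c → m<1 (proj₂ (proj₁ c))))
                             (*-monoʳ-≤ 2 (#≡0 (λ t → Ch₄? t s) λ { t (v , p , _) → m<1 (1≤# (λ w → Priv? w s) p) }))) z≤n
    ... | yes 1≤m with Bad? s
    ...   | yes bad@(m≡1 , _) = begin
      # (λ t → Ch₂? t s) + # (λ t → Ch₃? t s) + 2 * # (λ t → Ch₄? t s)
                              ≤⟨ +-mono-≤ (+-mono-≤ (#-mono (λ t → Ch₂? t s) (JN? s) λ t → proj₁) (#≡0 (λ t → Ch₃? t s) λ t c → proj₂ c bad))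
                                   (*-monoʳ-≤ 2 (#≡0 (λ t → Ch₄? t s) (Bound.bad⇒no-hit s bad))) ⟩
      j s + 0 + 2 * 0         ≡⟨ trans (+-identityʳ (j s + 0)) (+-identityʳ (j s)) ⟩
      j s                     ≤⟨ ≤-pred (≤-trans (≤-reflexive (cong (_+ j s) (sym m≡1))) (m+j≤k s)) ⟩
      1 + r                   ≤⟨ +-monoˡ-≤ r 1≤r ⟩
      r + r                   ≡⟨ cong (r +_) (sym (+-identityʳ r)) ⟩
      2 * r                   ≡⟨ sym (trans (cong (2 * r *_) m≡1) (*-identityʳ (2 * r))) ⟩
      (2 * r) * m s           ∎
      where open ≤-Reasoning
    ...   | no ¬bad = begin
      # (λ t → Ch₂? t s) + # (λ t → Ch₃? t s) + 2 * # (λ t → Ch₄? t s)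
                              ≤⟨ +-monoˡ-≤ (2 * # (λ t → Ch₄? t s)) (+-mono-≤ (#-mono (λ t → Ch₂? t s) (JN? s) λ t → proj₁)
                                                                  (#-mono (λ t → Ch₃? t s) (JN? s) λ t c → proj₁ (proj₁ c))) ⟩
      j s + j s + 2 * # (λ t → Ch₄? t s)     ≡⟨ cong (λ a → j s + a + 2 * # (λ t → Ch₄? t s)) (sym (+-identityʳ (j s))) ⟩
      2 * j s + 2 * # (λ t → Ch₄? t s)       ≡⟨ sym (*-distribˡ-+ 2 (j s) _) ⟩
      2 * (j s + # (λ t → Ch₄? t s))         ≤⟨ *-monoʳ-≤ 2 (Bound.j+Hit≤ s 1≤m ¬bad) ⟩
      2 * (m s * r)                          ≡⟨ cong (2 *_) (*-comm (m s) r) ⟩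
      2 * (r * m s)                          ≡⟨ sym (*-assoc 2 r (m s)) ⟩
      (2 * r) * m s                          ∎
      where open ≤-Reasoning

    module _ (few-twins : ∀ t → # (t ⊆ᴺ?_) ≤ suc r) where

      charged : ∀ t → 2 * 𝟙 (J? t) ≤ # (Ch₁? t) + (# (Ch₂? t) + # (Ch₃? t) + 2 * # (Ch₄? t))
      charged t with J? t
      ... | yes jt = PerJ.2≤charge few-twins jt
      ... | no _ = z≤n

      J≤Σσ : # J? ≤ sum σ
      J≤Σσ = *-cancelˡ-≤ 2 (begin
        2 * # J?                                     ≡⟨ *-distribˡ-sum 2 (λ t → 𝟙 (J? t)) ⟩
        sum (λ t → 2 * 𝟙 (J? t))                     ≤⟨ sum-mono charged ⟩
        sum (λ t → # (Ch₁? t) + (# (Ch₂? t) + # (Ch₃? t) + 2 * # (Ch₄? t)))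
                                                     ≡⟨ ∑-distrib-+ (λ t → # (Ch₁? t)) (λ t → # (Ch₂? t) + # (Ch₃? t) + 2 * # (Ch₄? t)) ⟩
        ∑₁ + sum (λ t → # (Ch₂? t) + # (Ch₃? t) + 2 * # (Ch₄? t))
                                                     ≡⟨ cong (∑₁ +_) split ⟩
        ∑₁ + (∑₂ + ∑₃ + 2 * ∑₄)                      ≡⟨ cong₂ _+_ (∑-comm (λ t w → 𝟙 (Ch₁? t w)))
                                                         (cong₂ (λ a b → a + 2 * b) (cong₂ _+_ (∑-comm (λ t s → 𝟙 (Ch₂? t s))) (∑-comm (λ t s → 𝟙 (Ch₃? t s))))
                                                                                    (∑-comm (λ t s → 𝟙 (Ch₄? t s)))) ⟩
        ∑₁′ + (∑₂′ + ∑₃′ + 2 * ∑₄′)                  ≡⟨ cong (∑₁′ +_) (sym split′) ⟩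
        ∑₁′ + sum (λ s → # (λ t → Ch₂? t s) + # (λ t → Ch₃? t s) + 2 * # (λ t → Ch₄? t s))
                                                     ≤⟨ +-monoʳ-≤ ∑₁′ (sum-mono per-s) ⟩
        ∑₁′ + sum (λ s → (2 * r) * m s)              ≡⟨ cong (∑₁′ +_) (sym (*-distribˡ-sum (2 * r) m)) ⟩
        ∑₁′ + (2 * r) * sum m                        ≡⟨ cong (λ a → ∑₁′ + (2 * r) * a) (∑-comm (λ s w → 𝟙 (Priv? w s))) ⟩
        ∑₁′ + (2 * r) * sum privs                    ≡⟨ cong (∑₁′ +_) (*-distribˡ-sum (2 * r) privs) ⟩
        ∑₁′ + sum (λ w → (2 * r) * privs w)          ≡⟨ sym (∑-distrib-+ (λ w → # (λ t → Ch₁? t w)) (λ w → (2 * r) * privs w)) ⟩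
        sum (λ w → # (λ t → Ch₁? t w) + (2 * r) * privs w)
                                                     ≤⟨ sum-mono per-w ⟩
        sum (λ w → 2 * σ w)                          ≡⟨ sym (*-distribˡ-sum 2 σ) ⟩
        2 * sum σ                                    ∎)
        where
        open ≤-Reasoning
        ∑₁ = sum (λ t → # (Ch₁? t))
        ∑₂ = sum (λ t → # (Ch₂? t))
        ∑₃ = sum (λ t → # (Ch₃? t))
        ∑₄ = sum (λ t → # (Ch₄? t))
        ∑₁′ = sum (λ w → # (λ t → Ch₁? t w))
        ∑₂′ = sum (λ s → # (λ t → Ch₂? t s))
        ∑₃′ = sum (λ s → # (λ t → Ch₃? t s))
        ∑₄′ = sum (λ s → # (λ t → Ch₄? t s))
        split₃ : ∀ (f g h : Fin n → ℕ) → sum (λ t → f t + g t + 2 * h t) ≡ sum f + sum g + 2 * sum h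
        split₃ f g h = trans (∑-distrib-+ (λ t → f t + g t) (λ t → 2 * h t))
                             (cong₂ _+_ (∑-distrib-+ f g) (sym (*-distribˡ-sum 2 h)))
        split = split₃ (λ t → # (Ch₂? t)) (λ t → # (Ch₃? t)) (λ t → # (Ch₄? t))
        split′ = split₃ (λ s → # (λ t → Ch₂? t s)) (λ s → # (λ t → Ch₃? t s)) (λ s → # (λ t → Ch₄? t s))

      E? : ∀ w → Decidable (λ y → w ∉ S × (y ∈ S × w ~ y))
      E? w y = ¬? (w ∈? S) ×-dec dS? w y

      edges : k * size S ≤ sum (λ w → # (E? w))
      edges = begin
        k * size S                         ≡⟨ *-distribˡ-sum k (λ y → 𝟙 (y ∈? S)) ⟩
        sum (λ y → k * 𝟙 (y ∈? S))         ≤⟨ sum-mono pointwise ⟩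
        sum (λ y → # (λ w → E? w y))       ≡⟨ ∑-comm (λ y w → 𝟙 (E? w y)) ⟩
        sum (λ w → # (E? w))               ∎
        where
        open ≤-Reasoning
        pointwise : ∀ y → k * 𝟙 (y ∈? S) ≤ # (λ w → E? w y)
        pointwise y with y ∈? S in eq
        ... | no _ = ≤-trans (≤-reflexive (*-zeroʳ k)) z≤n
        ... | yes y∈ = ≤-trans (≤-reflexive (trans (*-identityʳ k) (sym (deg y))))
                         (#-mono (y ~?_) (λ w → ¬? (w ∈? S) ×-dec (yes y∈ ×-dec (w ~? y)))
                                 λ w e → (λ w∈ → indep y∈ w∈ e) , y∈ , ~-sym e)

      balance : ∀ w → # (E? w) + σ w ≤ suc r * 𝟙 (¬? (w ∈? S)) + 𝟙 (J? w)
      balance w with w ∈? S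
      ... | yes w∈ = ≤-trans (≤-reflexive (+-identityʳ _))
                       (≤-trans (#≡0 (λ y → ¬? (yes w∈) ×-dec dS? w y) λ y p → proj₁ p w∈) z≤n)
      ... | no w∉ = ≤-trans (+-mono-≤ (#-mono (λ y → ¬? (no w∉) ×-dec dS? w y) (dS? w) λ y → proj₂) (≤-reflexive (+-identityʳ _)))
                      (≤-trans (case (dS w ≤? suc r)) (≤-reflexive (cong (_+ 𝟙 (J? w)) (sym (*-identityʳ (suc r))))))
        where
        case : Dec (dS w ≤ suc r) → dS w + (suc r ∸ dS w) ≤ suc r + 𝟙 (J? w)
        case (yes le) = ≤-trans (≤-reflexive (m+[n∸m]≡n le)) (m≤m+n _ _)
        case (no ¬le) = begin
          dS w + (suc r ∸ dS w)   ≡⟨ cong₂ (λ a b → a + (suc r ∸ b)) (J⇒dS jw) (J⇒dS jw) ⟩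
          k + (suc r ∸ k)         ≡⟨ trans (cong (k +_) (m≤n⇒m∸n≡0 (n≤1+n (suc r)))) (+-identityʳ k) ⟩
          k                       ≡⟨ +-comm 1 (suc r) ⟩
          suc r + 1               ≡⟨ cong (suc r +_) (sym (𝟙-yes (J? w) jw)) ⟩
          suc r + 𝟙 (J? w)        ∎
          where
          open ≤-Reasoning
          jw : J w
          jw = dS⇒J w∉ (≰⇒> ¬le)

      -- Summing `balance` and cancelling the surplus gives k|S| ≤ (k - 1)(n - |S|); it remains to
      -- add (k - 1)|S|.
      size-bound : (suc r + k) * size S ≤ suc r * n
      size-bound = begin
        (suc r + k) * size S              ≡⟨ *-distribʳ-+ (size S) (suc r) k ⟩
        suc r * size S + k * size S       ≤⟨ +-monoʳ-≤ (suc r * size S) k|S|≤ ⟩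
        suc r * size S + suc r * # out    ≡⟨ sym (*-distribˡ-+ (suc r) (size S) _) ⟩
        suc r * (size S + # out)          ≤⟨ *-monoʳ-≤ (suc r) (≤-trans (#-⊎ (λ _ → yes tt) (_∈? S) out _ _ (λ v p q → q p)) (#≤n {n} (λ _ → yes tt))) ⟩
        suc r * n                         ∎
        where
        open ≤-Reasoning
        out : Decidable (_∉ S)
        out w = ¬? (w ∈? S)
        k|S|≤ : k * size S ≤ suc r * # out
        k|S|≤ = +-cancelʳ-≤ (sum σ) _ _ (begin
          k * size S + sum σ                                    ≤⟨ +-monoˡ-≤ (sum σ) edges ⟩
          sum (λ w → # (E? w)) + sum σ                          ≡⟨ sym (∑-distrib-+ (λ w → # (E? w)) σ) ⟩
          sum (λ w → # (E? w) + σ w)                            ≤⟨ sum-mono balance ⟩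
          sum (λ w → suc r * 𝟙 (out w) + 𝟙 (J? w))              ≡⟨ ∑-distrib-+ (λ w → suc r * 𝟙 (out w)) (λ w → 𝟙 (J? w)) ⟩
          sum (λ w → suc r * 𝟙 (out w)) + # J?                  ≡⟨ cong (_+ # J?) (sym (*-distribˡ-sum (suc r) (λ w → 𝟙 (out w)))) ⟩
          suc r * # out + # J?                                  ≤⟨ +-monoʳ-≤ (suc r * # out) J≤Σσ ⟩
          suc r * # out + sum σ                                 ∎)

  -- Recognising the complete bipartite graph

  rank : ∀ {Q : Fin n → Set} → Decidable Q → Fin n → ℕ
  rank Q? v = # (λ u → Q? u ×-dec (u FinP.<? v))

  rank<# : ∀ {Q : Fin n → Set} (Q? : Decidable Q) {v} → Q v → rank Q? v < # Q?
  rank<# Q? {v} q = ≤-trans (≤-reflexive (+-comm 1 _))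
    (#-⊎⁅⁆ Q? (λ u → Q? u ×-dec (u FinP.<? v)) v (λ u → proj₁) q (λ p → FinP.<-irrefl refl (proj₂ p)))

  rank-mono : ∀ {Q : Fin n → Set} (Q? : Decidable Q) {u v} → Q u → u Fin.< v → rank Q? u < rank Q? v
  rank-mono Q? {u} {v} q u<v = ≤-trans (≤-reflexive (+-comm 1 _))
    (#-⊎⁅⁆ (λ w → Q? w ×-dec (w FinP.<? v)) (λ w → Q? w ×-dec (w FinP.<? u)) u
           (λ w p → proj₁ p , FinP.<-trans (proj₂ p) u<v) (q , u<v) (λ p → FinP.<-irrefl refl (proj₂ p)))

  rank-injective : ∀ {Q : Fin n → Set} (Q? : Decidable Q) {u v} → Q u → Q v → rank Q? u ≡ rank Q? v → u ≡ v
  rank-injective Q? {u} {v} p q eq with FinP.<-cmp u v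
  ... | tri< u<v _ _ = ⊥-elim (<⇒≢ (rank-mono Q? p u<v) eq)
  ... | tri≈ _ u≡v _ = u≡v
  ... | tri> _ _ v<u = ⊥-elim (<⇒≢ (rank-mono Q? q v<u) (sym eq))

  injective⇒surjective : ∀ {m} (f : Fin n → Fin m) → (∀ {u v} → f u ≡ f v → u ≡ v) → m ≤ n → ∀ y → ∃[ x ] f x ≡ y
  injective⇒surjective {suc m} f inj m≤n y with any? (λ x → f x ≟ y)
  ... | yes e = e
  ... | no ¬e = ⊥-elim (<⇒≱ m≤n (FinP.injective⇒≤ {f = λ x → punchOut (y≢ x)} λ {u} {v} eq → inj (FinP.punchOut-injective (y≢ u) (y≢ v) eq)))
    where
    y≢ : ∀ x → y ≢ f x
    y≢ x eq = ¬e (x , sym eq)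

  module Bipartition {P : Fin n → Set} (P? : Decidable P) (#P : # P? ≡ k) (#¬P : # (λ v → ¬? (P? v)) ≡ k)
                     (adj-xor : ∀ u v → adj G u v ≡ xor ⌊ P? u ⌋ ⌊ P? v ⌋) where

    ¬P? : Decidable (λ v → ¬ P v)
    ¬P? v = ¬? (P? v)

    -- Numbering each side by rank, P first, matches the split that `isLow` makes in
    -- `CompleteBipartite`.
    position : ∀ v → Dec (P v) → ℕ
    position v (yes _) = rank P? v
    position v (no _) = k + rank ¬P? v

    position< : ∀ v d → position v d < k + k
    position< v (yes p) = ≤-trans (≤-trans (rank<# P? p) (≤-reflexive #P)) (m≤m+n k k)
    position< v (no ¬p) = +-monoʳ-< k (≤-trans (rank<# ¬P? ¬p) (≤-reflexive #¬P))

    position-injective : ∀ {u v} d e → position u d ≡ position v e → u ≡ v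
    position-injective (yes p) (yes q) eq = rank-injective P? p q eq
    position-injective {u} {v} (yes p) (no _) eq =
      ⊥-elim (<⇒≱ (≤-trans (rank<# P? p) (≤-reflexive #P)) (≤-trans (m≤m+n k (rank ¬P? v)) (≤-reflexive (sym eq))))
    position-injective {u} {v} (no _) (yes q) eq =
      ⊥-elim (<⇒≱ (≤-trans (rank<# P? q) (≤-reflexive #P)) (≤-trans (m≤m+n k (rank ¬P? u)) (≤-reflexive eq)))
    position-injective (no ¬p) (no ¬q) eq = rank-injective ¬P? ¬p ¬q (+-cancelˡ-≡ k _ _ eq)

    abstract
      f : Fin n → Fin (k + k)
      f v = fromℕ< (position< v (P? v))

      toℕ-f : ∀ v → toℕ (f v) ≡ position v (P? v)
      toℕ-f v = FinP.toℕ-fromℕ< (position< v (P? v))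

      f-injective : ∀ {u v} → f u ≡ f v → u ≡ v
      f-injective {u} {v} eq = position-injective (P? u) (P? v)
        (trans (sym (toℕ-f u)) (trans (cong toℕ eq) (toℕ-f v)))

      low : ∀ v d → ⌊ position v d <? k ⌋ ≡ ⌊ d ⌋
      low v (yes p) with rank P? v <? k
      ... | yes _ = refl
      ... | no ¬lt = ⊥-elim (¬lt (≤-trans (rank<# P? p) (≤-reflexive #P)))
      low v (no _) with k + rank ¬P? v <? k
      ... | no _ = refl
      ... | yes lt = ⊥-elim (<⇒≱ lt (m≤m+n k _))

      isLow-f : ∀ v → isLow k (f v) ≡ ⌊ P? v ⌋
      isLow-f v = trans (cong (λ i → ⌊ i <? k ⌋) (toℕ-f v)) (low v (P? v))

    k+k≤n : k + k ≤ n
    k+k≤n = ≤-trans (≤-reflexive (cong₂ _+_ (sym #P) (sym #¬P)))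
              (≤-trans (#-⊎ (λ _ → yes tt) P? ¬P? _ _ (λ v p ¬p → ¬p p)) (#≤n {n} (λ _ → yes tt)))

    iso : G ≅ CompleteBipartite k
    iso = record
      { bij = mk⤖ (f-injective , λ y → proj₁ (sur y) , λ { refl → proj₂ (sur y) })
      ; preserve = λ u v → trans (cong₂ xor (isLow-f u) (isLow-f v)) (sym (adj-xor u v)) }
      where
      sur : ∀ y → ∃[ x ] f x ≡ y
      sur = injective⇒surjective f f-injective k+k≤n

  module _ (connected : Connected G) (t : Fin n) (many : k ≤ # (t ⊆ᴺ?_)) where
    private
      -- A neighbour y of t sees all twins of t; as there are k of them, it sees nothing else.
      N⇒twins : ∀ {y v} → t ~ y → y ~ v → t ⊆ᴺ v
      N⇒twins {y} {v} t~y = #⊆⇒⊇ (t ⊆ᴺ?_) (y ~?_) (λ u tw → ~-sym (tw y t~y)) (≤-trans (≤-reflexive (deg y)) many) v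

      disjoint : ∀ {v} → t ~ v → ¬ t ⊆ᴺ v
      disjoint {v} e tw = ~⇒≢ (tw v e) refl

      -- Walks alternate between the neighbours and the twins of t, so connectedness leaves no third
      -- kind of vertex.
      reach : ∀ {u v} → Walk G u v → t ~ u ⊎ t ⊆ᴺ u → t ~ v ⊎ t ⊆ᴺ v
      reach [] side = side
      reach (e ∷ w) (inj₁ t~u) = reach w (inj₂ (N⇒twins t~u e))
      reach (e ∷ w) (inj₂ tw) = reach w (inj₁ (⊆ᴺ-sym tw _ e))

      side : ∀ v → t ~ v ⊎ t ⊆ᴺ v
      side v = reach (connected t v) (inj₂ λ _ e → e)

      twin : ∀ {v} → ¬ t ~ v → t ⊆ᴺ v
      twin {v} ¬e = [ (λ e → ⊥-elim (¬e e)) , id ] (side v)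

      adj-true : ∀ {u v} → u ~ v → adj G u v ≡ true
      adj-true {u} {v} e with adj G u v
      ... | true = refl

      adj-false : ∀ {u v} → ¬ u ~ v → adj G u v ≡ false
      adj-false {u} {v} ¬e with adj G u v
      ... | true = ⊥-elim (¬e tt)
      ... | false = refl

      adj-xor : ∀ u v → adj G u v ≡ xor ⌊ t ~? u ⌋ ⌊ t ~? v ⌋
      adj-xor u v with t ~? u | t ~? v
      ... | yes e | yes e′ = adj-false λ e″ → disjoint e′ (N⇒twins e e″)
      ... | yes e | no ¬e′ = adj-true (~-sym (twin ¬e′ u e))
      ... | no ¬e | yes e′ = adj-true (twin ¬e v e′)
      ... | no ¬e | no ¬e′ = adj-false λ e″ → ¬e′ (⊆ᴺ-sym (twin ¬e) v e″)

      #twins : # (λ v → ¬? (t ~? v)) ≡ k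
      #twins = ≤-antisym upper (≤-trans many (#-mono (t ⊆ᴺ?_) (λ v → ¬? (t ~? v)) λ v tw e → disjoint e tw))
        where
        upper : # (λ v → ¬? (t ~? v)) ≤ k
        upper with 1≤#⇒∃ (t ~?_) (≤-trans (s≤s z≤n) (≤-reflexive (sym (deg t))))
        ... | y , t~y = ≤-trans (#-mono (λ v → ¬? (t ~? v)) (y ~?_) λ v ¬e → ~-sym (twin ¬e y t~y)) (≤-reflexive (deg y))

    twins⇒bipartite : G ≅ CompleteBipartite k
    twins⇒bipartite = Bipartition.iso (t ~?_) (deg t) #twins adj-xor

  bound : Connected G → ¬ (G ≅ CompleteBipartite k) → ∃[ S ] (ID S × (suc r + k) * ∣ S ∣ ≤ suc r * n)
  bound connected ¬iso = from-optimal (optimal-exists (proj₁ start) (proj₁ (proj₂ start)))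
    where
    start : ∃[ X ] ID X × (∀ v → v ∈ X → ⊥ ⊎ (∀ u → ⊥ → ¬ u ~ v))
    -- Extending the empty set yields an independent dominating set from which the minimisation can
    -- start.
    start = extend {λ _ → ⊥} (λ _ → no id) (λ ())
    few-twins : ∀ t → # (t ⊆ᴺ?_) ≤ suc r
    few-twins t = ≤-pred (≰⇒> λ many → ¬iso (twins⇒bipartite connected t many))
    from-optimal : ∃ Optimal → ∃[ S ] (ID S × (suc r + k) * ∣ S ∣ ≤ suc r * n)
    from-optimal (S , opt) = S , Optimal.S-ID opt ,
      subst (λ s → (suc r + k) * s ≤ suc r * n) (sym (∣∣≡# S)) (Charging.size-bound S opt few-twins)

theorem2 : (k : ℕ) → 3 ≤ k → (n : ℕ) → (G : Graph n) →
    Connected G → Regular k G → ¬ (G ≅ CompleteBipartite k) →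
    ∃[ S ] (IndependentDominating G S × (2 * k ∸ 1) * ∣ S ∣ ≤ (k ∸ 1) * n)
theorem2 (suc (suc r)) (s≤s (s≤s 1≤r)) n G connected regular ¬iso =
  from-bound (RegularGraph.bound G r 1≤r regular connected ¬iso)
  where
  eq : suc r + suc (suc r) ≡ 2 * suc (suc r) ∸ 1
  eq = cong (λ a → suc (r + a)) (sym (+-identityʳ (suc (suc r))))
  from-bound : ∃[ S ] (IndependentDominating G S × (suc r + suc (suc r)) * ∣ S ∣ ≤ suc r * n) →
               ∃[ S ] (IndependentDominating G S × (2 * suc (suc r) ∸ 1) * ∣ S ∣ ≤ suc r * n)
  from-bound (S , S-ID , le) = S , S-ID , subst (λ c → c * ∣ S ∣ ≤ suc r * n) eq le
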